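{- Let $G_1,G_2,G_3$ be critical snarks, and for each $i\in\{1,2,3\}$ let $e_i$ be an edge and $w_i$ a vertex of $G_i$ (not an endvertex of $e_i$) such that the $(2,3)$-pole $T_i=(G_i-e_i)-w_i$ is proper, perfect and good. Then the graph $H_6*\operatorname{TTT}_{\mathrm{sc}}(T_1,T_2,T_3)$ is a strictly critical snark.
   Context: Snarks: a snark is a connected cubic graph with chromatic index $4$; it is critical if removing any two distinct adjacent vertices yields a $3$-edge-colourable graph, bicritical if removing any two distinct vertices yields a $3$-edge-colourable graph, and strictly critical if critical but not bicritical. Multipoles: a multipole is a graph that may contain dangling edges (edges with only one end incident with a vertex) and isolated edges (edges with no end incident with a vertex); an edge end not incident with a vertex is a semiedge. All multipoles here are cubic (every vertex is incident with exactly three edge ends). The semiedges are partitioned into linearly ordered connectors; a multipole with connectors of widths $k_1,\dots,k_t$ is a $(k_1,\dots,k_t)$-pole. A junction of two semiedges joins them into one edge; a junction of two connectors of equal width joins their semiedges pairwise in order. For a graph/multipole $G$ and a vertex $v$, $G-v$ denotes the multipole obtained by deleting $v$ and turning its three incident edges into dangling edges (their free ends forming a new connector); for a link (edge with both ends at vertices) $e$, $G-e$ denotes the multipole obtained by cutting $e$ into two dangling edges forming a new $2$-connector. Thus $(G-e)-v$ is a $(2,3)$-pole $T(B,C)$ with $B$ the two semiedges from $e$ and $C$ the three semiedges from $v$. For a vertex $v$ incident with exactly one dangling edge, $M\sim v$ denotes the multipole obtained by deleting that dangling edge and suppressing $v$. Colourings: let $\mathbb{K}=\mathbb{Z}_2\times\mathbb{Z}_2\setminus\{(0,0)\}$.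 A colouring of a multipole assigns elements of $\mathbb{K}$ to edges so that the three edge ends at each vertex have colours summing to $0$ (equivalently, pairwise distinct). For a colouring $\varphi$ and a connector $S$, the flow through $S$ is $\varphi_*(S)=\sum_{e\in S}\varphi(e)$. A multipole is proper if $\varphi_*(S)\neq 0$ for every colouring $\varphi$ and every connector $S$. The colouring set $\operatorname{Col}(M)$ is the set of tuples of colours of the semiedges (listed connector by connector) over all colourings. A proper $(2,3)$-pole $T(B,C)$ is perfect if $\operatorname{Col}(T)$ contains every tuple $(x_1,x_2,y_1,y_2,y_3)\in\mathbb{K}^5$ with $x_1+x_2\neq 0$, $y_1+y_2+y_3\neq0$ and $x_1+x_2+y_1+y_2+y_3=0$. Essential and good: a pair $\{e,f\}$ of distinct edges of a snark $G$ is essential if $G-e-f$ (the graph with both edges deleted) is $3$-edge-colourable and for every vertex $v$ of the $4$-pole $G-(e,f)$ incident with a dangling edge, the $3$-pole $(G-(e,f))\sim v$ is colourable. A proper $(2,3)$-pole $T=(G-e)-v$ is good if for every endvertex $w$ of $e$ and every pair of edges $f,g$ with $f$ incident with $w$ and $g$ incident with $v$, the pair $\{f,g\}$ is essential in $G$. Constructions: for $(2,3)$-poles $T_i(B_i,C_i)$, $i=1,2,3$, $\operatorname{TTT}_{\mathrm{sc}}(T_1,T_2,T_3)$ is the $(2,2,2)$-pole with connectors $B_1,B_2,B_3$ obtained from $T_1\cup T_2\cup T_3$ by adding three new vertices $v_1,v_2,v_3$ and attaching the three dangling edges of each $C_i$ to $v_1,v_2,v_3$, one to each. $H_6$ is the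 $(2,2,2)$-pole consisting of a $6$-cycle $u_1u_2u_3u_4u_5u_6$ with a dangling edge $e_j$ attached to $u_j$ for each $j$, with connectors $(e_1,e_4),(e_2,e_5),(e_3,e_6)$. $H_6*\operatorname{TTT}_{\mathrm{sc}}(T_1,T_2,T_3)$ is the cubic graph obtained by joining the $i$-th connector of $H_6$ with $B_i$ for $i=1,2,3$. -}

module Defs where

open import Data.Nat using (ℕ; zero; suc; pred; _+_; _<_)
open import Data.Fin using (Fin; zero; suc; punchIn; punchOut; _↑ˡ_; _↑ʳ_; splitAt; inject₁; fromℕ)
open import Data.Fin.Properties using (_≟_)
open import Data.Unit using (⊤; tt)
open import Data.Bool using (Bool; true; false; _∧_; _∨_; _xor_; not; T)
open import Data.Maybe using (Maybe; just; nothing; _>>=_)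
import Data.Maybe as Maybe
open import Data.List using (List; []; _∷_; _++_; map; concatMap; mapMaybe; filterᵇ; allFin; length; null; foldr)
open import Data.List.Relation.Unary.All using (All)
open import Data.List.Relation.Unary.AllPairs using (AllPairs)
open import Data.Product using (Σ; ∃; _×_; _,_; proj₁; proj₂)
open import Data.Sum using (_⊎_; inj₁; inj₂)
open import Relation.Nullary using (¬_; yes; no)
open import Relation.Nullary.Decidable using (⌊_⌋)
open import Relation.Binary.PropositionalEquality using (_≡_; _≢_)
open import Relation.Binary.Construct.Closure.ReflexiveTransitive using (Star)

Z2² : Set
Z2² = Bool × Bool

0₂ : Z2²
0₂ = false , false

_⊕_ : Z2² → Z2² → Z2²
(a , b) ⊕ (c , d) = (a xor c) , (b xor d)

nz : Z2² → Bool
nz (a , b) = a ∨ b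

-- K as the subset of nonzero elements (proofs of 'T _' are unique)
K : Set
K = Σ Z2² (λ x → T (nz x))

-- Multipoles.  Vertices are Fin nV, edges Fin nE; every edge has two
-- ends (sides L and R); an end is either incident with a vertex
-- (just v) or free, i.e. a semiedge (nothing).  Connectors are
-- linearly ordered lists of semiedges, each semiedge being named by
-- (edge , side).

data Side : Set where
  L R : Side

flipS : Side → Side
flipS L = R
flipS R = L

_==S_ : Side → Side → Bool
L ==S L = true
R ==S R = true
_ ==S _ = false

record Multipole : Set where
  field
    nV nE : ℕ
    end   : Fin nE → Side → Maybe (Fin nV)
    conns : List (List (Fin nE × Side))
open Multipole public

EndOf : Multipole → Set
EndOf M = Fin (nE M) × Side

_==F_ : ∀ {n} → Fin n → Fin n → Bool
i ==F j = ⌊ i ≟ j ⌋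

atVertex : ∀ {n} → Fin n → Maybe (Fin n) → Bool
atVertex v (just u) = u ==F v
atVertex v nothing  = false

isFree : ∀ {n} → Maybe (Fin n) → Bool
isFree (just _) = false
isFree nothing  = true

allEnds : (M : Multipole) → List (EndOf M)
allEnds M = concatMap (λ e → (e , L) ∷ (e , R) ∷ []) (allFin (nE M))

endsAt : (M : Multipole) → Fin (nV M) → List (EndOf M)
endsAt M v = filterᵇ (λ p → atVertex v (end M (proj₁ p) (proj₂ p))) (allEnds M)

Cubic : Multipole → Set
Cubic M = ∀ v → length (endsAt M v) ≡ 3

IsGraph : Multipole → Set
IsGraph M = (conns M ≡ []) × (∀ e s → ∃ λ v → end M e s ≡ just v)

Adjacent : (M : Multipole) → Fin (nV M) → Fin (nV M) → Set
Adjacent M u v = ∃ λ e → (end M e L ≡ just u × end M e R ≡ just v)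
                        ⊎ (end M e L ≡ just v × end M e R ≡ just u)

Connected : Multipole → Set
Connected M = ∀ u v → Star (Adjacent M) u v

ProperColouring : (C : Set) (M : Multipole) → (Fin (nE M) → C) → Set
ProperColouring C M φ =
  ∀ v → AllPairs (λ a b → φ (proj₁ a) ≢ φ (proj₁ b)) (endsAt M v)

EdgeColourable : (C : Set) → Multipole → Set
EdgeColourable C M = ∃ λ (φ : Fin (nE M) → C) → ProperColouring C M φ

_EdgeColourableWith_ : Multipole → ℕ → Set
M EdgeColourableWith k = EdgeColourable (Fin k) M

ChromaticIndex : Multipole → ℕ → Set
ChromaticIndex M k = (M EdgeColourableWith k) × (∀ j → j < k → ¬ (M EdgeColourableWith j))

Colouring : (M : Multipole) → (Fin (nE M) → K) → Set
Colouring M φ = ProperColouring K M φ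

Colourable : Multipole → Set
Colourable M = EdgeColourable K M

Snark : Multipole → Set
Snark G = IsGraph G × Cubic G × Connected G × ChromaticIndex G 4

removeIdx : ∀ {n} → Fin n → Fin n → Maybe (Fin (pred n))
removeIdx {suc n} v u with v ≟ u
... | yes _ = nothing
... | no ¬p = just (punchOut ¬p)

skip : ∀ {n} → Fin n → Fin (pred n) → Fin n
skip {suc n} d i = punchIn d i

unlast : ∀ {n} → Fin (suc n) → Maybe (Fin n)
unlast {zero}  zero    = nothing
unlast {suc n} zero    = just zero
unlast {suc n} (suc i) = Maybe.map suc (unlast i)

reEnd : ∀ {n m} → (Fin n → Maybe (Fin m)) → Fin n × Side → Maybe (Fin m × Side)
reEnd f (i , t) = Maybe.map (λ j → j , t) (f i)

nthConn : (M : Multipole) → ℕ → List (EndOf M)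
nthConn M n = go (conns M) n
  where
  go : List (List (EndOf M)) → ℕ → List (EndOf M)
  go []       _       = []
  go (c ∷ cs) zero    = c
  go (c ∷ cs) (suc n) = go cs n

dropEmptyConns : Multipole → Multipole
dropEmptyConns M = record M { conns = filterᵇ (λ c → not (null c)) (conns M) }

deleteVertex : (M : Multipole) → Fin (nV M) → Multipole
deleteVertex M v = record
  { nV = pred (nV M) ; nE = nE M
  ; end = λ e s → end M e s >>= removeIdx v
  ; conns = conns M ++ (endsAt M v ∷ []) }

-- G - e : cut the edge e into two dangling edges forming a new
-- 2-connector (e keeps its L end, a new last edge gets its R end)
cutEdge : (M : Multipole) → Fin (nE M) → Multipole
cutEdge M e = record
  { nV = nV M ; nE = suc (nE M)
  ; end = end'
  ; conns = map (map (λ p → inject₁ (proj₁ p) , proj₂ p)) (conns M)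
            ++ (((inject₁ e , R) ∷ (fromℕ (nE M) , R) ∷ []) ∷ []) }
  where
  end' : Fin (suc (nE M)) → Side → Maybe (Fin (nV M))
  end' i t with unlast i
  ... | nothing = half t
    where half : Side → Maybe (Fin (nV M))
          half L = end M e R
          half R = nothing
  ... | just j with j ≟ e
  ...   | yes _ = half t
    where half : Side → Maybe (Fin (nV M))
          half L = end M e L
          half R = nothing
  ...   | no _  = end M j t

deleteEdge : (M : Multipole) → Fin (nE M) → Multipole
deleteEdge M d = record
  { nV = nV M ; nE = pred (nE M)
  ; end = λ i t → end M (skip d i) t
  ; conns = map (mapMaybe (reEnd (removeIdx d))) (conns M) }

-- suppressing a vertex v of degree 2 (incident with the ends a and b):
-- v is deleted and its two edges are merged into one
suppress2 : (M : Multipole) → Fin (nV M) → EndOf M → EndOf M → Multipole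
suppress2 M v (a , sa) (b , sb) = record
  { nV = pred (nV M) ; nE = pred (nE M)
  ; end = λ i t → raw (skip b i) t >>= removeIdx v
  ; conns = map (mapMaybe ren) (conns M) }
  where
  raw : Fin (nE M) → Side → Maybe (Fin (nV M))
  raw j t with (j ==F a) ∧ (t ==S sa)
  ... | true  = end M b (flipS sb)
  ... | false = end M j t
  ren : EndOf M → Maybe (Fin (pred (nE M)) × Side)
  ren (i , t) with i ==F b
  ... | true  = reEnd (removeIdx b) (a , sa)
  ... | false = reEnd (removeIdx b) (i , t)

suppress : (M : Multipole) → Fin (nV M) → Multipole
suppress M v = go (endsAt M v)
  where
  go : List (EndOf M) → Multipole
  go (a ∷ b ∷ []) = suppress2 M v a b
  go _            = M     -- not used: v is not of degree 2

-- M ~ v, for the dangling edge d incident with v: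
-- delete d and suppress v
tildeVia : (M : Multipole) → Fin (nE M) → Fin (nV M) → Multipole
tildeVia M d v = suppress (deleteEdge M d) v

_⊎M_ : Multipole → Multipole → Multipole
M₁ ⊎M M₂ = record
  { nV = nV M₁ + nV M₂ ; nE = nE M₁ + nE M₂
  ; end = end'
  ; conns = map (map (λ p → (proj₁ p ↑ˡ nE M₂) , proj₂ p)) (conns M₁)
         ++ map (map (λ p → (nE M₁ ↑ʳ proj₁ p) , proj₂ p)) (conns M₂) }
  where
  end' : Fin (nE M₁ + nE M₂) → Side → Maybe (Fin (nV M₁ + nV M₂))
  end' i t with splitAt (nE M₁) i
  ... | inj₁ j = Maybe.map (_↑ˡ nV M₂) (end M₁ j t)
  ... | inj₂ j = Maybe.map (nV M₁ ↑ʳ_) (end M₂ j t)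

addVertices : Multipole → ℕ → Multipole
addVertices M k = record
  { nV = nV M + k ; nE = nE M
  ; end = λ e t → Maybe.map (_↑ˡ k) (end M e t)
  ; conns = conns M }

attach : (M : Multipole) → EndOf M → Fin (nV M) → Multipole
attach M (e , s) x = record
  { nV = nV M ; nE = nE M
  ; end = λ i t → if' ((i ==F e) ∧ (t ==S s)) (just x) (end M i t)
  ; conns = map (filterᵇ (λ p → not ((proj₁ p ==F e) ∧ (proj₂ p ==S s)))) (conns M) }
  where
  if' : ∀ {A : Set} → Bool → A → A → A
  if' true  a _ = a
  if' false _ b = b

attachAll : (M : Multipole) → List (EndOf M × Fin (nV M)) → Multipole
attachAll M []              = M
attachAll M ((p , x) ∷ ps)  = attachAll (attach M p x) ps

-- junction of two semiedges (e , s) and (e' , s'): they are joined into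
-- one edge (the edge e survives, e' is deleted)
junction1 : (M : Multipole) → EndOf M → EndOf M → Multipole
junction1 M (e , s) (e' , s') = record
  { nV = nV M ; nE = pred (nE M)
  ; end = λ i t → raw (skip e' i) t
  ; conns = map (mapMaybe ren) (conns M) }
  where
  raw : Fin (nE M) → Side → Maybe (Fin (nV M))
  raw j t with (j ==F e) ∧ (t ==S s)
  ... | true  = end M e' (flipS s')
  ... | false = end M j t
  ren : EndOf M → Maybe (Fin (pred (nE M)) × Side)
  ren (i , t) with ((i ==F e) ∧ (t ==S s)) ∨ ((i ==F e') ∧ (t ==S s'))
  ... | true  = nothing
  ... | false with i ==F e'
  ...   | true  = reEnd (removeIdx e') (e , s)
  ...   | false = reEnd (removeIdx e') (i , t)

-- junction of the p-th and q-th connectors (pairwise, in order);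
-- the first argument bounds the width
junctionConns : ℕ → Multipole → ℕ → ℕ → Multipole
junctionConns zero    M p q = M
junctionConns (suc k) M p q = go (nthConn M p) (nthConn M q)
  where
  go : List (EndOf M) → List (EndOf M) → Multipole
  go (a ∷ _) (b ∷ _) = junctionConns k (junction1 M a b) p q
  go _       _       = M

-- The (2,3)-pole T = (G - e) - w, with connectors B (from e), C (from w)

T23 : (G : Multipole) → Fin (nE G) → Fin (nV G) → Multipole
T23 G e w = deleteVertex (cutEdge G e) w

flow : (M : Multipole) → (Fin (nE M) → K) → List (EndOf M) → Z2²
flow M φ S = foldr (λ p acc → proj₁ (φ (proj₁ p)) ⊕ acc) 0₂ S

Proper : Multipole → Set
Proper M = ∀ φ → Colouring M φ → All (λ S → flow M φ S ≢ 0₂) (conns M)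

colTuple : (M : Multipole) → (Fin (nE M) → K) → List (List K)
colTuple M φ = map (map (λ p → φ (proj₁ p))) (conns M)

_∈Col_ : List (List K) → Multipole → Set
t ∈Col M = ∃ λ φ → Colouring M φ × colTuple M φ ≡ t

Perfect : Multipole → Set
Perfect T = Proper T ×
  (∀ (x₁ x₂ y₁ y₂ y₃ : K) →
     proj₁ x₁ ⊕ proj₁ x₂ ≢ 0₂ →
     proj₁ y₁ ⊕ (proj₁ y₂ ⊕ proj₁ y₃) ≢ 0₂ →
     proj₁ x₁ ⊕ (proj₁ x₂ ⊕ (proj₁ y₁ ⊕ (proj₁ y₂ ⊕ proj₁ y₃))) ≡ 0₂ →
     ((x₁ ∷ x₂ ∷ []) ∷ (y₁ ∷ y₂ ∷ y₃ ∷ []) ∷ []) ∈Col T)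

Incident : (G : Multipole) → Fin (nE G) → Fin (nV G) → Set
Incident G f w = ∃ λ s → end G f s ≡ just w

ColourableAfterRemoving : (G : Multipole) → Fin (nV G) → Fin (nV G) → Set
ColourableAfterRemoving G u v =
  ∃ λ v' → removeIdx u v ≡ just v' × (deleteVertex (deleteVertex G u) v' EdgeColourableWith 3)

Critical : Multipole → Set
Critical G = ∀ u v → u ≢ v → Adjacent G u v → ColourableAfterRemoving G u v

Bicritical : Multipole → Set
Bicritical G = ∀ u v → u ≢ v → ColourableAfterRemoving G u v

StrictlyCritical : Multipole → Set
StrictlyCritical G = Critical G × ¬ Bicritical G

cut2 : (G : Multipole) → Fin (nE G) → Fin (nE G) → Multipole
cut2 G f g = cutEdge (cutEdge G f) (inject₁ g)

Essential : (G : Multipole) → Fin (nE G) → Fin (nE G) → Set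
Essential G f g =
  ∃ λ g' → removeIdx f g ≡ just g'
    × (deleteEdge (deleteEdge G f) g' EdgeColourableWith 3)
    × (∀ d s v → end (cut2 G f g) d s ≡ just v
               → end (cut2 G f g) d (flipS s) ≡ nothing
               → Colourable (tildeVia (cut2 G f g) d v))

Good : (G : Multipole) → Fin (nE G) → Fin (nV G) → Set
Good G e v = ∀ w → Incident G e w → ∀ f g → Incident G f w → Incident G g v → Essential G f g

TTTsc : Multipole → Multipole → Multipole → Multipole
TTTsc T₁ T₂ T₃ = dropEmptyConns (attachAll U atts)
  where
  U : Multipole
  U = addVertices (T₁ ⊎M (T₂ ⊎M T₃)) 3
  newV : Fin 3 → Fin (nV U)
  newV k = nV (T₁ ⊎M (T₂ ⊎M T₃)) ↑ʳ k
  vs : List (Fin (nV U))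
  vs = newV zero ∷ newV (suc zero) ∷ newV (suc (suc zero)) ∷ []
  zipL : List (EndOf U) → List (Fin (nV U)) → List (EndOf U × Fin (nV U))
  zipL (a ∷ as) (x ∷ xs) = (a , x) ∷ zipL as xs
  zipL _ _ = []
  -- connectors of U are B₁ C₁ B₂ C₂ B₃ C₃
  atts : List (EndOf U × Fin (nV U))
  atts = zipL (nthConn U 1) vs ++ zipL (nthConn U 3) vs ++ zipL (nthConn U 5) vs

H6 : Multipole
H6 = record { nV = 6 ; nE = 12 ; end = end' ; conns = cs }
  where
  next : Fin 6 → Fin 6
  next zero = suc zero
  next (suc zero) = suc (suc zero)
  next (suc (suc zero)) = suc (suc (suc zero))
  next (suc (suc (suc zero))) = suc (suc (suc (suc zero)))
  next (suc (suc (suc (suc zero)))) = suc (suc (suc (suc (suc zero))))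
  next (suc (suc (suc (suc (suc zero))))) = zero
  -- edges 0..5: cycle edges u_j u_{j+1}; edges 6..11: dangling edge at u_j
  end' : Fin 12 → Side → Maybe (Fin 6)
  end' i t with splitAt 6 i
  ... | inj₁ j = half t
    where half : Side → Maybe (Fin 6)
          half L = just j
          half R = just (next j)
  ... | inj₂ j = half t
    where half : Side → Maybe (Fin 6)
          half L = just j
          half R = nothing
  dE : Fin 6 → Fin 12 × Side
  dE j = (6 ↑ʳ j) , R
  u : ℕ → Fin 6
  u zero = zero
  u (suc zero) = suc zero
  u (suc (suc zero)) = suc (suc zero)
  u (suc (suc (suc zero))) = suc (suc (suc zero))
  u (suc (suc (suc (suc zero)))) = suc (suc (suc (suc zero)))
  u _ = suc (suc (suc (suc (suc zero))))
  cs : List (List (Fin 12 × Side))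
  cs = (dE (u 0) ∷ dE (u 3) ∷ []) ∷ (dE (u 1) ∷ dE (u 4) ∷ []) ∷ (dE (u 2) ∷ dE (u 5) ∷ []) ∷ []

-- H₆ * M for a (2,2,2)-pole M: join the i-th connector of H₆ with the
-- i-th connector of M (i = 1, 2, 3)
H6⋆ : Multipole → Multipole
H6⋆ M = dropEmptyConns
  (junctionConns 2 (junctionConns 2 (junctionConns 2 (H6 ⊎M M) 0 3) 1 4) 2 5)

CriticalSnark : Multipole → Set
CriticalSnark G = Snark G × Critical G

StrictlyCriticalSnark : Multipole → Set
StrictlyCriticalSnark G = Snark G × StrictlyCritical G

Admissible : (G : Multipole) → Fin (nE G) → Fin (nV G) → Set
Admissible G e w =
  CriticalSnark G × ¬ Incident G e w
  × Proper (T23 G e w) × Perfect (T23 G e w) × Good G e w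

{-# OPTIONS --safe #-}
module Submission where

-- Properness makes the three flows through B₁, B₂, B₃ nonzero, and no
-- 3-edge-colouring of the 6-cycle in H₆ admits three nonzero flows; this
-- argument ignores the three new vertices, so it also shows that removing
-- two of them leaves the graph uncolourable.
--
-- For criticality, remove the ends of an edge.  If the edge lies in T₁, or
-- joins T₁ to a new vertex, criticality of G₁ colours what remains of G₁,
-- with zero flow through B₁; the other two poles are coloured with equal
-- flows, using perfection.  If the edge joins H₆ to an end u of e₁, then
-- goodness for a pair {e₁, g} with g incident with w₁ colours G₁ with one
-- half of e₁ deleted and u suppressed; by parity the flow through C₁ is the
-- colour of the other half, and if C₁ has colours y, then C₂ and C₃ are
-- coloured by ω y and ω² y, where ω generates the multiplicative group of
-- F₄ = Z₂ × Z₂.  If the edge lies on the 6-cycle, perfection alone suffices.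
-- The colourings of the 6-cycle used here are found by exhaustive search.
--
-- For connectedness, suppose that some new vertex is not in the component
-- of the 6-cycle.  The vertices of T₁ outside that component meet no
-- semiedge of B₁, so by parity the colours of the semiedges in C₁ that
-- they meet sum to zero in every colouring, contradicting perfection.

-- The choice of flows is forced. At a new vertex that is not removed the three colours sum to zero;
-- summing over all three new vertices, the flows through C₁, C₂, C₃ sum to zero. Hence a zero flow
-- in T₁ forces equal flows in T₂ and T₃, while a nonzero flow x in T₁ forces three nonzero flows
-- with sum zero, that is x, ω x and ω² x in some order. Goodness gives no control over the single
-- entries of y, only over their sum; multiplication by ω handles every y at once, because it is
-- additive and fixes no colour.
--
-- The formal obstacle is that the composite graph arises from a long chain of operations that
-- renumber edges and vertices. The graph is therefore reached only through symbolic names (`N`,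
-- `VN`) and one end map `en` on these names; the colouring arguments never compute with the
-- numbering of the composite.

open import Defs
open import Algebra.Bundles using (CommutativeMonoid)
open import Data.Bool using (Bool; true; false; T; _∧_; _∨_; not; if_then_else_)
open import Data.Empty using (⊥; ⊥-elim)
open import Data.Fin using (Fin; zero; suc; splitAt; _↑ˡ_; _↑ʳ_; inject₁; fromℕ; punchIn; punchOut; inject≤)
open import Data.Fin.Patterns using (0F; 1F; 2F; 3F; 4F; 5F)
open import Data.Fin.Properties using (_≟_; injective⇒≤; punchInᵢ≢i; punchIn-injective; punchIn-punchOut; punchOut-punchIn; punchOut-cong; splitAt-↑ˡ; splitAt-↑ʳ; splitAt⁻¹-↑ˡ; splitAt⁻¹-↑ʳ; inject₁-injective; fromℕ≢inject₁; all?; any?; inject≤-injective)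
open import Data.List using (List; []; _∷_; length; lookup; concatMap; allFin; _++_; map; mapMaybe; filterᵇ; null; zip)
open import Data.List.Membership.Propositional using (_∈_; _∉_)
open import Data.List.Membership.Propositional.Properties using (∈-lookup; ∈-allFin; ∈-filter⁺; ∈-filter⁻)
open import Data.List.Relation.Unary.All using (All; []; _∷_)
open import Data.List.Relation.Unary.AllPairs using (AllPairs; []; _∷_)
open import Data.List.Relation.Unary.Any using (here; there; index)
open import Data.List.Relation.Unary.Any.Properties using (lookup-index)
open import Data.List.Relation.Unary.Unique.Propositional using (Unique)
open import Data.Maybe using (Maybe; just; nothing; _>>=_)
open import Data.Maybe.Properties using (just-injective)
open import Data.Nat using (ℕ; zero; suc; pred; _+_; _<_; s≤s)
open import Data.Nat.Properties using (_<?_)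
open import Data.Product using (∃; _×_; _,_; proj₁; proj₂; Σ; ∃-syntax)
open import Data.Product.Properties using (≡-dec)
open import Data.Sum using (_⊎_; inj₁; inj₂; [_,_]′; swap)
open import Data.Unit using (tt; ⊤)
open import Level using (0ℓ)
open import Relation.Binary.Construct.Closure.ReflexiveTransitive using (Star; ε; _◅_; _◅◅_; reverse)
open import Relation.Binary.PropositionalEquality using (_≡_; _≢_; refl; sym; trans; cong; subst; ≢-sym; cong₂; module ≡-Reasoning; isEquivalence)
open import Relation.Nullary using (¬_; Dec; yes; no; contradiction; does)
open import Relation.Nullary.Decidable using (T?; dec-true; dec-false; toWitness; map′; True; ¬?; _×-dec_; _⊎-dec_; _→-dec_)
import Data.Bool.Properties as Boolₚ
import Data.List.Properties as Listₚ
import Data.List.Relation.Unary.All as All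
import Data.List.Relation.Unary.Unique.Propositional.Properties as Unique
import Data.Maybe as Maybe
import Data.Maybe.Properties as Maybeₚ
import Data.Nat.Properties as ℕₚ
import Data.Sum as Sum

-- Edge ends and proper colourings

variable
  A C E V : Set

At : (E → Side → Maybe V) → E × Side → V → Set
At en p v = en (proj₁ p) (proj₂ p) ≡ just v

-- Values are attached to edge ends rather than edges, because the two
-- halves of a cut edge may be coloured differently.
ProperAt : (E → Side → Maybe V) → (E × Side → C) → V → Set
ProperAt en val v = ∀ p q → At en p v → At en q v → p ≢ q → val p ≢ val q

-- The ends at a vertex as an injective family instead of the list `endsAt`. Cutting, deleting and
-- renaming may reorder such a list, but they transport a family end by end.
record Darts (n : ℕ) (en : E → Side → Maybe V) (v : V) : Set where
  field
    dart      : Fin n → E × Side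
    dart-inj  : ∀ {j k} → dart j ≡ dart k → j ≡ k
    dart-at   : ∀ k → At en (dart k) v
    dart-onto : ∀ p → At en p v → ∃ λ k → dart k ≡ p

lookup-injective : {xs : List A} → Unique xs → ∀ {i j} → lookup xs i ≡ lookup xs j → i ≡ j
lookup-injective (x∉ ∷ u) {zero}  {zero}  eq = refl
lookup-injective (x∉ ∷ u) {zero}  {suc j} eq = contradiction eq (All.lookup x∉ (∈-lookup j))
lookup-injective (x∉ ∷ u) {suc i} {zero}  eq = contradiction (sym eq) (All.lookup x∉ (∈-lookup i))
lookup-injective (x∉ ∷ u) {suc i} {suc j} eq = cong suc (lookup-injective u eq)

allPairs-from : {R : A → A → Set} {xs : List A} → Unique xs →
  (∀ {x y} → x ∈ xs → y ∈ xs → x ≢ y → R x y) → AllPairs R xs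
allPairs-from []       r = []
allPairs-from (x∉ ∷ u) r =
  All.tabulate (λ y∈ → r (here refl) (there y∈) (All.lookup x∉ y∈)) ∷
  allPairs-from u (λ x∈ y∈ → r (there x∈) (there y∈))

allPairs-to : {R : A → A → Set} → (∀ {x y} → R x y → R y x) → {xs : List A} → AllPairs R xs →
  ∀ {x y} → x ∈ xs → y ∈ xs → x ≢ y → R x y
allPairs-to s (r ∷ rs) (here refl) (here refl) n = contradiction refl n
allPairs-to s (r ∷ rs) (here refl) (there y∈)  n = All.lookup r y∈
allPairs-to s (r ∷ rs) (there x∈)  (here refl) n = s (All.lookup r x∈)
allPairs-to s (r ∷ rs) (there x∈)  (there y∈)  n = allPairs-to s rs x∈ y∈ n

∈-allEnds : (M : Multipole) (p : EndOf M) → p ∈ allEnds M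
∈-allEnds M (d , s) = go (∈-allFin d) s
  where
  go : ∀ {ds} → d ∈ ds → ∀ s → (d , s) ∈ concatMap (λ e → (e , L) ∷ (e , R) ∷ []) ds
  go (here refl) L = here refl
  go (here refl) R = there (here refl)
  go (there d∈)  s = there (there (go d∈ s))

allEnds-unique : (M : Multipole) → Unique (allEnds M)
allEnds-unique M = go (Unique.allFin⁺ (nE M))
  where
  apart : ∀ {d s} {ds : List (Fin (nE M))} → All (d ≢_) ds →
          All ((d , s) ≢_) (concatMap (λ e → (e , L) ∷ (e , R) ∷ []) ds)
  apart []       = []
  apart (n ∷ ns) = (λ eq → n (cong proj₁ eq)) ∷ (λ eq → n (cong proj₁ eq)) ∷ apart ns
  go : {ds : List (Fin (nE M))} → Unique ds →
       Unique (concatMap (λ e → (e , L) ∷ (e , R) ∷ []) ds)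
  go []       = []
  go (d∉ ∷ u) = ((λ ()) ∷ apart d∉) ∷ apart d∉ ∷ go u

atVertex-sound : ∀ {n} (v : Fin n) m → T (atVertex v m) → m ≡ just v
atVertex-sound v (just u) t with u ≟ v
... | yes refl = refl

atVertex-complete : ∀ {n} (v : Fin n) {m} → m ≡ just v → T (atVertex v m)
atVertex-complete v refl with v ≟ v
... | yes _ = tt
... | no n  = n refl

module _ (M : Multipole) (v : Fin (nV M)) where

  ∈-endsAt⁺ : ∀ {p} → At (end M) p v → p ∈ endsAt M v
  ∈-endsAt⁺ {p} at = ∈-filter⁺ _ (∈-allEnds M p) (atVertex-complete v at)

  ∈-endsAt⁻ : ∀ {p} → p ∈ endsAt M v → At (end M) p v
  ∈-endsAt⁻ {p} p∈ = atVertex-sound v _ (proj₂ (∈-filter⁻ (λ p → T? (atVertex v (end M (proj₁ p) (proj₂ p)))) {xs = allEnds M} p∈))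

  endsAt-unique : Unique (endsAt M v)
  endsAt-unique = Unique.filter⁺ _ (allEnds-unique M)

  listed-darts : ∀ {xs} → endsAt M v ≡ xs → Darts (length xs) (end M) v
  listed-darts {xs} eq = record
    { dart      = lookup xs
    ; dart-inj  = lookup-injective (subst Unique eq endsAt-unique)
    ; dart-at   = λ k → ∈-endsAt⁻ (subst (lookup xs k ∈_) (sym eq) (∈-lookup k))
    ; dart-onto = λ p pv → let p∈ = subst (p ∈_) eq (∈-endsAt⁺ pv) in index p∈ , sym (lookup-index p∈) }

  length⇒darts : ∀ {n} → length (endsAt M v) ≡ n → Darts n (end M) v
  length⇒darts refl = listed-darts refl

  darts⇒length : ∀ {n} → Darts n (end M) v → length (endsAt M v) ≡ n
  darts⇒length D = ℕₚ.≤-antisym (injective⇒≤ f-inj) (injective⇒≤ g-inj)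
    where
    open Darts D
    f : Fin (length (endsAt M v)) → _
    f i = proj₁ (dart-onto _ (∈-endsAt⁻ (∈-lookup i)))
    f-dart : ∀ i → dart (f i) ≡ lookup (endsAt M v) i
    f-dart i = proj₂ (dart-onto _ (∈-endsAt⁻ (∈-lookup i)))
    f-inj : ∀ {i j} → f i ≡ f j → i ≡ j
    f-inj {i} {j} eq = lookup-injective endsAt-unique
      (trans (sym (f-dart i)) (trans (cong dart eq) (f-dart j)))
    g : _ → Fin (length (endsAt M v))
    g k = index (∈-endsAt⁺ (dart-at k))
    g-inj : ∀ {j k} → g j ≡ g k → j ≡ k
    g-inj {j} {k} eq = dart-inj (trans (lookup-index (∈-endsAt⁺ (dart-at j)))
      (trans (cong (lookup (endsAt M v)) eq) (sym (lookup-index (∈-endsAt⁺ (dart-at k))))))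

  properAt⇒allPairs : {φ : Fin (nE M) → C} → ProperAt (end M) (λ p → φ (proj₁ p)) v →
    AllPairs (λ a b → φ (proj₁ a) ≢ φ (proj₁ b)) (endsAt M v)
  properAt⇒allPairs pr = allPairs-from endsAt-unique
    (λ x∈ y∈ → pr _ _ (∈-endsAt⁻ x∈) (∈-endsAt⁻ y∈))

  allPairs⇒properAt : {φ : Fin (nE M) → C} →
    AllPairs (λ a b → φ (proj₁ a) ≢ φ (proj₁ b)) (endsAt M v) →
    ProperAt (end M) (λ p → φ (proj₁ p)) v
  allPairs⇒properAt ap p q pv qv = allPairs-to ≢-sym ap (∈-endsAt⁺ pv) (∈-endsAt⁺ qv)

EdgeProperAt : (M : Multipole) → (Fin (nE M) → C) → Fin (nV M) → Set
EdgeProperAt M φ = ProperAt (end M) (λ p → φ (proj₁ p))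

-- Distinct ends at `v′` go to distinct ends at `v` with the same values, so a conflict at `v′`
-- would be one at `v`. Only ends at the vertex matter, which lets `f` be arbitrary at free ends.
properAt-pull : ∀ {E′ V′ : Set} {en : E → Side → Maybe V} {en′ : E′ → Side → Maybe V′}
  {val : E × Side → C} {val′ : E′ × Side → C} {v v′} (f : E′ × Side → E × Side) →
  (∀ p → At en′ p v′ → At en (f p) v × val (f p) ≡ val′ p) →
  (∀ p q → At en′ p v′ → At en′ q v′ → f p ≡ f q → p ≡ q) →
  ProperAt en val v → ProperAt en′ val′ v′
properAt-pull f f-ok f-inj pr p q pv qv p≢q eq =
  pr (f p) (f q) (proj₁ (f-ok p pv)) (proj₁ (f-ok q qv)) (λ e → p≢q (f-inj p q pv qv e))
     (trans (proj₂ (f-ok p pv)) (trans eq (sym (proj₂ (f-ok q qv)))))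

removeIdx-skip : ∀ {n} (v : Fin n) y → removeIdx v (skip v y) ≡ just y
removeIdx-skip {suc n} v y with v ≟ skip v y
... | yes eq = contradiction (sym eq) (punchInᵢ≢i v y)
... | no ¬p = cong just (trans (punchOut-cong v refl) (punchOut-punchIn v))

removeIdx⁻ : ∀ {n} (v u : Fin n) {y} → removeIdx v u ≡ just y → skip v y ≡ u
removeIdx⁻ {suc n} v u eq with v ≟ u
removeIdx⁻ {suc n} v u refl | no ¬p = punchIn-punchOut ¬p

skip-≢ : ∀ {n} (v : Fin n) y → skip v y ≢ v
skip-≢ {suc n} v y = punchInᵢ≢i v y

skip-injective : ∀ {n} (v : Fin n) {x y} → skip v x ≡ skip v y → x ≡ y
skip-injective {suc n} v = punchIn-injective v _ _

removeIdx-≢ : ∀ {n} {v u : Fin n} → v ≢ u → ∃ λ y → removeIdx v u ≡ just y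
removeIdx-≢ {suc _} {v} {u} v≢u with v ≟ u
... | yes eq = contradiction eq v≢u
... | no ¬p  = _ , refl

-- The colours and the removal of vertices

pattern ka = ((true , false) , _)
pattern kb = ((false , true) , _)
pattern kc = ((true , true) , _)

a′ b′ c′ : K
a′ = (true , false) , tt
b′ = (false , true) , tt
c′ = (true , true) , tt

K→3 : K → Fin 3
K→3 ka = zero
K→3 kb = suc zero
K→3 kc = suc (suc zero)

3→K : Fin 3 → K
3→K zero = a′
3→K (suc zero) = b′
3→K (suc (suc zero)) = c′

K→3→K : ∀ x → 3→K (K→3 x) ≡ x
K→3→K ka = refl
K→3→K kb = refl
K→3→K kc = refl

3→K→3 : ∀ j → K→3 (3→K j) ≡ j
3→K→3 zero = refl
3→K→3 (suc zero) = refl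
3→K→3 (suc (suc zero)) = refl

K→3-injective : ∀ {x y} → K→3 x ≡ K→3 y → x ≡ y
K→3-injective {x} {y} eq = trans (sym (K→3→K x)) (trans (cong 3→K eq) (K→3→K y))

3→K-injective : ∀ {j k} → 3→K j ≡ 3→K k → j ≡ k
3→K-injective {j} {k} eq = trans (sym (3→K→3 j)) (trans (cong K→3 eq) (3→K→3 k))

_≟₂_ : (x y : Z2²) → Dec (x ≡ y)
_≟₂_ = ≡-dec Boolₚ._≟_ Boolₚ._≟_

proj₁-injective : {x y : K} → proj₁ x ≡ proj₁ y → x ≡ y
proj₁-injective {x , t} {.x , s} refl = cong (x ,_) (Boolₚ.T-irrelevant t s)

_≟K_ : (x y : K) → Dec (x ≡ y)
x ≟K y with proj₁ x ≟₂ proj₁ y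
... | yes eq = yes (proj₁-injective eq)
... | no ¬eq = no (λ eq → ¬eq (cong proj₁ eq))

⊕-self : ∀ x → x ⊕ x ≡ 0₂
⊕-self (a , b) = cong₂ _,_ (Boolₚ.xor-same a) (Boolₚ.xor-same b)

⊕-comm : ∀ x y → x ⊕ y ≡ y ⊕ x
⊕-comm (a , b) (c , d) = cong₂ _,_ (Boolₚ.xor-comm a c) (Boolₚ.xor-comm b d)

⊕-assoc : ∀ x y z → (x ⊕ y) ⊕ z ≡ x ⊕ (y ⊕ z)
⊕-assoc (a , b) (c , d) (e , f) = cong₂ _,_ (Boolₚ.xor-assoc a c e) (Boolₚ.xor-assoc b d f)

⊕-identityʳ : ∀ x → x ⊕ 0₂ ≡ x
⊕-identityʳ (a , b) = cong₂ _,_ (Boolₚ.xor-identityʳ a) (Boolₚ.xor-identityʳ b)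

⊕≡0 : ∀ {x y} → x ⊕ y ≡ 0₂ → x ≡ y
⊕≡0 {x} {y} eq = trans (sym (⊕-identityʳ x)) (trans (cong (x ⊕_) (sym (⊕-self y)))
  (trans (sym (⊕-assoc x y y)) (cong (_⊕ y) eq)))

properAt-recolour : ∀ {C′ : Set} {en : E → Side → Maybe V} {val : E × Side → C} {v} (f : C → C′) →
  (∀ {x y} → f x ≡ f y → x ≡ y) → ProperAt en val v → ProperAt en (λ p → f (val p)) v
properAt-recolour f f-inj pr p q pv qv p≢q eq = pr p q pv qv p≢q (f-inj eq)

properAt-cong : {en : E → Side → Maybe V} {val val′ : E × Side → C} {v : V} →
  (∀ p → At en p v → val p ≡ val′ p) → ProperAt en val v → ProperAt en val′ v
properAt-cong eq = properAt-pull (λ p → p) (λ p pv → pv , eq p pv) (λ _ _ _ _ e → e)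

>>=removeIdx⁺ : ∀ {n} {u : Fin n} {y m} → m ≡ just (skip u y) → (m >>= removeIdx u) ≡ just y
>>=removeIdx⁺ {u = u} {y} refl = removeIdx-skip u y

>>=removeIdx⁻ : ∀ {n} {u : Fin n} {y} m → (m >>= removeIdx u) ≡ just y → m ≡ just (skip u y)
>>=removeIdx⁻ {u = u} (just x) eq = cong just (sym (removeIdx⁻ u x eq))

skip-onto : ∀ {n} {v u : Fin n} → v ≢ u → ∃ λ y → skip v y ≡ u
skip-onto {v = v} {u} v≢u with y , eq ← removeIdx-≢ v≢u = y , removeIdx⁻ v u eq

module _ (M : Multipole) (u : Fin (nV M)) {φ : Fin (nE M) → C} {y : Fin (pred (nV M))} where

  deleteVertex-proper⁺ : EdgeProperAt M φ (skip u y) → EdgeProperAt (deleteVertex M u) φ y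
  deleteVertex-proper⁺ = properAt-pull (λ p → p)
    (λ p pv → >>=removeIdx⁻ (end M (proj₁ p) (proj₂ p)) pv , refl) (λ _ _ _ _ e → e)

  deleteVertex-proper⁻ : EdgeProperAt (deleteVertex M u) φ y → EdgeProperAt M φ (skip u y)
  deleteVertex-proper⁻ = properAt-pull (λ p → p)
    (λ p pv → >>=removeIdx⁺ pv , refl) (λ _ _ _ _ e → e)

module _ (G : Multipole) {u v : Fin (nV G)} where

  -- `deleteVertex` keeps every edge, so colouring what remains amounts to labelling the edges of
  -- `G` with no condition at `u` and `v`.
  removing⇒labelling : ColourableAfterRemoving G u v →
    ∃ λ (φ : Fin (nE G) → K) → ∀ x → x ≢ u → x ≢ v → EdgeProperAt G φ x
  removing⇒labelling (v′ , v′-eq , φ , φ-proper) = (λ d → 3→K (φ d)) , proper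
    where
    proper : ∀ x → x ≢ u → x ≢ v → EdgeProperAt G (λ d → 3→K (φ d)) x
    proper x x≢u x≢v
      with x₁ , refl ← skip-onto (≢-sym x≢u)
      with x₂ , refl ← skip-onto {v = v′} {x₁} (λ { refl → x≢v (removeIdx⁻ u v v′-eq) }) =
      properAt-recolour 3→K 3→K-injective
        (deleteVertex-proper⁻ G u (deleteVertex-proper⁻ (deleteVertex G u) v′
          (allPairs⇒properAt (deleteVertex (deleteVertex G u) v′) x₂ (φ-proper x₂))))

  labelling⇒removing : u ≢ v → (φ : Fin (nE G) → K) →
    (∀ x → x ≢ u → x ≢ v → EdgeProperAt G φ x) → ColourableAfterRemoving G u v
  labelling⇒removing u≢v φ proper with v′ , v′-eq ← removeIdx-≢ u≢v =
    v′ , v′-eq , (λ d → K→3 (φ d)) , λ y → properAt⇒allPairs (deleteVertex (deleteVertex G u) v′) y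
      (properAt-recolour K→3 K→3-injective
        (deleteVertex-proper⁺ (deleteVertex G u) v′ (deleteVertex-proper⁺ G u
          (proper (skip u (skip v′ y)) (skip-≢ u _)
            (λ eq → skip-≢ v′ y (skip-injective u (trans eq (sym (removeIdx⁻ u v v′-eq)))))))))

-- Multipoles up to the naming of edges and vertices

_≟S_ : (s t : Side) → Dec (s ≡ t)
L ≟S L = yes refl
L ≟S R = no λ ()
R ≟S L = no λ ()
R ≟S R = yes refl

-- The renaming of semiedges in `junction1` is local to a where block; the first component of this
-- pair is a handle on it.
junction-conns : (M : Multipole) (a b : EndOf M) →
  Σ (EndOf M → Maybe (Fin (pred (nE M)) × Side)) λ r → conns (junction1 M a b) ≡ map (mapMaybe r) (conns M)
junction-conns M a b = _ , refl

junction-conn-R : (M : Multipole) (e e′ i : Fin (nE M)) →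
  proj₁ (junction-conns M (e , R) (e′ , R)) (i , R) ≡
    (if does (i ≟ e) ∨ does (i ≟ e′) then nothing else Maybe.map (_, R) (removeIdx e′ i))
junction-conn-R M e e′ i with i ≟ e | i ≟ e′
... | yes _ | _     = refl
... | no _  | yes _ = refl
... | no _  | no n′ with i ≟ e′
...   | yes eq = contradiction eq n′
...   | no _   = refl

-- A bijection between `Fin k` and the elements of `X` that satisfy `live`. Elements are enumerated
-- rather than pairs with a proof, since `live` may have many proofs.
record Names (k : ℕ) {X : Set} (live : X → Set) : Set where
  field
    name : Fin k → X
    name-inj  : ∀ {i j} → name i ≡ name j → i ≡ j
    name-live : ∀ i → live (name i)
    name-onto : ∀ {x} → live x → ∃ λ i → name i ≡ x
open Names

names-⇔ : ∀ {k} {X : Set} {live live′ : X → Set} → (∀ {x} → live x → live′ x) → (∀ {x} → live′ x → live x) →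
  Names k live → Names k live′
names-⇔ to from N = record
  { name = name N ; name-inj = name-inj N ; name-live = λ i → to (name-live N i) ; name-onto = λ l → name-onto N (from l) }

module _ {k l} {X : Set} {live₁ live₂ : X → Set} (N₁ : Names k live₁) (N₂ : Names l live₂) where

  name-⊎ : Fin (k + l) → X
  name-⊎ i = [ name N₁ , name N₂ ]′ (splitAt k i)

  name-↑ˡ : ∀ j → name-⊎ (j ↑ˡ l) ≡ name N₁ j
  name-↑ˡ j = cong [ name N₁ , name N₂ ]′ (splitAt-↑ˡ k j l)

  name-↑ʳ : ∀ j → name-⊎ (k ↑ʳ j) ≡ name N₂ j
  name-↑ʳ j = cong [ name N₁ , name N₂ ]′ (splitAt-↑ʳ k l j)

  names-⊎ : (∀ {x} → live₁ x → live₂ x → ⊥) → Names (k + l) (λ x → live₁ x ⊎ live₂ x)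
  names-⊎ disj = record { name = name-⊎ ; name-inj = λ {i} {j} → inj₊ i j ; name-live = sound₊ ; name-onto = onto₊ }
    where
    inj₊ : ∀ i j → name-⊎ i ≡ name-⊎ j → i ≡ j
    inj₊ i j eq with splitAt k i in eqi | splitAt k j in eqj
    ... | inj₁ a | inj₁ b = trans (sym (splitAt⁻¹-↑ˡ eqi)) (trans (cong (_↑ˡ l) (name-inj N₁ eq)) (splitAt⁻¹-↑ˡ eqj))
    ... | inj₁ a | inj₂ b = ⊥-elim (disj (name-live N₁ a) (subst live₂ (sym eq) (name-live N₂ b)))
    ... | inj₂ a | inj₁ b = ⊥-elim (disj (name-live N₁ b) (subst live₂ eq (name-live N₂ a)))
    ... | inj₂ a | inj₂ b = trans (sym (splitAt⁻¹-↑ʳ eqi)) (trans (cong (k ↑ʳ_) (name-inj N₂ eq)) (splitAt⁻¹-↑ʳ eqj))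
    sound₊ : ∀ i → live₁ (name-⊎ i) ⊎ live₂ (name-⊎ i)
    sound₊ i with splitAt k i
    ... | inj₁ a = inj₁ (name-live N₁ a)
    ... | inj₂ a = inj₂ (name-live N₂ a)
    onto₊ : ∀ {x} → live₁ x ⊎ live₂ x → ∃ λ i → name-⊎ i ≡ x
    onto₊ (inj₁ lv) with j , eq ← name-onto N₁ lv = j ↑ˡ l , trans (name-↑ˡ j) eq
    onto₊ (inj₂ lv) with j , eq ← name-onto N₂ lv = k ↑ʳ j , trans (name-↑ʳ j) eq

names-skip : ∀ {k} {X : Set} {live : X → Set} (N : Names k live) (b : Fin k) →
  Names (pred k) (λ x → live x × x ≢ name N b)
names-skip N b = record
  { name  = λ i → name N (skip b i)
  ; name-inj   = λ eq → skip-injective b (name-inj N eq)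
  ; name-live = λ i → name-live N (skip b i) , λ eq → skip-≢ b i (name-inj N eq)
  ; name-onto  = onto′ }
  where
  onto′ : ∀ {x} → _ → ∃ λ i → name N (skip b i) ≡ x
  onto′ (lv , ne) with j , refl ← name-onto N lv
    with i , refl ← skip-onto {v = b} {j} (λ eq → ne (cong (name N) (sym eq))) = i , refl

map²-fuse : ∀ {A B D : Set} {f : A → B} {g : B → D} {h : A → D} → (∀ x → g (f x) ≡ h x) →
  ∀ xss → map (map g) (map (map f) xss) ≡ map (map h) xss
map²-fuse eq xss = trans (sym (Listₚ.map-∘ xss))
  (Listₚ.map-cong (λ xs → trans (sym (Listₚ.map-∘ xs)) (Listₚ.map-cong eq xs)) xss)

nth : {A : Set} → List (List A) → ℕ → List A
nth []       _       = []
nth (x ∷ xs) zero    = x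
nth (x ∷ xs) (suc n) = nth xs n

-- The recursion inside `nthConn` is local and cannot be named for an induction, so it is unfolded
-- by cases. The poles considered have at most six connectors.
nthConn-nth : ∀ M n → n < 6 → nthConn M n ≡ nth (conns M) n
nthConn-nth M n n<6 with conns M | n | n<6
... | [] | _ | _ = refl
... | _ ∷ _ | 0 | _ = refl
... | _ ∷ [] | suc _ | _ = refl
... | _ ∷ _ ∷ _ | 1 | _ = refl
... | _ ∷ _ ∷ [] | suc (suc _) | _ = refl
... | _ ∷ _ ∷ _ ∷ _ | 2 | _ = refl
... | _ ∷ _ ∷ _ ∷ [] | suc (suc (suc _)) | _ = refl
... | _ ∷ _ ∷ _ ∷ _ ∷ _ | 3 | _ = refl
... | _ ∷ _ ∷ _ ∷ _ ∷ [] | suc (suc (suc (suc _))) | _ = refl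
... | _ ∷ _ ∷ _ ∷ _ ∷ _ ∷ _ | 4 | _ = refl
... | _ ∷ _ ∷ _ ∷ _ ∷ _ ∷ [] | suc (suc (suc (suc (suc _)))) | _ = refl
... | _ ∷ _ ∷ _ ∷ _ ∷ _ ∷ _ ∷ _ | 5 | _ = refl
... | _ | suc (suc (suc (suc (suc (suc _))))) | s≤s (s≤s (s≤s (s≤s (s≤s (s≤s ())))))

junctionConns-step : ∀ M k p q {a b as bs} → p < 6 → q < 6 → nth (conns M) p ≡ a ∷ as → nth (conns M) q ≡ b ∷ bs →
  junctionConns (suc k) M p q ≡ junctionConns k (junction1 M a b) p q
junctionConns-step M k p q p<6 q<6 pe qe
  rewrite trans (nthConn-nth M p p<6) pe | trans (nthConn-nth M q q<6) qe = refl

-- Named M live vlive en cs: the edges and vertices of M are in bijection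
-- with the names satisfying live and vlive, and in terms of these names en
-- describes the ends of M and cs its connectors.
module Naming {N VN : Set} (_≟N_ : (n n′ : N) → Dec (n ≡ n′)) where

  _≟P_ : (p q : N × Side) → Dec (p ≡ q)
  (n , s) ≟P (n′ , s′) with n ≟N n′ | s ≟S s′
  ... | yes refl | yes refl = yes refl
  ... | no ne    | _        = no λ eq → ne (cong proj₁ eq)
  ... | yes _    | no ne    = no λ eq → ne (cong proj₂ eq)

  EndMap : Set
  EndMap = N → Side → Maybe VN

  Conns : Set
  Conns = List (List (N × Side))

  record Named (M : Multipole) (live : N → Set) (vlive : VN → Set) (en : EndMap) (cs : Conns) : Set where
    field
      edges : Names (nE M) live
      verts : Names (nV M) vlive

    nmE : EndOf M → N × Side
    nmE p = name edges (proj₁ p) , proj₂ p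

    field
      ends : ∀ i t → Maybe.map (name verts) (end M i t) ≡ en (name edges i) t
      conn : map (map nmE) (conns M) ≡ cs

    same-edge : ∀ i j → does (i ≟ j) ≡ does (name edges i ≟N name edges j)
    same-edge i j with i ≟ j
    ... | yes refl = sym (dec-true (name edges i ≟N name edges i) refl)
    ... | no ne    = sym (dec-false (name edges i ≟N name edges j) (λ eq → ne (name-inj edges eq)))

    same-end : ∀ i t j s → ((i ==F j) ∧ (t ==S s)) ≡ does (nmE (i , t) ≟P nmE (j , s))
    same-end i t j s with i ≟ j
    same-end i L j L | yes refl = sym (dec-true (nmE (i , L) ≟P nmE (i , L)) refl)
    same-end i L j R | yes refl = sym (dec-false (nmE (i , L) ≟P nmE (i , R)) λ ())
    same-end i R j L | yes refl = sym (dec-false (nmE (i , R) ≟P nmE (i , L)) λ ())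
    same-end i R j R | yes refl = sym (dec-true (nmE (i , R) ≟P nmE (i , R)) refl)
    same-end i t j s | no ne = sym (dec-false (nmE (i , t) ≟P nmE (j , s)) (λ eq → ne (name-inj edges (cong proj₁ eq))))

  open Named public

  module _ {M live vlive en cs} (ν : Named M live vlive en cs) where

    named-⇔ : {live′ : N → Set} {vlive′ : VN → Set} {en′ : EndMap} {cs′ : Conns} →
      (∀ {n} → live n → live′ n) → (∀ {n} → live′ n → live n) →
      (∀ {x} → vlive x → vlive′ x) → (∀ {x} → vlive′ x → vlive x) →
      (∀ {n} → live n → ∀ t → en n t ≡ en′ n t) → cs ≡ cs′ → Named M live′ vlive′ en′ cs′
    named-⇔ l→ l← v→ v← e c = record
      { edges = names-⇔ l→ l← (edges ν) ; verts = names-⇔ v→ v← (verts ν)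
      ; ends = λ i t → trans (ends ν i t) (e (name-live (edges ν) i) t) ; conn = trans (conn ν) c }

    named-dropEmpty : Named (dropEmptyConns M) live vlive en (filterᵇ (λ c → not (null c)) cs)
    named-dropEmpty = record { edges = edges ν ; verts = verts ν ; ends = ends ν ; conn = go (conns M) cs (conn ν) }
      where
      go : ∀ xss css → map (map (nmE ν)) xss ≡ css →
        map (map (nmE ν)) (filterᵇ (λ c → not (null c)) xss) ≡ filterᵇ (λ c → not (null c)) css
      go []               []  refl = refl
      go ([] ∷ xss)       ._  refl = go xss _ refl
      go ((x ∷ xs) ∷ xss) ._  refl = cong (_ ∷_) (go xss _ refl)

    named-conns≡[] : cs ≡ [] → conns M ≡ []
    named-conns≡[] refl with conns M | conn ν
    ... | [] | _ = refl

  named-⊎ : ∀ {M₁ M₂ live₁ live₂ vlive₁ vlive₂ en cs₁ cs₂} →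
    (∀ {n} → live₁ n → live₂ n → ⊥) → (∀ {x} → vlive₁ x → vlive₂ x → ⊥) →
    Named M₁ live₁ vlive₁ en cs₁ → Named M₂ live₂ vlive₂ en cs₂ →
    Named (M₁ ⊎M M₂) (λ n → live₁ n ⊎ live₂ n) (λ x → vlive₁ x ⊎ vlive₂ x) en (cs₁ ++ cs₂)
  named-⊎ {M₁} {M₂} {en = en} disj vdisj ν₁ ν₂ = record
    { edges = names-⊎ (edges ν₁) (edges ν₂) disj
    ; verts = names-⊎ (verts ν₁) (verts ν₂) vdisj
    ; ends = ends₊
    ; conn = trans (Listₚ.map-++ _ (map (map _) (conns M₁)) _) (cong₂ _++_
        (trans (map²-fuse (λ p → cong (_, proj₂ p) (name-↑ˡ (edges ν₁) (edges ν₂) (proj₁ p))) (conns M₁)) (conn ν₁))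
        (trans (map²-fuse (λ p → cong (_, proj₂ p) (name-↑ʳ (edges ν₁) (edges ν₂) (proj₁ p))) (conns M₂)) (conn ν₂))) }
    where
    ends₊ : ∀ i t → Maybe.map (name-⊎ (verts ν₁) (verts ν₂)) (end (M₁ ⊎M M₂) i t) ≡ en (name-⊎ (edges ν₁) (edges ν₂) i) t
    ends₊ i t with splitAt (nE M₁) i
    ... | inj₁ a = trans (sym (Maybeₚ.map-∘ (end M₁ a t))) (trans (Maybeₚ.map-cong (name-↑ˡ (verts ν₁) (verts ν₂)) (end M₁ a t)) (ends ν₁ a t))
    ... | inj₂ a = trans (sym (Maybeₚ.map-∘ (end M₂ a t))) (trans (Maybeₚ.map-cong (name-↑ʳ (verts ν₁) (verts ν₂)) (end M₂ a t)) (ends ν₂ a t))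

  named-addVertices : ∀ {M live vlive en cs k vlive′} → (∀ {x} → vlive x → vlive′ x → ⊥) →
    Named M live vlive en cs → Names k vlive′ →
    Named (addVertices M k) live (λ x → vlive x ⊎ vlive′ x) en cs
  named-addVertices {M} disj ν N′ = record
    { edges = edges ν ; verts = names-⊎ (verts ν) N′ disj
    ; ends = λ i t → trans (sym (Maybeₚ.map-∘ (end M i t)))
        (trans (Maybeₚ.map-cong (name-↑ˡ (verts ν) N′) (end M i t)) (ends ν i t))
    ; conn = conn ν }

  upd : EndMap → N × Side → Maybe VN → EndMap
  upd en p x n t = if does ((n , t) ≟P p) then x else en n t

  named-attach : ∀ {M live vlive en cs} (ν : Named M live vlive en cs) p x →
    Named (attach M p x) live vlive (upd en (nmE ν p) (just (name (verts ν) x)))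
      (map (filterᵇ (λ q → not (does (q ≟P nmE ν p)))) cs)
  named-attach {M} {en = en} ν (j , s) x = record
    { edges = edges ν ; verts = verts ν ; ends = ends′
    ; conn = trans (filters (conns M)) (cong (map _) (conn ν)) }
    where
    ends′ : ∀ i t → Maybe.map (name (verts ν)) (end (attach M (j , s) x) i t) ≡
      upd en (nmE ν (j , s)) (just (name (verts ν) x)) (name (edges ν) i) t
    ends′ i t rewrite sym (same-end ν i t j s) with (i ==F j) ∧ (t ==S s)
    ... | true  = refl
    ... | false = ends ν i t
    filter-map : ∀ xs → map (nmE ν) (filterᵇ (λ p → not ((proj₁ p ==F j) ∧ (proj₂ p ==S s))) xs) ≡
      filterᵇ (λ q → not (does (q ≟P nmE ν (j , s)))) (map (nmE ν) xs)
    filter-map [] = refl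
    filter-map ((i , t) ∷ xs) rewrite sym (same-end ν i t j s) with (i ==F j) ∧ (t ==S s)
    ... | true  = filter-map xs
    ... | false = cong (_ ∷_) (filter-map xs)
    filters : ∀ xss → map (map (nmE ν)) (map (filterᵇ (λ p → not ((proj₁ p ==F j) ∧ (proj₂ p ==S s)))) xss) ≡
      map (filterᵇ (λ q → not (does (q ≟P nmE ν (j , s))))) (map (map (nmE ν)) xss)
    filters [] = refl
    filters (xs ∷ xss) = cong₂ _∷_ (filter-map xs) (filters xss)

  -- All semiedges that get joined are `R` ends: the dangling edges of `H6` and both halves of a cut
  -- edge are free on that side. Their edge names alone therefore describe the connectors.
  onR : List (List N) → Conns
  onR = map (map (_, R))

  without : N → N → List (List N) → List (List N)
  without a b = map (filterᵇ (λ n → not (does (n ≟N a) ∨ does (n ≟N b))))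

  module _ {M live vlive en ns} (ν : Named M live vlive en (onR ns)) (a b : Fin (nE M)) where

    private
      na = name (edges ν) a
      nb = name (edges ν) b

    named-junction : Named (junction1 M (a , R) (b , R)) (λ n → live n × n ≢ nb) vlive
      (upd en (na , R) (en nb L)) (onR (without na nb ns))
    named-junction = record
      { edges = names-skip (edges ν) b ; verts = verts ν ; ends = ends′
      ; conn = trans (cong (map (map nmE′)) (proj₂ (junction-conns M (a , R) (b , R)))) (rens (conns M) ns (conn ν)) }
      where
      nmE′ : Fin (pred (nE M)) × Side → N × Side
      nmE′ p = name (edges ν) (skip b (proj₁ p)) , proj₂ p
      ren : EndOf M → Maybe (Fin (pred (nE M)) × Side)
      ren = proj₁ (junction-conns M (a , R) (b , R))
      ends′ : ∀ i t → Maybe.map (name (verts ν)) (end (junction1 M (a , R) (b , R)) i t) ≡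
        upd en (na , R) (en nb L) (name (edges ν) (skip b i)) t
      ends′ i t rewrite sym (same-end ν (skip b i) t a R) with (skip b i ==F a) ∧ (t ==S R)
      ... | true  = ends ν b L
      ... | false = ends ν (skip b i) t
      ren-map : ∀ xs ms → map (nmE ν) xs ≡ map (_, R) ms →
        map nmE′ (mapMaybe ren xs) ≡ map (_, R) (filterᵇ (λ n → not (does (n ≟N na) ∨ does (n ≟N nb))) ms)
      ren-map [] [] eq = refl
      ren-map ((i , L) ∷ xs) (m ∷ ms) ()
      ren-map ((i , R) ∷ xs) (m ∷ ms) eq with Listₚ.∷-injective eq
      ... | refl , eqs rewrite junction-conn-R M a b i | sym (same-edge ν i a) | sym (same-edge ν i b)
        with does (i ≟ a) | i ≟ b
      ... | true  | _      = ren-map xs ms eqs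
      ... | false | yes _  = ren-map xs ms eqs
      ... | false | no i≢b with removeIdx-≢ {v = b} {i} (≢-sym i≢b)
      ... | y , y-eq rewrite y-eq = cong₂ _∷_ (cong (λ j → name (edges ν) j , R) (removeIdx⁻ b i y-eq)) (ren-map xs ms eqs)
      rens : ∀ xss mss → map (map (nmE ν)) xss ≡ onR mss →
        map (map nmE′) (map (mapMaybe ren) xss) ≡ onR (without na nb mss)
      rens [] [] eq = refl
      rens (xs ∷ xss) (ms ∷ mss) eq with Listₚ.∷-injective eq
      ... | eq₁ , eq₂ = cong₂ _∷_ (ren-map xs ms eq₁) (rens xss mss eq₂)

  module _ {M live vlive en ns} (ν : Named M live vlive en (onR ns)) where

    nth-head : ∀ xss mss → map (map (nmE ν)) xss ≡ onR mss → ∀ p {m ms} → nth mss p ≡ m ∷ ms →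
      ∃ λ x → ∃ λ xs → nth xss p ≡ (x , R) ∷ xs × name (edges ν) x ≡ m
    nth-head (xs ∷ xss) (ms ∷ mss) eq (suc p) pe = nth-head xss mss (proj₂ (Listₚ.∷-injective eq)) p pe
    nth-head (((x , t) ∷ xs) ∷ xss) ((m ∷ ms) ∷ mss) eq zero refl
      with refl ← proj₁ (Listₚ.∷-injective (proj₁ (Listₚ.∷-injective eq))) = x , xs , refl , refl

    -- In continuation form, because the multipole after one junction depends on the numbers that
    -- carry the names `na` and `nb`. `P` holds the junctions still to be made.
    named-junctionConns : ∀ k p q {na nb as bs} → p < 6 → q < 6 → nth ns p ≡ na ∷ as → nth ns q ≡ nb ∷ bs →
      (P : Multipole → Set) →
      (∀ M′ → Named M′ (λ n → live n × n ≢ nb) vlive (upd en (na , R) (en nb L)) (onR (without na nb ns)) →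
        P (junctionConns k M′ p q)) →
      P (junctionConns (suc k) M p q)
    named-junctionConns k p q p<6 q<6 p-eq q-eq P next
      with a , as , a-eq , refl ← nth-head (conns M) ns (conn ν) p p-eq
         | b , bs , b-eq , refl ← nth-head (conns M) ns (conn ν) q q-eq =
      subst P (sym (junctionConns-step M k p q p<6 q<6 a-eq b-eq)) (next _ (named-junction ν a b))

-- Cutting an edge

unlast-inject₁ : ∀ {n} (i : Fin n) → unlast (inject₁ i) ≡ just i
unlast-inject₁ zero    = refl
unlast-inject₁ (suc i) = cong (Maybe.map suc) (unlast-inject₁ i)

unlast-fromℕ : ∀ n → unlast (fromℕ n) ≡ nothing
unlast-fromℕ zero    = refl
unlast-fromℕ (suc n) = cong (Maybe.map suc) (unlast-fromℕ n)

data Last {n} : Fin (suc n) → Set where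
  old  : ∀ i → Last (inject₁ i)
  last : Last (fromℕ n)

last? : ∀ {n} (i : Fin (suc n)) → Last i
last? {zero}  zero    = last
last? {suc n} zero    = old zero
last? {suc n} (suc i) with last? i
... | old j = old (suc j)
... | last  = last

last?-inject₁ : ∀ {n} (d : Fin n) → last? (inject₁ d) ≡ old d
last?-inject₁ zero = refl
last?-inject₁ (suc d) rewrite last?-inject₁ d = refl

last?-fromℕ : ∀ n → last? (fromℕ n) ≡ last
last?-fromℕ zero = refl
last?-fromℕ (suc n) rewrite last?-fromℕ n = refl

module _ (G : Multipole) (e : Fin (nE G)) where

  cut-other : ∀ {d} → d ≢ e → ∀ t → end (cutEdge G e) (inject₁ d) t ≡ end G d t
  cut-other {d} d≢e t rewrite unlast-inject₁ d with d ≟ e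
  ... | yes eq = contradiction eq d≢e
  ... | no _   = refl

  cut-L : end (cutEdge G e) (inject₁ e) L ≡ end G e L
  cut-L rewrite unlast-inject₁ e with e ≟ e
  ... | yes _ = refl
  ... | no n  = contradiction refl n

  cut-R : end (cutEdge G e) (inject₁ e) R ≡ nothing
  cut-R rewrite unlast-inject₁ e with e ≟ e
  ... | yes _ = refl
  ... | no n  = contradiction refl n

  cut-last-L : end (cutEdge G e) (fromℕ (nE G)) L ≡ end G e R
  cut-last-L rewrite unlast-fromℕ (nE G) = refl

  cut-last-R : end (cutEdge G e) (fromℕ (nE G)) R ≡ nothing
  cut-last-R rewrite unlast-fromℕ (nE G) = refl

  -- Both halves have their vertex on side `L`, including the half that inherits the `R` end of `e`.
  half : Side → Fin (suc (nE G))
  half L = inject₁ e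
  half R = fromℕ (nE G)

  half-end : ∀ s → end (cutEdge G e) (half s) L ≡ end G e s
  half-end L = cut-L
  half-end R = cut-last-L

  half-free : ∀ s → end (cutEdge G e) (half s) R ≡ nothing
  half-free L = cut-R
  half-free R = cut-last-R

  toCut : EndOf G → EndOf (cutEdge G e)
  toCut (d , s) = if does (d ≟ e) then (half s , L) else (inject₁ d , s)

  -- The inverse of `toCut` on ends incident with a vertex; its values at the two new free ends are
  -- arbitrary.
  fromCut : EndOf (cutEdge G e) → EndOf G
  fromCut (i , t) with last? i
  ... | last  = e , R
  ... | old d = if does (d ≟ e) then (e , L) else (d , t)

  toCut-e : ∀ s → toCut (e , s) ≡ (half s , L)
  toCut-e s rewrite dec-true (e ≟ e) refl = refl

  toCut-other : ∀ {d} → d ≢ e → ∀ s → toCut (d , s) ≡ (inject₁ d , s)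
  toCut-other {d} d≢e s rewrite dec-false (d ≟ e) d≢e = refl

  toCut-at : ∀ {v} p → At (end G) p v → At (end (cutEdge G e)) (toCut p) v
  toCut-at (d , s) pv with d ≟ e
  ... | yes refl = trans (half-end s) pv
  ... | no d≢e   = trans (cut-other d≢e s) pv

  fromCut-at : ∀ {v} p → At (end (cutEdge G e)) p v → At (end G) (fromCut p) v × toCut (fromCut p) ≡ p
  fromCut-at (i , t) pv with last? i
  fromCut-at (i , L) pv | last = trans (sym cut-last-L) pv , toCut-e R
  fromCut-at (i , R) pv | last with () ← trans (sym cut-last-R) pv
  fromCut-at (i , t) pv | old d with d ≟ e
  fromCut-at (i , L) pv | old d | yes refl = trans (sym cut-L) pv , toCut-e L
  fromCut-at (i , R) pv | old d | yes refl with () ← trans (sym cut-R) pv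
  fromCut-at (i , t) pv | old d | no d≢e   = trans (sym (cut-other d≢e t)) pv , toCut-other d≢e t

  toCut-injective : ∀ p q → toCut p ≡ toCut q → p ≡ q
  toCut-injective (d , s) (d′ , s′) eq with d ≟ e | d′ ≟ e
  toCut-injective (d , L) (d′ , L) eq | yes refl | yes refl = refl
  toCut-injective (d , R) (d′ , R) eq | yes refl | yes refl = refl
  toCut-injective (d , L) (d′ , R) eq | yes refl | yes refl = contradiction (sym (cong proj₁ eq)) fromℕ≢inject₁
  toCut-injective (d , R) (d′ , L) eq | yes refl | yes refl = contradiction (cong proj₁ eq) fromℕ≢inject₁
  toCut-injective (d , L) (d′ , s′) eq | yes refl | no n = contradiction (sym (inject₁-injective (cong proj₁ eq))) n
  toCut-injective (d , R) (d′ , s′) eq | yes refl | no n = contradiction (cong proj₁ eq) fromℕ≢inject₁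
  toCut-injective (d , s) (d′ , L) eq | no n | yes refl = contradiction (inject₁-injective (cong proj₁ eq)) n
  toCut-injective (d , s) (d′ , R) eq | no n | yes refl = contradiction (sym (cong proj₁ eq)) fromℕ≢inject₁
  toCut-injective (d , s) (d′ , s′) eq | no _ | no _ = cong₂ _,_ (inject₁-injective (cong proj₁ eq)) (cong proj₂ eq)

  module _ {φ : Fin (suc (nE G)) → C} {v : Fin (nV G)} where

    cut-proper⁺ : ProperAt (end G) (λ p → φ (proj₁ (toCut p))) v → EdgeProperAt (cutEdge G e) φ v
    cut-proper⁺ = properAt-pull fromCut
      (λ p pv → proj₁ (fromCut-at p pv) , cong (λ q → φ (proj₁ q)) (proj₂ (fromCut-at p pv)))
      (λ p q pv qv eq → trans (sym (proj₂ (fromCut-at p pv))) (trans (cong toCut eq) (proj₂ (fromCut-at q qv))))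

    cut-proper⁻ : EdgeProperAt (cutEdge G e) φ v → ProperAt (end G) (λ p → φ (proj₁ (toCut p))) v
    cut-proper⁻ = properAt-pull toCut (λ p pv → toCut-at p pv , refl) (λ p q _ _ → toCut-injective p q)

  cut-darts⁺ : ∀ {n v} → Darts n (end G) v → Darts n (end (cutEdge G e)) v
  cut-darts⁺ D = record
    { dart = λ k → toCut (dart k)
    ; dart-inj = λ eq → dart-inj (toCut-injective _ _ eq)
    ; dart-at = λ k → toCut-at (dart k) (dart-at k)
    ; dart-onto = onto }
    where
    open Darts D
    onto : ∀ p → At (end (cutEdge G e)) p _ → ∃ λ k → toCut (dart k) ≡ p
    onto p pv with fv , back ← fromCut-at p pv with k , eq ← dart-onto _ fv =
      k , trans (cong toCut eq) back

  cut-darts⁻ : ∀ {n v} → Darts n (end (cutEdge G e)) v → Darts n (end G) v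
  cut-darts⁻ D = record
    { dart = λ k → fromCut (dart k)
    ; dart-inj = λ {j} {k} eq → dart-inj (trans (sym (proj₂ (fromCut-at (dart j) (dart-at j))))
        (trans (cong toCut eq) (proj₂ (fromCut-at (dart k) (dart-at k)))))
    ; dart-at = λ k → proj₁ (fromCut-at (dart k) (dart-at k))
    ; dart-onto = λ p pv → let k , eq = dart-onto (toCut p) (toCut-at p pv) in
        k , toCut-injective _ _ (trans (proj₂ (fromCut-at (dart k) (dart-at k))) eq) }
    where open Darts D

  -- A labelling of the ends of `G` in which the halves of `e` may differ; the value `ψ e` is never
  -- read.
  cutVal : (Side → C) → (Fin (nE G) → C) → EndOf G → C
  cutVal β ψ (d , s) = if does (d ≟ e) then β s else ψ d

  cutVal-toCut : (φ : Fin (suc (nE G)) → C) → ∀ p →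
    cutVal (λ s → φ (half s)) (λ d → φ (inject₁ d)) p ≡ φ (proj₁ (toCut p))
  cutVal-toCut φ (d , s) with d ≟ e
  ... | yes _ = refl
  ... | no _  = refl

  uncut : (Side → C) → (Fin (nE G) → C) → Fin (suc (nE G)) → C
  uncut β ψ i with last? i
  ... | last  = β R
  ... | old d = if does (d ≟ e) then β L else ψ d

  uncut-half : (β : Side → C) (ψ : Fin (nE G) → C) → ∀ s → uncut β ψ (half s) ≡ β s
  uncut-half β ψ L rewrite last?-inject₁ e | dec-true (e ≟ e) refl = refl
  uncut-half β ψ R rewrite last?-fromℕ (nE G) = refl

  uncut-other : (β : Side → C) (ψ : Fin (nE G) → C) → ∀ {d} → d ≢ e → uncut β ψ (inject₁ d) ≡ ψ d
  uncut-other β ψ {d} d≢e rewrite last?-inject₁ d | dec-false (d ≟ e) d≢e = refl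

  uncut-toCut : (β : Side → C) (ψ : Fin (nE G) → C) → ∀ p → uncut β ψ (proj₁ (toCut p)) ≡ cutVal β ψ p
  uncut-toCut β ψ (d , s) with d ≟ e
  ... | yes refl = uncut-half β ψ s
  ... | no d≢e = uncut-other β ψ d≢e

-- The (2,3)-pole obtained by cutting an edge and deleting a vertex

inj₁E : ∀ {n} → Fin n × Side → Fin (suc n) × Side
inj₁E (d , s) = inject₁ d , s

-- The flow through the connector `B` of a pole; `rowSum` is the flow through `C`.
halfSum : (Side → K) → Z2²
halfSum β = proj₁ (β L) ⊕ proj₁ (β R)

rowSum : (Fin 3 → K) → Z2²
rowSum y = proj₁ (y zero) ⊕ (proj₁ (y (suc zero)) ⊕ proj₁ (y (suc (suc zero))))

record Pole : Set where
  field
    G : Multipole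
    e : Fin (nE G)
    w : Fin (nV G)
    conns≡[] : conns G ≡ []
    attached : ∀ d s → ∃[ v ] end G d s ≡ just v
    loopless : ∀ d {v} → end G d L ≡ just v → end G d R ≢ just v
    e∌w      : ∀ s → end G e s ≢ just w
    darts    : ∀ v → Darts 3 (end G) v
    w-darts  : Darts 3 (end G) w

  c : Fin 3 → EndOf G
  c = Darts.dart w-darts

  field
    -- Fixes the order of `w-darts` to be the order in which `deleteVertex` lists the connector `C`.
    -- This order decides which edge is attached to which new vertex.
    C-list : endsAt (cutEdge G e) w ≡ map inj₁E (c zero ∷ c (suc zero) ∷ c (suc (suc zero)) ∷ [])

  pole : Multipole
  pole = T23 G e w

  B C₃ : List (EndOf pole)
  B = (inject₁ e , R) ∷ (fromℕ (nE G) , R) ∷ []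
  C₃ = map inj₁E (c zero ∷ c (suc zero) ∷ c (suc (suc zero)) ∷ [])

  pole-conns : conns pole ≡ B ∷ C₃ ∷ []
  pole-conns rewrite conns≡[] = cong (λ xs → B ∷ xs ∷ []) C-list

  c≢e : ∀ k → proj₁ (c k) ≢ e
  c≢e k eq = e∌w (proj₂ (c k)) (subst (λ d → end G d (proj₂ (c k)) ≡ just w) eq (Darts.dart-at w-darts k))

  ProperPole : ∀ {C : Set} → (Side → C) → (Fin (nE G) → C) → Set
  ProperPole β ψ = ∀ x → x ≢ w → ProperAt (end G) (cutVal G e β ψ) x

  pole-proper : Proper pole → ∀ β ψ → ProperPole β ψ → halfSum β ≢ 0₂
  pole-proper pr β ψ ok flow₀ with subst (All _) pole-conns (pr φ φ-ok)
    where
    φ : Fin (suc (nE G)) → K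
    φ = uncut G e β ψ
    φ-ok : Colouring pole φ
    φ-ok y = properAt⇒allPairs pole y (deleteVertex-proper⁺ (cutEdge G e) w (cut-proper⁺ G e
      (properAt-cong (λ p _ → sym (uncut-toCut G e β ψ p)) (ok (skip w y) (skip-≢ w y)))))
  ... | B≢0 ∷ _ = B≢0 (trans (cong₂ _⊕_ (cong proj₁ (uncut-half G e β ψ L))
      (trans (⊕-identityʳ _) (cong proj₁ (uncut-half G e β ψ R)))) flow₀)

  colouring⇒properPole : ∀ {φ : Fin (nE pole) → K} → Colouring pole φ →
    ProperPole (λ s → φ (half G e s)) (λ d → φ (inject₁ d))
  colouring⇒properPole {φ} ok x x≢w with y , refl ← skip-onto {v = w} {x} (≢-sym x≢w) =
    properAt-cong (λ p _ → sym (cutVal-toCut G e φ p))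
      (cut-proper⁻ G e (deleteVertex-proper⁻ (cutEdge G e) w (allPairs⇒properAt pole y (ok y))))

  pole-perfect : Perfect pole → (β : Side → K) (y : Fin 3 → K) →
    halfSum β ≢ 0₂ → halfSum β ≡ rowSum y →
    ∃[ ψ ] (∀ k → ψ (proj₁ (c k)) ≡ y k) × ProperPole β ψ
  pole-perfect (_ , perfect) β y Σβ≢0 Σβ≡Σy
    with φ , ok , tuple ← perfect (β L) (β R) (y zero) (y (suc zero)) (y (suc (suc zero)))
           Σβ≢0 (subst (_≢ 0₂) Σβ≡Σy Σβ≢0)
           (trans (sym (⊕-assoc (proj₁ (β L)) (proj₁ (β R)) (rowSum y))) (trans (cong (_⊕ rowSum y) Σβ≡Σy) (⊕-self (rowSum y))))
    = (λ d → φ (inject₁ d)) , y-ok , λ x x≢w → properAt-cong (λ p _ → β-ok p) (colouring⇒properPole ok x x≢w)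
    where
    tuple′ : map (map (λ p → φ (proj₁ p))) (B ∷ C₃ ∷ []) ≡
      (β L ∷ β R ∷ []) ∷ (y zero ∷ y (suc zero) ∷ y (suc (suc zero)) ∷ []) ∷ []
    tuple′ = trans (cong (map (map (λ p → φ (proj₁ p)))) (sym pole-conns)) tuple
    nthK : ℕ → ℕ → List (List K) → K
    nthK zero    zero    ((x ∷ _) ∷ _) = x
    nthK zero    (suc n) ((_ ∷ xs) ∷ xss) = nthK zero n (xs ∷ xss)
    nthK (suc m) n       (_ ∷ xss) = nthK m n xss
    -- A default for indices outside the tuple; the entries read below all exist.
    nthK _ _ _ = β L
    half-ok : ∀ s → φ (half G e s) ≡ β s
    half-ok L = cong (nthK 0 0) tuple′
    half-ok R = cong (nthK 0 1) tuple′
    y-ok : ∀ k → φ (inject₁ (proj₁ (c k))) ≡ y k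
    y-ok zero = cong (nthK 1 0) tuple′
    y-ok (suc zero) = cong (nthK 1 1) tuple′
    y-ok (suc (suc zero)) = cong (nthK 1 2) tuple′
    β-ok : ∀ p → cutVal G e (λ s → φ (half G e s)) (λ d → φ (inject₁ d)) p ≡ cutVal G e β (λ d → φ (inject₁ d)) p
    β-ok (d , s) with d ≟ e
    ... | yes _ = half-ok s
    ... | no _  = refl

-- Names for the composite graph

next : Fin 6 → Fin 6
next 0F = 1F
next 1F = 2F
next 2F = 3F
next 3F = 4F
next 4F = 5F
next 5F = 0F

prev : Fin 6 → Fin 6
prev 0F = 5F
prev 1F = 0F
prev 2F = 1F
prev 3F = 2F
prev 4F = 3F
prev 5F = 4F

hexEnd : Fin 6 ⊎ Fin 6 → Side → Maybe (Fin 6)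
hexEnd (inj₁ j) L = just j
hexEnd (inj₁ j) R = just (next j)
hexEnd (inj₂ j) L = just j
hexEnd (inj₂ j) R = nothing

-- The functions inside `H6` are local, so the agreement with `hexEnd` is decided over all twelve
-- edges.
H6-end : ∀ i t → end H6 i t ≡ hexEnd (splitAt 6 i) t
H6-end i L = toWitness {a? = all? λ i → Maybeₚ.≡-dec _≟_ (end H6 i L) (hexEnd (splitAt 6 i) L)} _ i
H6-end i R = toWitness {a? = all? λ i → Maybeₚ.≡-dec _≟_ (end H6 i R) (hexEnd (splitAt 6 i) R)} _ i

-- The dangling edge at u_j of H6 is joined with half s of the edge e_i.
spoke : Fin 3 → Side → Fin 6
spoke 0F L = 0F
spoke 1F L = 1F
spoke 2F L = 2F
spoke 0F R = 3F
spoke 1F R = 4F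
spoke 2F R = 5F

unspoke : Fin 6 → Fin 3 × Side
unspoke 0F = 0F , L
unspoke 1F = 1F , L
unspoke 2F = 2F , L
unspoke 3F = 0F , R
unspoke 4F = 1F , R
unspoke 5F = 2F , R

spoke-unspoke : ∀ j → spoke (proj₁ (unspoke j)) (proj₂ (unspoke j)) ≡ j
spoke-unspoke 0F = refl
spoke-unspoke 1F = refl
spoke-unspoke 2F = refl
spoke-unspoke 3F = refl
spoke-unspoke 4F = refl
spoke-unspoke 5F = refl

unspoke-spoke : ∀ i s → unspoke (spoke i s) ≡ (i , s)
unspoke-spoke 0F L = refl
unspoke-spoke 1F L = refl
unspoke-spoke 2F L = refl
unspoke-spoke 0F R = refl
unspoke-spoke 1F R = refl
unspoke-spoke 2F R = refl

map-nth : {A A′ : Set} (f : A → A′) (xss : List (List A)) → ∀ n → map f (nth xss n) ≡ nth (map (map f) xss) n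
map-nth f []         n       = refl
map-nth f (xs ∷ xss) zero    = refl
map-nth f (xs ∷ xss) (suc n) = map-nth f xss n

map-zip : {A A′ B B′ : Set} (f : A → A′) (g : B → B′) → ∀ xs ys →
  map (λ p → f (proj₁ p) , g (proj₂ p)) (zip xs ys) ≡ zip (map f xs) (map g ys)
map-zip f g []       ys       = refl
map-zip f g (x ∷ xs) []       = refl
map-zip f g (x ∷ xs) (y ∷ ys) = cong (_ ∷_) (map-zip f g xs ys)

empty-list : {A : Set} (xs : List A) → (∀ {x} → x ∉ xs) → xs ≡ []
empty-list []       e = refl
empty-list (x ∷ xs) e = ⊥-elim (e (here refl))

below6 : ∀ n → {n<6 : True (n <? 6)} → n < 6
below6 n {n<6} = toWitness n<6

newVertices : ∀ n → List (Fin (n + 3))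
newVertices n = map (n ↑ʳ_) (0F ∷ 1F ∷ 2F ∷ [])

poles : Multipole → Multipole → Multipole → Multipole
poles T₁ T₂ T₃ = addVertices (T₁ ⊎M (T₂ ⊎M T₃)) 3

-- The local zipping function of `TTTsc` and `zip` compute to the same list once the three
-- connectors are explicit triples.
TTTsc-zip : ∀ T₁ T₂ T₃ → let U = poles T₁ T₂ T₃ ; vs = newVertices (nV (T₁ ⊎M (T₂ ⊎M T₃))) in
  ∀ {a b c a′ b′ c′ a″ b″ c″} →
  nthConn U 1 ≡ a ∷ b ∷ c ∷ [] → nthConn U 3 ≡ a′ ∷ b′ ∷ c′ ∷ [] → nthConn U 5 ≡ a″ ∷ b″ ∷ c″ ∷ [] →
  TTTsc T₁ T₂ T₃ ≡
    dropEmptyConns (attachAll U (zip (nthConn U 1) vs ++ zip (nthConn U 3) vs ++ zip (nthConn U 5) vs))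
TTTsc-zip T₁ T₂ T₃ eq₁ eq₂ eq₃ rewrite eq₁ | eq₂ | eq₃ = refl

map-triple : {A A′ : Set} (f : A → A′) {x y z : A′} (xs : List A) → map f xs ≡ x ∷ y ∷ z ∷ [] →
  ∃[ a ] ∃[ b ] ∃[ c ] xs ≡ a ∷ b ∷ c ∷ []
map-triple f (a ∷ b ∷ c ∷ []) eq = a , b , c , refl

module Assembly (P : Fin 3 → Pole) where

  module P i = Pole (P i)

  -- `cy` and `sp` are the cycle edges and the dangling edges of `H6`, `be i s` is half `s` of e_i,
  -- and `te i d` is an edge of the i-th graph. Dead names, such as `te i d` with `d` the cut edge,
  -- are excluded by the predicates `live`. In `VN`, likewise, `hv` is on the 6-cycle, `tv` in a
  -- pole, and `nv` is a new vertex.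
  data N : Set where
    cy sp : Fin 6 → N
    be    : Fin 3 → Side → N
    te    : (i : Fin 3) → Fin (nE (P.G i)) → N

  data VN : Set where
    hv : Fin 6 → VN
    tv : (i : Fin 3) → Fin (nV (P.G i)) → VN
    nv : Fin 3 → VN

  _≟N_ : (n n′ : N) → Dec (n ≡ n′)
  cy j   ≟N cy k   = map′ (cong cy) (λ { refl → refl }) (j ≟ k)
  cy _   ≟N sp _   = no λ ()
  cy _   ≟N be _ _ = no λ ()
  cy _   ≟N te _ _ = no λ ()
  sp _   ≟N cy _   = no λ ()
  sp j   ≟N sp k   = map′ (cong sp) (λ { refl → refl }) (j ≟ k)
  sp _   ≟N be _ _ = no λ ()
  sp _   ≟N te _ _ = no λ ()
  be _ _ ≟N cy _   = no λ ()
  be _ _ ≟N sp _   = no λ ()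
  be i s ≟N be k t with i ≟ k | s ≟S t
  ... | yes refl | yes refl = yes refl
  ... | no i≢k   | _        = no λ { refl → i≢k refl }
  ... | yes _    | no s≢t   = no λ { refl → s≢t refl }
  be _ _ ≟N te _ _ = no λ ()
  te _ _ ≟N cy _   = no λ ()
  te _ _ ≟N sp _   = no λ ()
  te _ _ ≟N be _ _ = no λ ()
  te i d ≟N te k f with i ≟ k
  ... | no i≢k = no λ { refl → i≢k refl }
  ... | yes refl with d ≟ f
  ...   | yes refl = yes refl
  ...   | no d≢f   = no λ { refl → d≢f refl }

  open Naming {N} {VN} _≟N_ public

  liveH : N → Set
  liveH (cy _)   = ⊤
  liveH (sp _)   = ⊤
  liveH (be _ _) = ⊥
  liveH (te _ _) = ⊥

  vliveH : VN → Set
  vliveH (hv _)   = ⊤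
  vliveH (tv _ _) = ⊥
  vliveH (nv _)   = ⊥

  liveT : Fin 3 → N → Set
  liveT i (cy _)   = ⊥
  liveT i (sp _)   = ⊥
  liveT i (be k s) = k ≡ i
  liveT i (te k d) = k ≡ i × d ≢ P.e k

  vliveT : Fin 3 → VN → Set
  vliveT i (hv _)   = ⊥
  vliveT i (tv k x) = k ≡ i × x ≢ P.w k
  vliveT i (nv _)   = ⊥

  vliveN : VN → Set
  vliveN (hv _)   = ⊥
  vliveN (tv _ _) = ⊥
  vliveN (nv _)   = ⊤

  place : ∀ i → Maybe (Fin (nV (P.G i))) → Maybe VN
  place i (just x) = if does (x ≟ P.w i) then nothing else just (tv i x)
  place i nothing  = nothing

  -- One end map for `H6` and the three poles while nothing is joined. The parts are told apart by
  -- liveness alone, so disjoint unions leave the map unchanged.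
  en₀ : EndMap
  en₀ (cy j)   t = Maybe.map hv (hexEnd (inj₁ j) t)
  en₀ (sp j)   t = Maybe.map hv (hexEnd (inj₂ j) t)
  en₀ (be i s) L = place i (end (P.G i) (P.e i) s)
  en₀ (be i s) R = nothing
  en₀ (te i d) t = place i (end (P.G i) d t)

  named-H6 : Named H6 liveH vliveH en₀ (onR
    ((sp 0F ∷ sp 3F ∷ []) ∷ (sp 1F ∷ sp 4F ∷ []) ∷ (sp 2F ∷ sp 5F ∷ []) ∷ []))
  named-H6 = record
    { edges = names-⇔ (λ { {cy _} _ → tt ; {sp _} _ → tt ; {be _ _} (inj₁ ()) ; {be _ _} (inj₂ ()) ; {te _ _} (inj₁ ()) ; {te _ _} (inj₂ ()) })
                      (λ { {cy _} _ → inj₁ tt ; {sp _} _ → inj₂ tt })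
                (names-⊎ cys sps λ { {cy _} _ () ; {sp _} () _ })
    ; verts = record { name = hv ; name-inj = λ { refl → refl } ; name-live = λ _ → tt ; name-onto = λ { {hv j} _ → j , refl } }
    ; ends  = λ i t → trans (cong (Maybe.map hv) (H6-end i t)) (ends′ (splitAt 6 i) t)
    ; conn  = refl }
    where
    isCy isSp : N → Set
    isCy (cy _) = ⊤
    isCy _      = ⊥
    isSp (sp _) = ⊤
    isSp _      = ⊥
    cys : Names 6 isCy
    cys = record { name = cy ; name-inj = λ { refl → refl } ; name-live = λ _ → tt ; name-onto = λ { {cy j} _ → j , refl } }
    sps : Names 6 isSp
    sps = record { name = sp ; name-inj = λ { refl → refl } ; name-live = λ _ → tt ; name-onto = λ { {sp j} _ → j , refl } }
    ends′ : ∀ x t → Maybe.map hv (hexEnd x t) ≡ en₀ ([ cy , sp ]′ x) t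
    ends′ (inj₁ j) t = refl
    ends′ (inj₂ j) t = refl

  Bₙ Cₙ : Fin 3 → List (N × Side)
  Bₙ i = (be i L , R) ∷ (be i R , R) ∷ []
  Cₙ i = map (λ k → te i (proj₁ (P.c i k)) , proj₂ (P.c i k)) (0F ∷ 1F ∷ 2F ∷ [])

  named-pole : ∀ i → Named (P.pole i) (liveT i) (vliveT i) en₀ (Bₙ i ∷ Cₙ i ∷ [])
  named-pole i = record
    { edges = record { name = nm ; name-inj = λ {x} {y} → nm-inj x y ; name-live = nm-live ; name-onto = nm-onto }
    ; verts = record { name = λ y → tv i (skip w y) ; name-inj = λ eq → skip-injective w (tv-inj eq)
                     ; name-live = λ y → refl , skip-≢ w y ; name-onto = v-onto }
    ; ends = ends′
    ; conn = trans (cong (map (map _)) pole-conns) (cong₂ _∷_ (cong₂ _∷_ (cong (_, R) nm-e) (cong₂ _∷_ (cong (_, R) nm-last) refl))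
        (cong (_∷ []) (cong₂ _∷_ (nm-c 0F) (cong₂ _∷_ (nm-c 1F) (cong₂ _∷_ (nm-c 2F) refl))))) }
    where
    open P i
    nm : Fin (suc (nE G)) → N
    nm x with last? x
    ... | last  = be i R
    ... | old d = if does (d ≟ e) then be i L else te i d
    tv-inj : ∀ {x y} → tv i x ≡ tv i y → x ≡ y
    tv-inj refl = refl
    nm-inj : ∀ x y → nm x ≡ nm y → x ≡ y
    nm-inj x y eq with last? x | last? y
    nm-inj x y eq | last | last = refl
    nm-inj x y eq | last | old d with d ≟ e
    nm-inj x y () | last | old d | yes _
    nm-inj x y () | last | old d | no _
    nm-inj x y eq | old d | last with d ≟ e
    nm-inj x y () | old d | last | yes _
    nm-inj x y () | old d | last | no _
    nm-inj x y eq | old d | old f with d ≟ e | f ≟ e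
    nm-inj x y eq   | old d | old f | yes refl | yes refl = refl
    nm-inj x y refl | old d | old f | no _     | no _     = refl
    nm-live : ∀ x → liveT i (nm x)
    nm-live x with last? x
    ... | last = refl
    ... | old d with d ≟ e
    ...   | yes _  = refl
    ...   | no d≢e = refl , d≢e
    nm-e : nm (inject₁ e) ≡ be i L
    nm-e rewrite last?-inject₁ e | dec-true (e ≟ e) refl = refl
    nm-last : nm (fromℕ (nE G)) ≡ be i R
    nm-last rewrite last?-fromℕ (nE G) = refl
    nm-other : ∀ {d} → d ≢ e → nm (inject₁ d) ≡ te i d
    nm-other {d} d≢e rewrite last?-inject₁ d | dec-false (d ≟ e) d≢e = refl
    nm-c : ∀ k → (nm (inject₁ (proj₁ (c k))) , proj₂ (c k)) ≡ (te i (proj₁ (c k)) , proj₂ (c k))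
    nm-c k = cong (_, proj₂ (c k)) (nm-other (c≢e k))
    nm-onto : ∀ {n} → liveT i n → ∃ λ x → nm x ≡ n
    nm-onto {be k L} refl = inject₁ e , nm-e
    nm-onto {be k R} refl = fromℕ (nE G) , nm-last
    nm-onto {te k d} (refl , d≢e) = inject₁ d , nm-other d≢e
    v-onto : ∀ {x} → vliveT i x → ∃ λ y → tv i (skip w y) ≡ x
    v-onto {tv k x} (refl , x≢w) with y , refl ← skip-onto {v = w} {x} (≢-sym x≢w) = y , refl
    placed : ∀ m → Maybe.map (λ y → tv i (skip w y)) (m >>= removeIdx w) ≡ place i m
    placed nothing  = refl
    placed (just x) with x ≟ w
    placed (just x) | no x≢w with y , eq ← removeIdx-≢ {v = w} {x} (≢-sym x≢w) rewrite eq =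
      cong (λ z → just (tv i z)) (removeIdx⁻ w x eq)
    placed (just x) | yes refl with removeIdx w w in eq
    ... | nothing = refl
    ... | just y  = contradiction (removeIdx⁻ w w eq) (skip-≢ w y)
    ends′ : ∀ x t → Maybe.map (λ y → tv i (skip w y)) (end (cutEdge G e) x t >>= removeIdx w) ≡ en₀ (nm x) t
    ends′ x t with last? x
    ends′ x L | last rewrite cut-last-L G e = placed (end G e R)
    ends′ x R | last rewrite cut-last-R G e = refl
    ends′ x t | old d with d ≟ e
    ends′ x L | old d | yes refl rewrite cut-L G e = placed (end G e L)
    ends′ x R | old d | yes refl rewrite cut-R G e = refl
    ends′ x t | old d | no d≢e rewrite cut-other G e d≢e t = placed (end G d t)

  Keys : Set
  Keys = List ((N × Side) × VN)

  updAll : EndMap → Keys → EndMap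
  updAll en []             = en
  updAll en ((p , x) ∷ ks) = updAll (upd en p (just x)) ks

  detach : Keys → List (N × Side) → List (N × Side)
  detach []             l = l
  detach ((p , _) ∷ ks) l = detach ks (filterᵇ (λ q → not (does (q ≟P p))) l)

  named-attachAll : ∀ {M live vlive en cs} (ν : Named M live vlive en cs) (ps : List (EndOf M × Fin (nV M))) →
    let ks = map (λ p → nmE ν (proj₁ p) , name (verts ν) (proj₂ p)) ps in
    Named (attachAll M ps) live vlive (updAll en ks) (map (detach ks) cs)
  named-attachAll {cs = cs} ν [] = named-⇔ ν (λ l → l) (λ l → l) (λ l → l) (λ l → l) (λ _ _ → refl) (sym (Listₚ.map-id cs))
  named-attachAll {cs = cs} ν ((p , x) ∷ ps) =
    named-⇔ (named-attachAll (named-attach ν p x) ps) (λ l → l) (λ l → l) (λ l → l) (λ l → l) (λ _ _ → refl) (sym (Listₚ.map-∘ cs))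

  updAll-miss : ∀ en ks q → (∀ {x} → (q , x) ∉ ks) → updAll en ks (proj₁ q) (proj₂ q) ≡ en (proj₁ q) (proj₂ q)
  updAll-miss en []             q q∉ = refl
  updAll-miss en ((p , x) ∷ ks) q q∉ = trans (updAll-miss _ ks q (λ m → q∉ (there m)))
    (cong (if_then just x else en (proj₁ q) (proj₂ q)) (dec-false (q ≟P p) (λ { refl → q∉ (here refl) })))

  -- Later entries override earlier ones, which is harmless when all entries for `q` agree. The
  -- disjunction is the invariant of the recursion: `q` is already set, or its entry is still to
  -- come.
  updAll-hit : ∀ en ks q {x} → (∀ {y} → (q , y) ∈ ks → y ≡ x) →
    en (proj₁ q) (proj₂ q) ≡ just x ⊎ (∃ λ y → (q , y) ∈ ks) → updAll en ks (proj₁ q) (proj₂ q) ≡ just x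
  updAll-hit en [] q u (inj₁ eq) = eq
  updAll-hit en ((p , y) ∷ ks) q {x} u h = updAll-hit _ ks q (λ m → u (there m)) (h′ h)
    where
    h′ : en (proj₁ q) (proj₂ q) ≡ just x ⊎ (∃ λ z → (q , z) ∈ (p , y) ∷ ks) →
      upd en p (just y) (proj₁ q) (proj₂ q) ≡ just x ⊎ (∃ λ z → (q , z) ∈ ks)
    h′ h with q ≟P p
    h′ h                     | yes refl = inj₁ (cong just (u (here refl)))
    h′ (inj₁ eq)             | no _     = inj₁ eq
    h′ (inj₂ (z , here refl)) | no q≢p   = contradiction refl q≢p
    h′ (inj₂ (z , there m))  | no _     = inj₂ (z , m)

  detach-∈ : ∀ ks l {q} → q ∈ detach ks l → q ∈ l × (∀ {x} → (q , x) ∉ ks)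
  detach-∈ []             l q∈ = q∈ , λ ()
  detach-∈ ((p , x) ∷ ks) l {q} q∈ with q∈′ , q∉ ← detach-∈ ks _ q∈
    with q∈l , keep ← ∈-filter⁻ (λ r → T? (not (does (r ≟P p)))) {xs = l} q∈′ = q∈l , q∉′
    where
    q∉′ : ∀ {y} → (q , y) ∉ (p , x) ∷ ks
    q∉′ (here refl) = subst (λ b → T (not b)) (dec-true (q ≟P q) refl) keep
    q∉′ (there m)   = q∉ m

  detach-[] : ∀ ks l → (∀ {q} → q ∈ l → ∃ λ x → (q , x) ∈ ks) → detach ks l ≡ []
  detach-[] ks l all∈ = empty-list _ λ q∈ → let q∈l , q∉ = detach-∈ ks l q∈ in q∉ (proj₂ (all∈ q∈l))

  newVs : Names 3 vliveN
  newVs = record { name = nv ; name-inj = λ { refl → refl } ; name-live = λ _ → tt ; name-onto = λ { {nv k} _ → k , refl } }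

  liveP : N → Set
  liveP n = liveT 0F n ⊎ (liveT 1F n ⊎ liveT 2F n)

  vliveP : VN → Set
  vliveP x = (vliveT 0F x ⊎ (vliveT 1F x ⊎ vliveT 2F x)) ⊎ vliveN x

  poleConns : Conns
  poleConns = Bₙ 0F ∷ Cₙ 0F ∷ Bₙ 1F ∷ Cₙ 1F ∷ Bₙ 2F ∷ Cₙ 2F ∷ []

  Named-pole : Fin 3 → Multipole → Set
  Named-pole i M = Named M (liveT i) (vliveT i) en₀ (Bₙ i ∷ Cₙ i ∷ [])

  named-poles : ∀ {T₁ T₂ T₃} → Named-pole 0F T₁ → Named-pole 1F T₂ → Named-pole 2F T₃ →
    Σ (Named (poles T₁ T₂ T₃) liveP vliveP en₀ poleConns) λ ν →
      map (name (verts ν)) (newVertices (nV (T₁ ⊎M (T₂ ⊎M T₃)))) ≡ nv 0F ∷ nv 1F ∷ nv 2F ∷ []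
  named-poles {T₁} {T₂} {T₃} ν₁ ν₂ ν₃ = named-addVertices vN-disj ν newVs ,
    cong₂ _∷_ (fresh 0F) (cong₂ _∷_ (fresh 1F) (cong (_∷ []) (fresh 2F)))
    where
    apart : ∀ {i j} → i ≢ j → ∀ {n} → liveT i n → liveT j n → ⊥
    apart i≢j {be _ _} refl eq = i≢j eq
    apart i≢j {te _ _} (refl , _) (eq , _) = i≢j eq
    vapart : ∀ {i j} → i ≢ j → ∀ {x} → vliveT i x → vliveT j x → ⊥
    vapart i≢j {tv _ _} (refl , _) (eq , _) = i≢j eq
    vN-disj : ∀ {x} → vliveT 0F x ⊎ (vliveT 1F x ⊎ vliveT 2F x) → vliveN x → ⊥
    vN-disj {nv _} (inj₁ ()) _
    vN-disj {nv _} (inj₂ (inj₁ ())) _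
    vN-disj {nv _} (inj₂ (inj₂ ())) _
    ν : Named (T₁ ⊎M (T₂ ⊎M T₃)) liveP _ en₀ poleConns
    ν = named-⊎
      (λ { l (inj₁ l′) → apart (λ ()) l l′ ; l (inj₂ l′) → apart (λ ()) l l′ })
      (λ { l (inj₁ l′) → vapart (λ ()) l l′ ; l (inj₂ l′) → vapart (λ ()) l l′ })
      ν₁ (named-⊎ (apart (λ ())) (vapart (λ ())) ν₂ ν₃)
    fresh : ∀ k → name-⊎ (verts ν) newVs (nV (T₁ ⊎M (T₂ ⊎M T₃)) ↑ʳ k) ≡ nv k
    fresh = name-↑ʳ (verts ν) newVs

  nvs : List VN
  nvs = nv 0F ∷ nv 1F ∷ nv 2F ∷ []

  keys : Keys
  keys = zip (Cₙ 0F) nvs ++ zip (Cₙ 1F) nvs ++ zip (Cₙ 2F) nvs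

  key : Fin 3 → Fin 3 → N × Side
  key i k = te i (proj₁ (P.c i k)) , proj₂ (P.c i k)

  ∈-keys⁺ : ∀ i k → (key i k , nv k) ∈ keys
  ∈-keys⁺ 0F 0F = here refl
  ∈-keys⁺ 0F 1F = there (here refl)
  ∈-keys⁺ 0F 2F = there (there (here refl))
  ∈-keys⁺ 1F 0F = there (there (there (here refl)))
  ∈-keys⁺ 1F 1F = there (there (there (there (here refl))))
  ∈-keys⁺ 1F 2F = there (there (there (there (there (here refl)))))
  ∈-keys⁺ 2F 0F = there (there (there (there (there (there (here refl))))))
  ∈-keys⁺ 2F 1F = there (there (there (there (there (there (there (here refl)))))))
  ∈-keys⁺ 2F 2F = there (there (there (there (there (there (there (there (here refl))))))))

  ∈-keys⁻ : ∀ {q x} → (q , x) ∈ keys → ∃[ i ] ∃[ k ] q ≡ key i k × x ≡ nv k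
  ∈-keys⁻ m = All.lookup {P = λ { (q , x) → ∃[ i ] ∃[ k ] q ≡ key i k × x ≡ nv k }}
    ((0F , 0F , refl , refl) ∷ (0F , 1F , refl , refl) ∷ (0F , 2F , refl , refl) ∷
     (1F , 0F , refl , refl) ∷ (1F , 1F , refl , refl) ∷ (1F , 2F , refl , refl) ∷
     (2F , 0F , refl , refl) ∷ (2F , 1F , refl , refl) ∷ (2F , 2F , refl , refl) ∷ []) m

  te-index : ∀ {i j d f} → te i d ≡ te j f → i ≡ j
  te-index refl = refl

  te-injective : ∀ {i d f} → te i d ≡ te i f → d ≡ f
  te-injective refl = refl

  key-injective : ∀ {i j k l} → key i k ≡ key j l → k ≡ l
  key-injective {i} {j} {k} {l} eq with refl ← te-index (cong proj₁ eq) =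
    Darts.dart-inj (P.w-darts i) (cong₂ _,_ (te-injective (cong proj₁ eq)) (cong proj₂ eq))

  en₁ : EndMap
  en₁ = updAll en₀ keys

  en₁-inner : ∀ {i d t x} → end (P.G i) d t ≡ just x → x ≢ P.w i → en₁ (te i d) t ≡ just (tv i x)
  en₁-inner {i} {d} {t} {x} eq x≢w = trans (updAll-miss en₀ keys (te i d , t) miss)
    (trans (cong (place i) eq) (cong (if_then nothing else just (tv i x)) (dec-false (x ≟ P.w i) x≢w)))
    where
    miss : ∀ {y} → ((te i d , t) , y) ∉ keys
    miss m with j , k , refl , _ ← ∈-keys⁻ m =
      x≢w (Maybeₚ.just-injective (trans (sym eq) (Darts.dart-at (P.w-darts i) k)))

  en₁-c : ∀ i k → en₁ (te i (proj₁ (P.c i k))) (proj₂ (P.c i k)) ≡ just (nv k)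
  en₁-c i k = updAll-hit en₀ keys (key i k) uniq (inj₂ (nv k , ∈-keys⁺ i k))
    where
    uniq : ∀ {y} → (key i k , y) ∈ keys → y ≡ nv k
    uniq m with j , l , eq , refl ← ∈-keys⁻ m = cong nv (sym (key-injective eq))

  named-attached : ∀ {M live vlive} (ν : Named M live vlive en₀ poleConns) (xs : Fin 3 → List (EndOf M)) (vs : List (Fin (nV M))) →
    (∀ i → map (nmE ν) (xs i) ≡ Cₙ i) → map (name (verts ν)) vs ≡ nvs →
    Named (dropEmptyConns (attachAll M (zip (xs 0F) vs ++ zip (xs 1F) vs ++ zip (xs 2F) vs))) live vlive en₁
      (Bₙ 0F ∷ Bₙ 1F ∷ Bₙ 2F ∷ [])
  named-attached {M} ν xs vs xs-eq vs-eq = named-⇔ (named-dropEmpty (named-attachAll ν ps)) (λ l → l) (λ l → l) (λ l → l) (λ l → l)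
    (λ {n} _ t → cong (λ ks → updAll en₀ ks n t) keys-eq)
    (cong (filterᵇ (λ c → not (null c))) (trans (cong (λ ks → map (detach ks) poleConns) keys-eq) detached))
    where
    ps : List (EndOf M × Fin (nV M))
    ps = zip (xs 0F) vs ++ zip (xs 1F) vs ++ zip (xs 2F) vs
    nm² : EndOf M × Fin (nV M) → (N × Side) × VN
    nm² p = nmE ν (proj₁ p) , name (verts ν) (proj₂ p)
    part : ∀ i → map nm² (zip (xs i) vs) ≡ zip (Cₙ i) nvs
    part i = trans (map-zip (nmE ν) (name (verts ν)) (xs i) vs) (cong₂ zip (xs-eq i) vs-eq)
    keys-eq : map nm² ps ≡ keys
    keys-eq = trans (Listₚ.map-++ nm² (zip (xs 0F) vs) _) (cong₂ _++_ (part 0F)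
      (trans (Listₚ.map-++ nm² (zip (xs 1F) vs) _) (cong₂ _++_ (part 1F) (part 2F))))
    C-gone : ∀ i → detach keys (Cₙ i) ≡ []
    C-gone i = detach-[] keys (Cₙ i) λ
      { (here refl) → nv 0F , ∈-keys⁺ i 0F ; (there (here refl)) → nv 1F , ∈-keys⁺ i 1F
      ; (there (there (here refl))) → nv 2F , ∈-keys⁺ i 2F }
    detached : map (detach keys) poleConns ≡ Bₙ 0F ∷ [] ∷ Bₙ 1F ∷ [] ∷ Bₙ 2F ∷ [] ∷ []
    detached = cong (Bₙ 0F ∷_) (cong₂ _∷_ (C-gone 0F) (cong (Bₙ 1F ∷_) (cong₂ _∷_ (C-gone 1F)
      (cong (Bₙ 2F ∷_) (cong (_∷ []) (C-gone 2F))))))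

  named-TTTsc : ∀ {T₁ T₂ T₃} → Σ (Named (poles T₁ T₂ T₃) liveP vliveP en₀ poleConns) (λ ν →
      map (name (verts ν)) (newVertices (nV (T₁ ⊎M (T₂ ⊎M T₃)))) ≡ nvs) →
    Named (TTTsc T₁ T₂ T₃) liveP vliveP en₁ (Bₙ 0F ∷ Bₙ 1F ∷ Bₙ 2F ∷ [])
  named-TTTsc {T₁} {T₂} {T₃} (ν , vs-eq) =
    subst (λ M → Named M liveP vliveP en₁ (Bₙ 0F ∷ Bₙ 1F ∷ Bₙ 2F ∷ []))
      (sym (TTTsc-zip T₁ T₂ T₃ (eq₃ 0F) (eq₃ 1F) (eq₃ 2F)))
      (named-attached ν xs (newVertices (nV (T₁ ⊎M (T₂ ⊎M T₃)))) xs-eq vs-eq)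
    where
    U = poles T₁ T₂ T₃
    xs : Fin 3 → List (EndOf U)
    xs 0F = nthConn U 1
    xs 1F = nthConn U 3
    xs 2F = nthConn U 5
    C-name : ∀ n → n < 6 → map (nmE ν) (nthConn U n) ≡ nth poleConns n
    C-name n n<6 = trans (cong (map (nmE ν)) (nthConn-nth U n n<6))
      (trans (map-nth (nmE ν) (conns U) n) (cong (λ css → nth css n) (conn ν)))
    xs-eq : ∀ i → map (nmE ν) (xs i) ≡ Cₙ i
    xs-eq 0F = C-name 1 (below6 1)
    xs-eq 1F = C-name 3 (below6 3)
    xs-eq 2F = C-name 5 (below6 5)
    triple : ∀ i → ∃[ a ] ∃[ b ] ∃[ c ] xs i ≡ a ∷ b ∷ c ∷ []
    triple i = map-triple (nmE ν) (xs i) (xs-eq i)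
    eq₃ : ∀ i → xs i ≡ proj₁ (triple i) ∷ proj₁ (proj₂ (triple i)) ∷ proj₁ (proj₂ (proj₂ (triple i))) ∷ []
    eq₃ i = proj₂ (proj₂ (proj₂ (triple i)))

  live : N → Set
  live (cy _)   = ⊤
  live (sp _)   = ⊤
  live (be _ _) = ⊥
  live (te i d) = d ≢ P.e i

  vlive : VN → Set
  vlive (hv _)   = ⊤
  vlive (tv i x) = x ≢ P.w i
  vlive (nv _)   = ⊤

  en : EndMap
  en (cy j)   t = Maybe.map hv (hexEnd (inj₁ j) t)
  en (sp j)   L = just (hv j)
  en (sp j)   R = let i , s = unspoke j in place i (end (P.G i) (P.e i) s)
  en (be i s) t = nothing
  en (te i d) t = en₁ (te i d) t

  liveU : N → Set
  liveU n = liveH n ⊎ liveP n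

  vliveU : VN → Set
  vliveU x = vliveH x ⊎ vliveP x

  joinedConns : List (List N)
  joinedConns = (sp 0F ∷ sp 3F ∷ []) ∷ (sp 1F ∷ sp 4F ∷ []) ∷ (sp 2F ∷ sp 5F ∷ []) ∷
    (be 0F L ∷ be 0F R ∷ []) ∷ (be 1F L ∷ be 1F R ∷ []) ∷ (be 2F L ∷ be 2F R ∷ []) ∷ []

  named-joined : ∀ {M} → Named M liveU vliveU en₁ (onR joinedConns) →
    Named (dropEmptyConns (junctionConns 2 (junctionConns 2 (junctionConns 2 M 0 3) 1 4) 2 5)) live vlive en []
  named-joined ν₀ =
    -- Exhausted connectors remain in place as empty lists, so the indices 0 to 5 keep their meaning
    -- until `named-dropEmpty` removes them all at the end.
    named-junctionConns ν₀ 1 0 3 (below6 0) (below6 3) refl refl Goal₀ λ _ ν₁ →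
    named-junctionConns ν₁ 0 0 3 (below6 0) (below6 3) refl refl Goal₀ λ _ ν₂ →
    named-junctionConns ν₂ 1 1 4 (below6 1) (below6 4) refl refl Goal₁ λ _ ν₃ →
    named-junctionConns ν₃ 0 1 4 (below6 1) (below6 4) refl refl Goal₁ λ _ ν₄ →
    named-junctionConns ν₄ 1 2 5 (below6 2) (below6 5) refl refl Goal₂ λ _ ν₅ →
    named-junctionConns ν₅ 0 2 5 (below6 2) (below6 5) refl refl Goal₂ λ _ ν₆ →
    named-⇔ (named-dropEmpty ν₆) l→ l← v→ v← ends-eq refl
    where
    Goal₂ Goal₁ Goal₀ : Multipole → Set
    Goal₂ M = Named (dropEmptyConns M) live vlive en []
    Goal₁ M = Goal₂ (junctionConns 2 M 2 5)
    Goal₀ M = Goal₁ (junctionConns 2 M 1 4)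
    Joined : N → Set
    Joined n = (((((liveU n × n ≢ be 0F L) × n ≢ be 0F R) × n ≢ be 1F L) × n ≢ be 1F R) × n ≢ be 2F L) × n ≢ be 2F R
    l→ : ∀ {n} → Joined n → live n
    l→ {cy _} _ = tt
    l→ {sp _} _ = tt
    l→ {be 0F L} ((((((_ , ne) , _) , _) , _) , _) , _) = ne refl
    l→ {be 0F R} (((((_ , ne) , _) , _) , _) , _) = ne refl
    l→ {be 1F L} ((((_ , ne) , _) , _) , _) = ne refl
    l→ {be 1F R} (((_ , ne) , _) , _) = ne refl
    l→ {be 2F L} ((_ , ne) , _) = ne refl
    l→ {be 2F R} (_ , ne) = ne refl
    l→ {te _ _} ((((((inj₂ (inj₁ (_ , d≢e)) , _) , _) , _) , _) , _) , _) = d≢e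
    l→ {te _ _} ((((((inj₂ (inj₂ (inj₁ (_ , d≢e))) , _) , _) , _) , _) , _) , _) = d≢e
    l→ {te _ _} ((((((inj₂ (inj₂ (inj₂ (_ , d≢e))) , _) , _) , _) , _) , _) , _) = d≢e
    l← : ∀ {n} → live n → Joined n
    l← {cy _} _ = (((((inj₁ tt , λ ()) , λ ()) , λ ()) , λ ()) , λ ()) , λ ()
    l← {sp _} _ = (((((inj₁ tt , λ ()) , λ ()) , λ ()) , λ ()) , λ ()) , λ ()
    l← {te i d} d≢e = (((((inj₂ (part i d≢e) , λ ()) , λ ()) , λ ()) , λ ()) , λ ()) , λ ()
      where
      part : ∀ i {d} → d ≢ P.e i → liveP (te i d)
      part 0F ne = inj₁ (refl , ne)
      part 1F ne = inj₂ (inj₁ (refl , ne))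
      part 2F ne = inj₂ (inj₂ (refl , ne))
    v→ : ∀ {x} → vliveU x → vlive x
    v→ {hv _} _ = tt
    v→ {nv _} _ = tt
    v→ {tv _ _} (inj₂ (inj₁ (inj₁ (_ , ne)))) = ne
    v→ {tv _ _} (inj₂ (inj₁ (inj₂ (inj₁ (_ , ne))))) = ne
    v→ {tv _ _} (inj₂ (inj₁ (inj₂ (inj₂ (_ , ne))))) = ne
    v← : ∀ {x} → vlive x → vliveU x
    v← {hv _} _ = inj₁ tt
    v← {nv _} _ = inj₂ (inj₂ tt)
    v← {tv 0F _} ne = inj₂ (inj₁ (inj₁ (refl , ne)))
    v← {tv 1F _} ne = inj₂ (inj₁ (inj₂ (inj₁ (refl , ne))))
    v← {tv 2F _} ne = inj₂ (inj₁ (inj₂ (inj₂ (refl , ne))))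
    join : EndMap → N → N → EndMap
    join f a b = upd f (a , R) (f b L)
    ends-eq : ∀ {n} → Joined n → ∀ t →
      join (join (join (join (join (join en₁ (sp 0F) (be 0F L)) (sp 3F) (be 0F R)) (sp 1F) (be 1F L)) (sp 4F) (be 1F R))
        (sp 2F) (be 2F L)) (sp 5F) (be 2F R) n t ≡ en n t
    ends-eq {cy _} _ L = refl
    ends-eq {cy _} _ R = refl
    ends-eq {te _ _} _ t = refl
    ends-eq {be i s} l t = ⊥-elim (l→ {be i s} l)
    ends-eq {sp 0F} _ L = refl
    ends-eq {sp 1F} _ L = refl
    ends-eq {sp 2F} _ L = refl
    ends-eq {sp 3F} _ L = refl
    ends-eq {sp 4F} _ L = refl
    ends-eq {sp 5F} _ L = refl
    ends-eq {sp 0F} _ R = refl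
    ends-eq {sp 1F} _ R = refl
    ends-eq {sp 2F} _ R = refl
    ends-eq {sp 3F} _ R = refl
    ends-eq {sp 4F} _ R = refl
    ends-eq {sp 5F} _ R = refl

  named-H6⋆ : ∀ {M} → Named M liveP vliveP en₁ (Bₙ 0F ∷ Bₙ 1F ∷ Bₙ 2F ∷ []) → Named (H6⋆ M) live vlive en []
  named-H6⋆ ν = named-joined (named-⊎ disj vdisj
      (named-⇔ named-H6 (λ l → l) (λ l → l) (λ l → l) (λ l → l) (λ { {cy _} _ _ → refl ; {sp _} _ _ → refl }) refl)
      ν)
    where
    disj : ∀ {n} → liveH n → liveP n → ⊥
    disj {cy _} _ (inj₁ ())
    disj {cy _} _ (inj₂ (inj₁ ()))
    disj {cy _} _ (inj₂ (inj₂ ()))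
    disj {sp _} _ (inj₁ ())
    disj {sp _} _ (inj₂ (inj₁ ()))
    disj {sp _} _ (inj₂ (inj₂ ()))
    vdisj : ∀ {x} → vliveH x → vliveP x → ⊥
    vdisj {hv _} _ (inj₁ (inj₁ ()))
    vdisj {hv _} _ (inj₁ (inj₂ (inj₁ ())))
    vdisj {hv _} _ (inj₁ (inj₂ (inj₂ ())))
    vdisj {hv _} _ (inj₂ ())

  named-H6⋆-TTTsc : ∀ T₁ T₂ T₃ → Named-pole 0F T₁ → Named-pole 1F T₂ → Named-pole 2F T₃ →
    Named (H6⋆ (TTTsc T₁ T₂ T₃)) live vlive en []
  named-H6⋆-TTTsc T₁ T₂ T₃ ν₁ ν₂ ν₃ =
    named-H6⋆ {TTTsc T₁ T₂ T₃} (named-TTTsc {T₁} {T₂} {T₃} (named-poles {T₁} {T₂} {T₃} ν₁ ν₂ ν₃))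

  -- Equations rather than the poles themselves: the composite must not be
  -- unfolded at concrete poles.
  named-F : ∀ {T₁ T₂ T₃} → T₁ ≡ P.pole 0F → T₂ ≡ P.pole 1F → T₃ ≡ P.pole 2F →
    Named (H6⋆ (TTTsc T₁ T₂ T₃)) live vlive en []
  named-F {T₁} {T₂} {T₃} eq₁ eq₂ eq₃ = named-H6⋆-TTTsc T₁ T₂ T₃
    (subst (Named-pole 0F) (sym eq₁) (named-pole 0F))
    (subst (Named-pole 1F) (sym eq₂) (named-pole 1F))
    (subst (Named-pole 2F) (sym eq₃) (named-pole 2F))

-- Parity

⊕-commutativeMonoid : CommutativeMonoid 0ℓ 0ℓ
⊕-commutativeMonoid = record
  { Carrier = Z2² ; _≈_ = _≡_ ; _∙_ = _⊕_ ; ε = 0₂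
  ; isCommutativeMonoid = record
    { isMonoid = record
      { isSemigroup = record
        { isMagma = record { isEquivalence = isEquivalence ; ∙-cong = cong₂ _⊕_ }
        ; assoc = ⊕-assoc }
      ; identity = (λ _ → refl) , ⊕-identityʳ }
    ; comm = ⊕-comm } }

open import Algebra.Properties.CommutativeMonoid.Sum ⊕-commutativeMonoid
  using (sum; sum-cong-≗; sum-replicate-zero; sum-remove; ∑-comm; ∑-distrib-+)

sum-zero : ∀ {n} {f : Fin n → Z2²} → (∀ i → f i ≡ 0₂) → sum f ≡ 0₂
sum-zero {n} f≡0 = trans (sum-cong-≗ f≡0) (sum-replicate-zero n)

sum-single : ∀ {n} (f : Fin n → Z2²) j → (∀ i → i ≢ j → f i ≡ 0₂) → sum f ≡ f j
sum-single {suc n} f j f≡0 = trans (sum-remove {i = j} f)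
  (trans (cong (f j ⊕_) (sum-zero λ i → f≡0 (punchIn j i) (punchInᵢ≢i j i))) (⊕-identityʳ (f j)))

_·_ : Bool → Z2² → Z2²
b · x = if b then x else 0₂

·-0 : ∀ b → b · 0₂ ≡ 0₂
·-0 true  = refl
·-0 false = refl

-- Each `g d` is spread over the preimages of `d` under `ι`, of which there is at most one, and the
-- two sums are exchanged.
sum-image : ∀ {m n} (g : Fin n → Z2²) (ι : Fin m → Fin n) → (∀ {j k} → ι j ≡ ι k → j ≡ k) →
  (∀ d → (∀ k → ι k ≢ d) → g d ≡ 0₂) → sum g ≡ sum (λ k → g (ι k))
sum-image g ι ι-inj g≡0 = begin
  sum g                                             ≡⟨ sum-cong-≗ spread ⟩
  sum (λ d → sum (λ k → does (ι k ≟ d) · g d))      ≡⟨ ∑-comm (λ d k → does (ι k ≟ d) · g d) ⟩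
  sum (λ k → sum (λ d → does (ι k ≟ d) · g d))      ≡⟨ sum-cong-≗ collect ⟩
  sum (λ k → g (ι k))                               ∎
  where
  open ≡-Reasoning
  hit : ∀ k → does (ι k ≟ ι k) · g (ι k) ≡ g (ι k)
  hit k = cong (_· g (ι k)) (dec-true (ι k ≟ ι k) refl)
  spread : ∀ d → g d ≡ sum (λ k → does (ι k ≟ d) · g d)
  spread d with any? (λ k → ι k ≟ d)
  ... | no ∄ = trans (g≡0 d λ k eq → ∄ (k , eq)) (sym (sum-zero λ k → cong (_· g d) (dec-false (ι k ≟ d) λ eq → ∄ (k , eq))))
  ... | yes (k , refl) = sym (trans
    (sum-single _ k λ i i≢k → cong (_· g (ι k)) (dec-false (ι i ≟ ι k) λ eq → i≢k (ι-inj eq))) (hit k))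
  collect : ∀ k → sum (λ d → does (ι k ≟ d) · g d) ≡ g (ι k)
  collect k = trans (sum-single _ (ι k) λ d d≢ → cong (_· g d) (dec-false (ι k ≟ d) (≢-sym d≢))) (hit k)

inside : ∀ {n} → (Fin n → Bool) → Maybe (Fin n) → Bool
inside S (just v) = S v
inside S nothing  = false

edgeSum : ∀ {m n} → (Fin m → Side → Maybe (Fin n)) → (Fin m × Side → Z2²) → (Fin n → Bool) → Fin m → Z2²
edgeSum en val S d = (inside S (en d L) · val (d , L)) ⊕ (inside S (en d R) · val (d , R))

module _ {m n : ℕ} (en : Fin m → Side → Maybe (Fin n)) (val : Fin m × Side → Z2²)
  (loopless : ∀ d {v} → en d L ≡ just v → en d R ≢ just v)
  (darts : ∀ v → Darts 3 en v) where

  private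
    f : Fin n → Fin m → Z2²
    f v d = (atVertex v (en d L) · val (d , L)) ⊕ (atVertex v (en d R) · val (d , R))

    at-true : ∀ {v : Fin n} {x} → x ≡ just v → atVertex v x ≡ true
    at-true {v} refl with v ≟ v
    ... | yes _ = refl
    ... | no ne = contradiction refl ne

    at-false : ∀ {v : Fin n} x → x ≢ just v → atVertex v x ≡ false
    at-false nothing _ = refl
    at-false {v} (just u) ne with u ≟ v
    ... | yes refl = contradiction refl ne
    ... | no _     = refl

    vertexSum : ∀ v → sum (f v) ≡ sum (λ k → val (Darts.dart (darts v) k))
    vertexSum v = trans (sum-image (f v) (λ k → proj₁ (dart k)) ι-inj off) (sum-cong-≗ on)
      where
      open Darts (darts v)
      same : ∀ {d s t} → At en (d , s) v → At en (d , t) v → s ≡ t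
      same {s = L} {L} a b = refl
      same {s = R} {R} a b = refl
      same {d} {L} {R} a b = contradiction b (loopless d a)
      same {d} {R} {L} a b = contradiction a (loopless d b)
      ι-inj : ∀ {j k} → proj₁ (dart j) ≡ proj₁ (dart k) → j ≡ k
      ι-inj {j} {k} eq = dart-inj (cong₂ _,_ eq
        (same (dart-at j) (subst (λ d → At en (d , proj₂ (dart k)) v) (sym eq) (dart-at k))))
      off : ∀ d → (∀ k → proj₁ (dart k) ≢ d) → f v d ≡ 0₂
      off d ∉ = cong₂ (λ b b′ → (b · val (d , L)) ⊕ (b′ · val (d , R)))
        (at-false (en d L) (miss L)) (at-false (en d R) (miss R))
        where
        miss : ∀ s → en d s ≢ just v
        miss s pv with k , eq ← dart-onto (d , s) pv = ∉ k (cong proj₁ eq)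
      on : ∀ k → f v (proj₁ (dart k)) ≡ val (dart k)
      on k with dart k | dart-at k
      ... | d , L | pv = trans (cong₂ (λ b b′ → (b · val (d , L)) ⊕ (b′ · val (d , R)))
        (at-true pv) (at-false (en d R) (loopless d pv))) (⊕-identityʳ _)
      ... | d , R | pv = cong₂ (λ b b′ → (b · val (d , L)) ⊕ (b′ · val (d , R)))
        (at-false (en d L) (λ eq → loopless d eq pv)) (at-true pv)

    inside-sum : ∀ (S : Fin n → Bool) x z → inside S x · z ≡ sum (λ v → S v · (atVertex v x · z))
    inside-sum S nothing  z = sym (sum-zero λ v → ·-0 (S v))
    inside-sum S (just u) z = sym (trans
      (sum-single _ u λ v v≢u → trans (cong (λ b → S v · (b · z)) (at-false (just u) λ eq → v≢u (sym (just-injective eq)))) (·-0 (S v)))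
      (cong (λ b → S u · (b · z)) (at-true {u} refl)))

    ·-⊕ : ∀ b x y → (b · x) ⊕ (b · y) ≡ b · (x ⊕ y)
    ·-⊕ true  x y = refl
    ·-⊕ false x y = refl

    sum-⊕ : ∀ {k} (g h : Fin k → Z2²) → sum g ⊕ sum h ≡ sum (λ i → g i ⊕ h i)
    sum-⊕ g h = sym (∑-distrib-+ g h)

    sum-· : ∀ {k} b (g : Fin k → Z2²) → sum (λ i → b · g i) ≡ b · sum g
    sum-· true  g = refl
    sum-· {k} false g = sum-replicate-zero k

  -- Edges with both ends in S cancel.
  parity : (S : Fin n → Bool) → (∀ v → S v ≡ true → sum (λ k → val (Darts.dart (darts v) k)) ≡ 0₂) →
    sum (edgeSum en val S) ≡ 0₂
  parity S zero-sum = begin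
    sum (edgeSum en val S)
      ≡⟨ sum-cong-≗ by-vertex ⟩
    sum (λ d → sum (λ v → S v · f v d))  ≡⟨ ∑-comm (λ d v → S v · f v d) ⟩
    sum (λ v → sum (λ d → S v · f v d))  ≡⟨ sum-zero (λ v → trans (sum-· (S v) (f v)) (at v)) ⟩
    0₂ ∎
    where
    open ≡-Reasoning
    by-vertex : ∀ d → edgeSum en val S d ≡ sum (λ v → S v · f v d)
    by-vertex d = trans (cong₂ _⊕_ (inside-sum S (en d L) (val (d , L))) (inside-sum S (en d R) (val (d , R))))
      (trans (sum-⊕ (λ v → S v · (atVertex v (en d L) · val (d , L))) (λ v → S v · (atVertex v (en d R) · val (d , R))))
        (sum-cong-≗ λ v → ·-⊕ (S v) (atVertex v (en d L) · val (d , L)) (atVertex v (en d R) · val (d , R))))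
    at : ∀ v → S v · sum (f v) ≡ 0₂
    at v with S v in eq
    ... | true  = trans (vertexSum v) (zero-sum v eq)
    ... | false = refl

module _ (P : Pole) where
  open Pole P

  poleVal : (Side → Z2²) → (Fin (nE G) → Z2²) → EndOf G → Z2²
  poleVal h ψ (d , s) = if does (d ≟ e) then h s else ψ d

  c-far : Fin 3 → Maybe (Fin (nV G))
  c-far k = end G (proj₁ (c k)) (flipS (proj₂ (c k)))

  -- By `closed`, an edge that is neither `e` nor incident with `w` has both ends in `S` or none,
  -- and contributes zero. What is left is the boundary: the two halves of `e`, and the edges at
  -- `w`, which count when their far end lies in `S`. Taking `S` on `Maybe` lets it be applied
  -- directly to `end`.
  pole-parity : (h : Side → Z2²) (ψ : Fin (nE G) → Z2²) (S : Maybe (Fin (nV G)) → Bool) →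
    S nothing ≡ false → S (just w) ≡ false →
    (∀ v → S (just v) ≡ true → sum (λ k → poleVal h ψ (Darts.dart (darts v) k)) ≡ 0₂) →
    (∀ d → d ≢ e → end G d L ≢ just w → end G d R ≢ just w → S (end G d L) ≡ S (end G d R)) →
    ((S (end G e L) · h L) ⊕ (S (end G e R) · h R)) ⊕ sum (λ k → S (c-far k) · ψ (proj₁ (c k))) ≡ 0₂
  pole-parity h ψ S S-nothing S-w zero-sum closed =
    trans (sym (cong₂ _⊕_ at-e (sum-cong-≗ at-c)))
      (trans (sym (sum-image (edgeSum (end G) val S′) ι ι-inj off)) (parity (end G) val loopless darts S′ zero-sum))
    where
    S′ : Fin (nV G) → Bool
    S′ v = S (just v)
    val = poleVal h ψ
    inside-S : ∀ x → inside S′ x ≡ S x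
    inside-S (just v) = refl
    inside-S nothing  = sym S-nothing
    -- The four edges whose contributions need not cancel.
    ι : Fin 4 → Fin (nE G)
    ι zero    = e
    ι (suc k) = proj₁ (c k)
    edge : Fin (nE G) → Z2²
    edge d = (S (end G d L) · val (d , L)) ⊕ (S (end G d R) · val (d , R))
    edge-eq : ∀ d → edgeSum (end G) val S′ d ≡ edge d
    edge-eq d = cong₂ (λ b b′ → (b · val (d , L)) ⊕ (b′ · val (d , R))) (inside-S (end G d L)) (inside-S (end G d R))
    val-e : ∀ s → val (e , s) ≡ h s
    val-e s rewrite dec-true (e ≟ e) refl = refl
    val-other : ∀ {d} → d ≢ e → ∀ s → val (d , s) ≡ ψ d
    val-other {d} d≢e s rewrite dec-false (d ≟ e) d≢e = refl
    at-e : edgeSum (end G) val S′ e ≡ (S (end G e L) · h L) ⊕ (S (end G e R) · h R)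
    at-e = trans (edge-eq e) (cong₂ (λ x y → (S (end G e L) · x) ⊕ (S (end G e R) · y)) (val-e L) (val-e R))
    half-sum : ∀ d s → d ≢ e → end G d s ≡ just w → edge d ≡ S (end G d (flipS s)) · ψ d
    half-sum d L d≢e dw rewrite val-other d≢e L | val-other d≢e R | dw | S-w = refl
    half-sum d R d≢e dw rewrite val-other d≢e L | val-other d≢e R | dw | S-w = ⊕-identityʳ _
    at-c : ∀ k → edgeSum (end G) val S′ (proj₁ (c k)) ≡ S (c-far k) · ψ (proj₁ (c k))
    at-c k = trans (edge-eq _) (half-sum (proj₁ (c k)) (proj₂ (c k)) (c≢e k) (Darts.dart-at w-darts k))
    side : ∀ {d s t} → end G d s ≡ just w → end G d t ≡ just w → s ≡ t
    side {s = L} {L} a b = refl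
    side {s = R} {R} a b = refl
    side {d} {L} {R} a b = contradiction b (loopless d a)
    side {d} {R} {L} a b = contradiction a (loopless d b)
    ι-inj : ∀ {j k} → ι j ≡ ι k → j ≡ k
    ι-inj {zero}  {zero}  eq = refl
    ι-inj {zero}  {suc k} eq = contradiction (sym eq) (c≢e k)
    ι-inj {suc j} {zero}  eq = contradiction eq (c≢e j)
    ι-inj {suc j} {suc k} eq = cong suc (Darts.dart-inj w-darts (cong₂ _,_ eq
      (side (Darts.dart-at w-darts j) (subst (λ d → end G d (proj₂ (c k)) ≡ just w) (sym eq) (Darts.dart-at w-darts k)))))
    off : ∀ d → (∀ k → ι k ≢ d) → edgeSum (end G) val S′ d ≡ 0₂
    off d ∉ = trans (edge-eq d) (trans
      (cong₂ (λ x y → (S (end G d L) · x) ⊕ (S (end G d R) · y)) (val-other d≢e L) (val-other d≢e R))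
      (trans (cong (λ b → (b · ψ d) ⊕ (S (end G d R) · ψ d)) (closed d d≢e (miss L) (miss R))) (⊕-self (S (end G d R) · ψ d))))
      where
      d≢e : d ≢ e
      d≢e eq = ∉ zero (sym eq)
      miss : ∀ s → end G d s ≢ just w
      miss s dw with k , eq ← Darts.dart-onto w-darts (d , s) dw = ∉ (suc k) (cong proj₁ eq)

-- Suppressing a vertex

module _ (M : Multipole) (d : Fin (nE M)) where

  unskip : ∀ {A : Set} → A → (Fin (pred (nE M)) → A) → Fin (nE M) → A
  unskip z φ j with d ≟ j
  ... | yes _  = z
  ... | no d≢j = φ (proj₁ (skip-onto d≢j))

  unskip-skip : ∀ {A : Set} (z : A) φ i → unskip z φ (skip d i) ≡ φ i
  unskip-skip z φ i with d ≟ skip d i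
  ... | yes eq = contradiction (sym eq) (skip-≢ d i)
  ... | no d≢  = cong φ (skip-injective d (proj₂ (skip-onto d≢)))

  unskip-at : ∀ {A : Set} (z : A) φ → unskip z φ d ≡ z
  unskip-at z φ with d ≟ d
  ... | yes _ = refl
  ... | no ne = contradiction refl ne

-- The variant of `properAt-pull` for a correspondence that exists only at ends incident with the
-- vertex. Its injectivity comes for free, since `back` undoes `lift`.
properAt-via : ∀ {E′ V′ : Set} {en : E → Side → Maybe V} {en′ : E′ → Side → Maybe V′}
  {val : E × Side → C} {val′ : E′ × Side → C} {v v′} (back : E × Side → E′ × Side) →
  (∀ p → At en′ p v′ → ∃[ q ] back q ≡ p × At en q v × val q ≡ val′ p) →
  ProperAt en val v → ProperAt en′ val′ v′
properAt-via back lift pr p p′ pv pv′ p≢p′ eq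
  with q , refl , qv , q-val ← lift p pv | q′ , refl , qv′ , q-val′ ← lift p′ pv′ =
  pr q q′ qv qv′ (λ q≡q′ → p≢p′ (cong back q≡q′)) (trans q-val (trans eq (sym q-val′)))

module _ (M : Multipole) (d : Fin (nE M)) where

  deleteEdge-proper⁻ : ∀ {φ : Fin (pred (nE M)) → C} {x} z → (∀ s → end M d s ≢ just x) →
    EdgeProperAt (deleteEdge M d) φ x → EdgeProperAt M (unskip M d z φ) x
  deleteEdge-proper⁻ {φ = φ} {x} z d∌x = properAt-via (λ (i , t) → skip d i , t) lift
    where
    lift : ∀ p → At (end M) p x → ∃[ q ] _ ≡ p × At (end (deleteEdge M d)) q x × φ (proj₁ q) ≡ unskip M d z φ (proj₁ p)
    lift (j , t) pv with i , refl ← skip-onto {v = d} {j} (λ { refl → d∌x t pv }) =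
      (i , t) , refl , pv , sym (unskip-skip M d z φ i)

  deleteEdge-darts : ∀ {n v} (D : Darts (suc n) (end M) v) k → proj₁ (Darts.dart D k) ≡ d →
    (∀ j → j ≢ k → proj₁ (Darts.dart D j) ≢ d) → Darts n (end (deleteEdge M d)) v
  deleteEdge-darts {n} {v} D k k-d others = record
    { dart = λ j → proj₁ (pre j) , proj₂ (dart (punchIn k j))
    ; dart-inj = λ {i} {j} eq → punchIn-injective k _ _ (dart-inj (cong₂ _,_
        (trans (sym (proj₂ (pre i))) (trans (cong (skip d) (cong proj₁ eq)) (proj₂ (pre j)))) (cong proj₂ eq)))
    ; dart-at = λ j → subst (λ i → end M i (proj₂ (dart (punchIn k j))) ≡ just v) (sym (proj₂ (pre j))) (dart-at (punchIn k j))
    ; dart-onto = onto }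
    where
    open Darts D
    pre : ∀ j → ∃ λ i → skip d i ≡ proj₁ (dart (punchIn k j))
    pre j = skip-onto (≢-sym (others (punchIn k j) (punchInᵢ≢i k j)))
    onto : ∀ p → At (end (deleteEdge M d)) p v → ∃ λ j → (proj₁ (pre j) , proj₂ (dart (punchIn k j))) ≡ p
    onto (i , t) pv with l , eq ← dart-onto (skip d i , t) pv with k ≟ l
    ... | yes refl = contradiction (trans (sym (cong proj₁ eq)) k-d) (skip-≢ d i)
    ... | no k≢l = punchOut k≢l , cong₂ _,_
      (skip-injective d (trans (proj₂ (pre (punchOut k≢l))) (trans (cong (λ j → proj₁ (dart j)) (punchIn-punchOut k≢l)) (cong proj₁ eq))))
      (trans (cong (λ j → proj₂ (dart j)) (punchIn-punchOut k≢l)) (cong proj₂ eq))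

flipS-involutive : ∀ s → flipS (flipS s) ≡ s
flipS-involutive L = refl
flipS-involutive R = refl

flipS-≢ : ∀ {s t} → s ≢ t → s ≡ flipS t
flipS-≢ {L} {L} n = contradiction refl n
flipS-≢ {L} {R} n = refl
flipS-≢ {R} {L} n = refl
flipS-≢ {R} {R} n = contradiction refl n

==S-refl : ∀ s → (s ==S s) ≡ true
==S-refl L = refl
==S-refl R = refl

==S-≢ : ∀ {s t} → s ≢ t → (s ==S t) ≡ false
==S-≢ {L} {L} n = contradiction refl n
==S-≢ {L} {R} n = refl
==S-≢ {R} {L} n = refl
==S-≢ {R} {R} n = contradiction refl n

module _ (M : Multipole) (v : Fin (nV M)) (ea : Fin (nE M)) (sa : Side) (eb : Fin (nE M)) (sb : Side) where

  private S = suppress2 M v (ea , sa) (eb , sb)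

  suppress2-joined : ∀ {i} → skip eb i ≡ ea → end S i sa ≡ (end M eb (flipS sb) >>= removeIdx v)
  suppress2-joined {i} eq with skip eb i ≟ ea
  suppress2-joined {i} eq | no ne = contradiction eq ne
  suppress2-joined {i} eq | yes _ rewrite ==S-refl sa = refl

  suppress2-other : ∀ {i t} → (skip eb i , t) ≢ (ea , sa) → end S i t ≡ (end M (skip eb i) t >>= removeIdx v)
  suppress2-other {i} {t} ne with skip eb i ≟ ea
  suppress2-other {i} {t} ne | no _ = refl
  suppress2-other {i} {t} ne | yes eq rewrite ==S-≢ {t} {sa} (λ t≡s → ne (cong₂ _,_ eq t≡s)) = refl

  -- Suppression keeps `ea`, which takes over the far end of `eb`. Giving the restored edge `eb` the
  -- colour of the surviving edge undoes the merging.
  suppress2-colouring : ea ≢ eb → At (end M) (ea , sa) v → At (end M) (eb , sb) v →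
    (φ : Fin (nE S) → C) → (∀ y → EdgeProperAt S φ y) →
    ∃[ ψ ] (∀ x → x ≢ v → EdgeProperAt M ψ x) × ψ ea ≡ ψ eb
  suppress2-colouring {C = C} ea≢eb a-at b-at φ ok = ψ , proper , trans
      (trans (cong ψ (sym r-eq)) (unskip-skip M eb (φ r) φ r)) (sym (unskip-at M eb (φ r) φ))
    where
    r : Fin (pred (nE M))
    r = proj₁ (skip-onto (≢-sym ea≢eb))
    r-eq : skip eb r ≡ ea
    r-eq = proj₂ (skip-onto (≢-sym ea≢eb))
    ψ : Fin (nE M) → C
    ψ = unskip M eb (φ r) φ
    back : EndOf S → EndOf M
    back (i , t) with i ≟ r | t ≟S sa
    ... | yes _ | yes _ = eb , flipS sb
    ... | yes _ | no _  = skip eb i , t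
    ... | no _  | _     = skip eb i , t
    back-joined : back (r , sa) ≡ (eb , flipS sb)
    back-joined with r ≟ r | sa ≟S sa
    ... | yes _ | yes _ = refl
    ... | no ne | _     = contradiction refl ne
    ... | yes _ | no ne = contradiction refl ne
    back-other : ∀ {i t} → (skip eb i , t) ≢ (ea , sa) → back (i , t) ≡ (skip eb i , t)
    back-other {i} {t} ne with i ≟ r | t ≟S sa
    ... | yes refl | yes refl = contradiction (cong (_, sa) r-eq) ne
    ... | yes _    | no _     = refl
    ... | no _     | _        = refl
    proper : ∀ x → x ≢ v → EdgeProperAt M ψ x
    proper x x≢v with y , refl ← skip-onto {v = v} {x} (≢-sym x≢v) = properAt-via back lift (ok y)
      where
      Lift : EndOf M → Set
      Lift p = ∃[ q ] back q ≡ p × At (end S) q y × φ (proj₁ q) ≡ ψ (proj₁ p)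
      lift : ∀ p → At (end M) p (skip v y) → Lift p
      lift-by : ∀ {j t} → Dec (eb ≡ j) → end M j t ≡ just (skip v y) → Lift (j , t)
      lift p pv = lift-by (eb ≟ proj₁ p) pv
      lift-by {j} {t} (yes refl) pv with refl ← flipS-≢ {t} {sb} (λ { refl → x≢v (just-injective (trans (sym pv) b-at)) }) =
        (r , sa) , back-joined , trans (suppress2-joined r-eq) (>>=removeIdx⁺ pv) , sym (unskip-at M eb (φ r) φ)
      lift-by {j} {t} (no eb≢j) pv with i , refl ← skip-onto eb≢j =
        (i , t) , back-other ne , trans (suppress2-other ne) (>>=removeIdx⁺ pv) , sym (unskip-skip M eb (φ r) φ i)
        where
        ne : (skip eb i , t) ≢ (ea , sa)
        ne eq = x≢v (just-injective (trans (sym pv) (trans (cong₂ (end M) (cong proj₁ eq) (cong proj₂ eq)) a-at)))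

suppress-two : ∀ M v {a b} → endsAt M v ≡ a ∷ b ∷ [] → suppress M v ≡ suppress2 M v a b
suppress-two M v eq rewrite eq = refl

length-two : {A : Set} (xs : List A) → length xs ≡ 2 → ∃[ a ] ∃[ b ] xs ≡ a ∷ b ∷ []
length-two (a ∷ b ∷ []) eq = a , b , refl

module _ (M : Multipole) (v : Fin (nV M)) (loopless : ∀ j → end M j L ≡ just v → end M j R ≢ just v) where

  private
    edges-differ : ∀ {ea sa eb sb} → endsAt M v ≡ (ea , sa) ∷ (eb , sb) ∷ [] → ea ≢ eb
    edges-differ {ea} {sa} {eb} {sb} eq refl = sides sa sb a-at b-at (subst Unique eq (endsAt-unique M v))
      where
      a-at : At (end M) (ea , sa) v
      a-at = ∈-endsAt⁻ M v (subst ((ea , sa) ∈_) (sym eq) (here refl))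
      b-at : At (end M) (eb , sb) v
      b-at = ∈-endsAt⁻ M v (subst ((eb , sb) ∈_) (sym eq) (there (here refl)))
      sides : ∀ s t → end M ea s ≡ just v → end M ea t ≡ just v → ¬ Unique ((ea , s) ∷ (ea , t) ∷ [])
      sides L L _ _ ((n ∷ _) ∷ _) = n refl
      sides R R _ _ ((n ∷ _) ∷ _) = n refl
      sides L R a b _ = loopless ea a b
      sides R L a b _ = loopless ea b a

    suppress2-equal : ∀ {a b} → endsAt M v ≡ a ∷ b ∷ [] → Colourable (suppress2 M v a b) →
      ∃[ ψ ] (∀ x → x ≢ v → EdgeProperAt M ψ x) ×
             (∀ p q → At (end M) p v → At (end M) q v → ψ (proj₁ p) ≡ ψ (proj₁ q))
    suppress2-equal {ea , sa} {eb , sb} eq (φ , ok) = proj₁ both , proj₁ (proj₂ both) ,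
        λ p q pv qv → trans (same p pv) (sym (same q qv))
      where
      both : ∃[ ψ ] (∀ x → x ≢ v → EdgeProperAt M ψ x) × ψ ea ≡ ψ eb
      both = suppress2-colouring M v ea sa eb sb (edges-differ eq)
        (∈-endsAt⁻ M v (subst ((ea , sa) ∈_) (sym eq) (here refl)))
        (∈-endsAt⁻ M v (subst ((eb , sb) ∈_) (sym eq) (there (here refl))))
        φ (λ y → allPairs⇒properAt (suppress2 M v (ea , sa) (eb , sb)) y (ok y))
      same : ∀ p → At (end M) p v → proj₁ both (proj₁ p) ≡ proj₁ both ea
      same p pv with subst (p ∈_) eq (∈-endsAt⁺ M v pv)
      ... | here refl         = refl
      ... | there (here refl) = sym (proj₂ (proj₂ both))

  suppress-equal : Darts 2 (end M) v → Colourable (suppress M v) →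
    ∃[ ψ ] (∀ x → x ≢ v → EdgeProperAt M ψ x) ×
           (∀ p q → At (end M) p v → At (end M) q v → ψ (proj₁ p) ≡ ψ (proj₁ q))
  suppress-equal D colourable with a , b , eq ← length-two (endsAt M v) (darts⇒length M v D) =
    suppress2-equal eq (subst Colourable (suppress-two M v eq) colourable)

module _ (M : Multipole) (loopless : ∀ j {v} → end M j L ≡ just v → end M j R ≢ just v)
  {u : Fin (nV M)} (Du : Darts 3 (end M) u) {d : Fin (nE M)}
  (d-L : end M d L ≡ just u) (d-R : end M d R ≡ nothing) where

  private
    free : ∀ {x} → end M d R ≢ just x
    free eq with () ← trans (sym d-R) eq

    not-d : ∀ {p} → At (end M) p u → p ≢ (d , L) → proj₁ p ≢ d
    not-d {_ , L} pv p≢ refl = p≢ refl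
    not-d {_ , R} pv p≢ refl = free pv

    d∌ : ∀ {x} → x ≢ u → ∀ t → end M d t ≢ just x
    d∌ x≢u L eq = x≢u (just-injective (trans (sym eq) d-L))
    d∌ x≢u R eq = free eq

    deleted-darts : Darts 2 (end (deleteEdge M d)) u
    deleted-darts = deleteEdge-darts M d Du k₀ (cong proj₁ k₀-eq)
        (λ j j≢k₀ → not-d (dart-at j) (λ eq → j≢k₀ (dart-inj (trans eq (sym k₀-eq)))))
      where
      open Darts Du
      k₀ : Fin 3
      k₀ = proj₁ (dart-onto (d , L) d-L)
      k₀-eq : dart k₀ ≡ (d , L)
      k₀-eq = proj₂ (dart-onto (d , L) d-L)

    Equalised : (Fin (nE M) → K) → Set
    Equalised ψ = ∀ p q → At (end M) p u → At (end M) q u → p ≢ (d , L) → q ≢ (d , L) → ψ (proj₁ p) ≡ ψ (proj₁ q)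

    undelete : (∃[ ψ ] (∀ x → x ≢ u → EdgeProperAt (deleteEdge M d) ψ x) ×
        (∀ p q → At (end (deleteEdge M d)) p u → At (end (deleteEdge M d)) q u → ψ (proj₁ p) ≡ ψ (proj₁ q))) →
      ∃[ ψ ] (∀ x → x ≢ u → EdgeProperAt M ψ x) × Equalised ψ
    undelete (ψ , proper , same) = unskip M d a′ ψ ,
        (λ x x≢u → deleteEdge-proper⁻ M d a′ (d∌ x≢u) (proper x x≢u)) , equal
      where
      equal : Equalised (unskip M d a′ ψ)
      equal (i , s) (j , t) pv qv p≢ q≢
        with i′ , refl ← skip-onto {v = d} {i} (≢-sym (not-d pv p≢)) | j′ , refl ← skip-onto {v = d} {j} (≢-sym (not-d qv q≢)) =
        trans (unskip-skip M d a′ ψ i′) (trans (same (i′ , s) (j′ , t) pv qv) (sym (unskip-skip M d a′ ψ j′)))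

  -- Suppressing u merges the two edges that remain at u.
  tilde-equal : Colourable (tildeVia M d u) → ∃[ ψ ] (∀ x → x ≢ u → EdgeProperAt M ψ x) ×
    (∀ p q → At (end M) p u → At (end M) q u → p ≢ (d , L) → q ≢ (d , L) → ψ (proj₁ p) ≡ ψ (proj₁ q))
  tilde-equal colourable = undelete (suppress-equal (deleteEdge M d) u (λ j → loopless (skip d j)) deleted-darts colourable)

-- Colourings obtained from goodness

distinct-sum : ∀ (x y z : K) → x ≢ y → x ≢ z → y ≢ z → proj₁ x ⊕ (proj₁ y ⊕ (proj₁ z ⊕ 0₂)) ≡ 0₂
distinct-sum ka kb kc _ _ _ = refl
distinct-sum ka kc kb _ _ _ = refl
distinct-sum kb ka kc _ _ _ = refl
distinct-sum kb kc ka _ _ _ = refl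
distinct-sum kc ka kb _ _ _ = refl
distinct-sum kc kb ka _ _ _ = refl
distinct-sum ka ka _  n _ _ = contradiction refl n
distinct-sum kb kb _  n _ _ = contradiction refl n
distinct-sum kc kc _  n _ _ = contradiction refl n
distinct-sum ka _  ka _ n _ = contradiction refl n
distinct-sum kb _  kb _ n _ = contradiction refl n
distinct-sum kc _  kc _ n _ = contradiction refl n
distinct-sum _  ka ka _ _ n = contradiction refl n
distinct-sum _  kb kb _ _ n = contradiction refl n
distinct-sum _  kc kc _ _ n = contradiction refl n

⊕-cancel : ∀ x → x ⊕ (x ⊕ 0₂) ≡ 0₂
⊕-cancel x = trans (cong (x ⊕_) (⊕-identityʳ x)) (⊕-self x)

-- This is the sum at the suppressed vertex: the deleted half counts as zero, and the two merged
-- edges have the same colour.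
cancelling-sum : (f : Fin 3 → Z2²) (k : Fin 3) → f k ≡ 0₂ → (∀ i j → i ≢ k → j ≢ k → f i ≡ f j) → sum f ≡ 0₂
cancelling-sum f zero z s =
  trans (cong₂ _⊕_ z (cong (_⊕ (f (suc (suc zero)) ⊕ 0₂)) (s (suc zero) (suc (suc zero)) (λ ()) (λ ())))) (⊕-cancel (f (suc (suc zero))))
cancelling-sum f (suc zero) z s =
  trans (cong₂ _⊕_ (s zero (suc (suc zero)) (λ ()) (λ ())) (cong (_⊕ (f (suc (suc zero)) ⊕ 0₂)) z)) (⊕-cancel (f (suc (suc zero))))
cancelling-sum f (suc (suc zero)) z s =
  trans (cong₂ _⊕_ (s zero (suc zero) (λ ()) (λ ())) (cong (λ x → f (suc zero) ⊕ (x ⊕ 0₂)) z)) (⊕-cancel (f (suc zero)))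

cut-loopless : ∀ G e → (∀ j {v} → end G j L ≡ just v → end G j R ≢ just v) →
  ∀ j {v} → end (cutEdge G e) j L ≡ just v → end (cutEdge G e) j R ≢ just v
cut-loopless G e loopless j jL jR with last? j
... | last with () ← trans (sym (cut-last-R G e)) jR
... | old d with d ≟ e
...   | yes refl with () ← trans (sym (cut-R G e)) jR
...   | no d≢e = loopless d (trans (sym (cut-other G e d≢e L)) jL) (trans (sym (cut-other G e d≢e R)) jR)

module _ (P : Pole) where
  open Pole P

  -- The colour `β s` of the deleted half is unconstrained, as nothing is required at its endvertex.
  -- In the composite this half becomes the edge whose two ends are removed.
  HalfColouring : Side → Set
  HalfColouring s = ∃[ β ] ∃[ ψ ] (∀ x → x ≢ w → end G e s ≢ just x → ProperAt (end G) (cutVal G e β ψ) x) ×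
    rowSum (λ k → ψ (proj₁ (c k))) ≡ proj₁ (β (flipS s))

  private
    g : Fin (nE G)
    g = proj₁ (c zero)

  -- The row sum is given by parity on the vertices other than w, with the
  -- value at (e , s) replaced by 0₂.
  half-colouring : ∀ s {u} → end G e s ≡ just u → (val₀ : EndOf G → K) →
    (∀ x → x ≢ u → ProperAt (end G) val₀ x) →
    (∀ p q → At (end G) p u → At (end G) q u → p ≢ (e , s) → q ≢ (e , s) → val₀ p ≡ val₀ q) →
    (∀ {f} → f ≢ e → f ≢ g → ∀ t → val₀ (f , L) ≡ val₀ (f , t)) → HalfColouring s
  half-colouring s {u} u-at val₀ val₀-proper val₀-equal val₀-sides = β , ψ , proper , row-flow
    where
    u≢w : u ≢ w
    u≢w refl = e∌w s u-at
    β : Side → K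
    β t = val₀ (e , t)
    g-far : Side
    g-far = flipS (proj₂ (c zero))
    -- The edge `g` is cut as well, and its halves may differ in colour. Nothing is required at `w`,
    -- so the half away from `w` supplies the colour of `g`.
    ψ : Fin (nE G) → K
    ψ f = if does (f ≟ g) then val₀ (g , g-far) else val₀ (f , L)
    agree : ∀ {x} → x ≢ w → ∀ p → At (end G) p x → cutVal G e β ψ p ≡ val₀ p
    agree x≢w (f , t) pv with f ≟ e
    ... | yes refl = refl
    ... | no f≢e with f ≟ g
    ...   | yes refl = cong (λ t → val₀ (g , t)) (sym (flipS-≢ λ { refl → x≢w (just-injective (trans (sym pv) (Darts.dart-at w-darts zero))) }))
    ...   | no f≢g = val₀-sides f≢e f≢g t
    proper : ∀ x → x ≢ w → end G e s ≢ just x → ProperAt (end G) (cutVal G e β ψ) x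
    proper x x≢w e∌x = properAt-cong (λ p pv → sym (agree x≢w p pv))
      (val₀-proper x λ { refl → e∌x u-at })
    h : Side → Z2²
    h t = if does (t ≟S s) then 0₂ else proj₁ (β t)
    h-sum : ∀ r → (if does (L ≟S r) then 0₂ else proj₁ (β L)) ⊕ (if does (R ≟S r) then 0₂ else proj₁ (β R)) ≡ proj₁ (β (flipS r))
    h-sum L = refl
    h-sum R = ⊕-identityʳ _
    pv-cut : ∀ p → p ≢ (e , s) → poleVal P h (λ f → proj₁ (ψ f)) p ≡ proj₁ (cutVal G e β ψ p)
    pv-cut (f , t) p≢ with f ≟ e
    ... | no _ = refl
    ... | yes refl with t ≟S s
    ...   | yes refl = contradiction refl p≢
    ...   | no _ = refl
    pv-es : poleVal P h (λ f → proj₁ (ψ f)) (e , s) ≡ 0₂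
    pv-es rewrite dec-true (e ≟ e) refl | dec-true (s ≟S s) refl = refl
    S : Maybe (Fin (nV G)) → Bool
    S (just v) = not (does (v ≟ w))
    S nothing  = false
    S-true : ∀ {x v} → x ≡ just v → v ≢ w → S x ≡ true
    S-true {v = v} refl v≢w = cong not (dec-false (v ≟ w) v≢w)
    S-sound : ∀ v → S (just v) ≡ true → v ≢ w
    S-sound v eq with v ≟ w
    S-sound v () | yes _
    ... | no v≢w = v≢w
    zero-sum : ∀ v → S (just v) ≡ true → sum (λ k → poleVal P h (λ f → proj₁ (ψ f)) (Darts.dart (darts v) k)) ≡ 0₂
    zero-sum v Sv with v ≟ u
    ... | yes refl = cancelling-sum _ k (trans (cong (poleVal P h (λ f → proj₁ (ψ f))) k-eq) pv-es) λ i j i≢k j≢k →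
        trans (val i i≢k) (trans (cong proj₁ (val₀-equal _ _ (dart-at i) (dart-at j) (off i≢k) (off j≢k))) (sym (val j j≢k)))
      where
      open Darts (darts u)
      k : Fin 3
      k = proj₁ (dart-onto (e , s) u-at)
      k-eq : dart k ≡ (e , s)
      k-eq = proj₂ (dart-onto (e , s) u-at)
      off : ∀ {i} → i ≢ k → dart i ≢ (e , s)
      off i≢k eq = i≢k (dart-inj (trans eq (sym k-eq)))
      val : ∀ i → i ≢ k → poleVal P h (λ f → proj₁ (ψ f)) (dart i) ≡ proj₁ (val₀ (dart i))
      val i i≢k = trans (pv-cut (dart i) (off i≢k)) (cong proj₁ (agree u≢w (dart i) (dart-at i)))
    ... | no v≢u = trans (sum-cong-≗ λ k → pv-cut (dart k) (off k))
        (distinct-sum (cutVal G e β ψ (dart zero)) _ _ (diff (λ ())) (diff (λ ())) (diff (λ ())))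
      where
      open Darts (darts v)
      off : ∀ k → dart k ≢ (e , s)
      off k eq = v≢u (just-injective (trans (sym (dart-at k)) (trans (cong (λ p → end G (proj₁ p) (proj₂ p)) eq) u-at)))
      diff : ∀ {i j} → i ≢ j → cutVal G e β ψ (dart i) ≢ cutVal G e β ψ (dart j)
      diff {i} {j} i≢j = proper v (S-sound v Sv) (λ eq → v≢u (just-injective (trans (sym eq) u-at)))
        (dart i) (dart j) (dart-at i) (dart-at j) (λ eq → i≢j (dart-inj eq))
    attached-S : ∀ f t → end G f t ≢ just w → S (end G f t) ≡ true
    attached-S f t f≢w with v , eq ← attached f t = S-true eq λ { refl → f≢w eq }
    far-S : ∀ k → S (c-far P k) ≡ true
    far-S k = attached-S (proj₁ (c k)) (flipS (proj₂ (c k))) (far (proj₂ (c k)) (Darts.dart-at w-darts k))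
      where
      far : ∀ t → end G (proj₁ (c k)) t ≡ just w → end G (proj₁ (c k)) (flipS t) ≢ just w
      far L a b = loopless (proj₁ (c k)) a b
      far R a b = loopless (proj₁ (c k)) b a
    y : Fin 3 → Z2²
    y k = proj₁ (ψ (proj₁ (c k)))
    total : proj₁ (β (flipS s)) ⊕ sum y ≡ 0₂
    total = trans (cong₂ _⊕_ (sym (trans (cong₂ (λ b b′ → (b · h L) ⊕ (b′ · h R)) (attached-S e L (e∌w L)) (attached-S e R (e∌w R))) (h-sum s)))
        (sum-cong-≗ λ k → sym (cong (_· y k) (far-S k))))
      (pole-parity P h (λ f → proj₁ (ψ f)) S refl (cong not (dec-true (w ≟ w) refl)) zero-sum
        (λ f f≢e fL fR → trans (attached-S f L fL) (sym (attached-S f R fR))))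
    row-flow : rowSum (λ k → ψ (proj₁ (c k))) ≡ proj₁ (β (flipS s))
    row-flow = sym (trans (⊕≡0 total) (cong (λ x → y zero ⊕ (y (suc zero) ⊕ x)) (⊕-identityʳ _)))

  good⇒half-colouring : Good G e w → ∀ s →
    HalfColouring s
  good⇒half-colouring good s = half-colouring s u-at val₀ val₀-proper val₀-equal val₀-sides
    where
    u : Fin (nV G)
    u = proj₁ (attached e s)
    u-at : end G e s ≡ just u
    u-at = proj₂ (attached e s)
    g≢e : g ≢ e
    g≢e = c≢e zero
    G′ M : Multipole
    G′ = cutEdge G e
    M  = cut2 G e g
    g′ : Fin (nE G′)
    g′ = inject₁ g
    half≢g′ : ∀ t → half G e t ≢ g′
    half≢g′ L eq = g≢e (sym (inject₁-injective eq))
    half≢g′ R eq = fromℕ≢inject₁ eq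
    d : Fin (nE M)
    d = inject₁ (half G e s)
    d-L : end M d L ≡ just u
    d-L = trans (cut-other G′ g′ (half≢g′ s) L) (trans (half-end G e s) u-at)
    d-R : end M d R ≡ nothing
    d-R = trans (cut-other G′ g′ (half≢g′ s) R) (half-free G e s)
    essential : Essential G e g
    essential = good u (s , u-at) e g (s , u-at) (proj₂ (c zero) , Darts.dart-at w-darts zero)
    -- `d` is half `s` of `e` in the twice cut graph, hence a dangling edge at `u`, and the last
    -- clause of essentiality applies to it.
    colourable : Colourable (tildeVia M d u)
    colourable = proj₂ (proj₂ (proj₂ essential)) d L u d-L d-R
    toM : EndOf G → EndOf M
    toM p = toCut G′ g′ (toCut G e p)
    toM-injective : ∀ {p q} → toM p ≡ toM q → p ≡ q
    toM-injective eq = toCut-injective G e _ _ (toCut-injective G′ g′ _ _ eq)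
    toM-half : ∀ t → toM (e , t) ≡ (inject₁ (half G e t) , L)
    toM-half t = trans (cong (toCut G′ g′) (toCut-e G e t)) (toCut-other G′ g′ (half≢g′ t) L)
    M-darts : ∀ v → Darts 3 (end M) v
    M-darts v = cut-darts⁺ G′ g′ (cut-darts⁺ G e (darts v))
    Du : Darts 3 (end M) u
    Du = M-darts u
    M-loopless : ∀ j {v} → end M j L ≡ just v → end M j R ≢ just v
    M-loopless = cut-loopless G′ g′ (cut-loopless G e loopless)
    coloured : ∃[ ψ ] (∀ x → x ≢ u → EdgeProperAt M ψ x) ×
      (∀ p q → At (end M) p u → At (end M) q u → p ≢ (d , L) → q ≢ (d , L) → ψ (proj₁ p) ≡ ψ (proj₁ q))
    coloured = tilde-equal M M-loopless {u} Du {d} d-L d-R colourable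
    ψM : Fin (nE M) → K
    ψM = proj₁ coloured
    val₀ : EndOf G → K
    val₀ p = ψM (proj₁ (toM p))
    val₀-proper : ∀ x → x ≢ u → ProperAt (end G) val₀ x
    val₀-proper x x≢u = properAt-pull toM
      (λ p pv → toCut-at G′ g′ (toCut G e p) (toCut-at G e p pv) , refl) (λ _ _ _ _ → toM-injective)
      (proj₁ (proj₂ coloured) x x≢u)
    toM-d : ∀ p → p ≢ (e , s) → toM p ≢ (d , L)
    toM-d p p≢ eq = p≢ (toM-injective (trans eq (sym (toM-half s))))
    val₀-equal : ∀ p q → At (end G) p u → At (end G) q u → p ≢ (e , s) → q ≢ (e , s) → val₀ p ≡ val₀ q
    val₀-equal p q pv qv p≢ q≢ = proj₂ (proj₂ coloured) (toM p) (toM q)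
      (toCut-at G′ g′ (toCut G e p) (toCut-at G e p pv)) (toCut-at G′ g′ (toCut G e q) (toCut-at G e q qv))
      (toM-d p p≢) (toM-d q q≢)
    val₀-sides : ∀ {f} → f ≢ e → f ≢ g → ∀ t → val₀ (f , L) ≡ val₀ (f , t)
    val₀-sides {f} f≢e f≢g t = trans (at L) (sym (at t))
      where
      at : ∀ t → val₀ (f , t) ≡ ψM (inject₁ (inject₁ f))
      at t = cong (λ p → ψM (proj₁ p)) (trans (cong (toCut G′ g′) (toCut-other G e f≢e t))
        (toCut-other G′ g′ (λ eq → f≢g (inject₁-injective eq)) t))

-- Searches over colours

allK? : {Q : K → Set} → (∀ x → Dec (Q x)) → Dec (∀ x → Q x)
allK? {Q} Q? = map′ (λ { (qa , qb , qc) ka → qa ; (qa , qb , qc) kb → qb ; (qa , qb , qc) kc → qc })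
  (λ q → q a′ , q b′ , q c′) (Q? a′ ×-dec (Q? b′ ×-dec Q? c′))

anyK? : {Q : K → Set} → (∀ x → Dec (Q x)) → Dec (∃ Q)
anyK? {Q} Q? = map′ (λ { (inj₁ q) → a′ , q ; (inj₂ (inj₁ q)) → b′ , q ; (inj₂ (inj₂ q)) → c′ , q })
  (λ { (ka , q) → inj₁ q ; (kb , q) → inj₂ (inj₁ q) ; (kc , q) → inj₂ (inj₂ q) }) (Q? a′ ⊎-dec (Q? b′ ⊎-dec Q? c′))

Distinct₃ : {A : Set} → A → A → A → Set
Distinct₃ x y z = x ≢ y × x ≢ z × y ≢ z

distinct₃? : ∀ (x y z : K) → Dec (Distinct₃ x y z)
distinct₃? x y z = ¬? (x ≟K y) ×-dec (¬? (x ≟K z) ×-dec ¬? (y ≟K z))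

-- Multiplication by a generator of the multiplicative group of F₄ = Z2².
ω : K → K
ω ka = b′
ω kb = c′
ω kc = a′

-- The third colour; the value at x ≡ y is irrelevant.
third : K → K → K
third ka ka = a′
third ka kb = c′
third ka kc = b′
third kb ka = c′
third kb kb = b′
third kb kc = a′
third kc ka = b′
third kc kb = a′
third kc kc = c′

-- The 6-cycle and its spokes

nx : Fin 3 → Fin 3
nx 0F = 1F
nx 1F = 2F
nx 2F = 0F

opp : Fin 6 → Fin 6
opp 0F = 3F
opp 1F = 4F
opp 2F = 5F
opp 3F = 0F
opp 4F = 1F
opp 5F = 2F

hex : {A : Set} (c₀ c₁ c₂ c₃ c₄ c₅ : A) → Fin 6 → A
hex c₀ c₁ c₂ c₃ c₄ c₅ 0F = c₀
hex c₀ c₁ c₂ c₃ c₄ c₅ 1F = c₁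
hex c₀ c₁ c₂ c₃ c₄ c₅ 2F = c₂
hex c₀ c₁ c₂ c₃ c₄ c₅ 3F = c₃
hex c₀ c₁ c₂ c₃ c₄ c₅ 4F = c₄
hex c₀ c₁ c₂ c₃ c₄ c₅ 5F = c₅

row : {A : Set} (y₀ y₁ y₂ : A) → Fin 3 → A
row y₀ y₁ y₂ 0F = y₀
row y₀ y₁ y₂ 1F = y₁
row y₀ y₁ y₂ 2F = y₂

spokes : (Fin 6 → K) → Fin 3 → Side → K
spokes hs i s = hs (spoke i s)

HexAt : {A : Set} → (Fin 6 → A) → (Fin 6 → A) → Fin 6 → Set
HexAt hc hs j = Distinct₃ (hc j) (hc (prev j)) (hs j)

hexAt? : ∀ hc hs j → Dec (HexAt {K} hc hs j)
hexAt? hc hs j = distinct₃? (hc j) (hc (prev j)) (hs j)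

-- The search over colourings of the 6-cycle is pruned at consecutive edges
-- of equal colour, except at the vertices in X.
module _ {X : Fin 6 → Set} (X? : ∀ j → Dec (X j)) where

  private
    ok : Fin 6 → K → K → Set
    ok j x y = X j ⊎ x ≢ y
    ok? : ∀ j x y → Dec (ok j x y)
    ok? j x y = X? j ⊎-dec ¬? (x ≟K y)

  HexSearch : ((Fin 6 → K) → Set) → Set
  HexSearch Q = ∃[ c₀ ] ∃[ c₁ ] ok 1F c₁ c₀ × (∃[ c₂ ] ok 2F c₂ c₁ × (∃[ c₃ ] ok 3F c₃ c₂ × (∃[ c₄ ] ok 4F c₄ c₃ ×
    (∃[ c₅ ] ok 5F c₅ c₄ × Q (hex c₀ c₁ c₂ c₃ c₄ c₅)))))

  hexSearch? : ∀ {Q} → (∀ hc → Dec (Q hc)) → Dec (HexSearch Q)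
  hexSearch? Q? = anyK? λ c₀ → anyK? λ c₁ → ok? 1F c₁ c₀ ×-dec anyK? λ c₂ → ok? 2F c₂ c₁ ×-dec
    anyK? λ c₃ → ok? 3F c₃ c₂ ×-dec anyK? λ c₄ → ok? 4F c₄ c₃ ×-dec anyK? λ c₅ → ok? 5F c₅ c₄ ×-dec
    Q? (hex c₀ c₁ c₂ c₃ c₄ c₅)

  hexSearch-∃ : ∀ {Q} → HexSearch Q → ∃ Q
  hexSearch-∃ (_ , _ , _ , _ , _ , _ , _ , _ , _ , _ , _ , q) = _ , q

thirds : (Fin 6 → K) → Fin 6 → K
thirds hc j = third (hc j) (hc (prev j))

set : {A : Set} → Fin 6 → A → (Fin 6 → A) → Fin 6 → A
set j z hs k with k ≟ j
... | yes _ = z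
... | no _  = hs k

private
  flow? : ∀ i hs (x : K) → Dec (halfSum (spokes hs i) ≡ proj₁ x)
  flow? i hs x = halfSum (spokes hs i) ≟₂ proj₁ x

third-unique : ∀ x y z → Distinct₃ x y z → z ≡ third x y
third-unique = toWitness {a? = allK? λ x → allK? λ y → allK? λ z → distinct₃? x y z →-dec (z ≟K third x y)} tt

-- Each spoke is determined by the two cycle edges that it meets, so the search runs over the cycle
-- edges only. As `hc` is an arbitrary function, its values are first transferred to a `hex`.
hex-zero-flow : ∀ hc hs → (∀ j → HexAt {K} hc hs j) → ¬ (∀ i → halfSum (spokes hs i) ≢ 0₂)
hex-zero-flow hc hs ok nonzero = search (hc 0F) (hc 1F) (hc 2F) (hc 3F) (hc 4F) (hc 5F)
    (λ j → subst Distinct (η j) (proj₁ (ok j)))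
    (λ i eq → nonzero i (trans (cong₂ (λ x y → proj₁ x ⊕ proj₁ y) (hs-third (spoke i L)) (hs-third (spoke i R))) eq))
  where
  Distinct : K × K → Set
  Distinct (x , y) = x ≢ y
  hc′ : Fin 6 → K
  hc′ = hex (hc 0F) (hc 1F) (hc 2F) (hc 3F) (hc 4F) (hc 5F)
  hc-η : ∀ j → hc j ≡ hc′ j
  hc-η 0F = refl
  hc-η 1F = refl
  hc-η 2F = refl
  hc-η 3F = refl
  hc-η 4F = refl
  hc-η 5F = refl
  η : ∀ j → (hc j , hc (prev j)) ≡ (hc′ j , hc′ (prev j))
  η j = cong₂ _,_ (hc-η j) (hc-η (prev j))
  hs-third : ∀ j → hs j ≡ thirds hc′ j
  hs-third j = trans (third-unique _ _ _ (ok j)) (cong₂ third (hc-η j) (hc-η (prev j)))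
  search : ∀ c₀ c₁ c₂ c₃ c₄ c₅ → let hc = hex c₀ c₁ c₂ c₃ c₄ c₅ in
    (∀ j → hc j ≢ hc (prev j)) → ¬ (∀ i → halfSum (spokes (thirds hc) i) ≢ 0₂)
  search = toWitness {a? = allK? λ c₀ → allK? λ c₁ → allK? λ c₂ → allK? λ c₃ → allK? λ c₄ → allK? λ c₅ →
    let hc = hex c₀ c₁ c₂ c₃ c₄ c₅ in all? (λ j → ¬? (hc j ≟K hc (prev j))) →-dec
    ¬? (all? λ i → ¬? (halfSum (spokes (thirds hc) i) ≟₂ 0₂))} tt

-- For poles whose edge e_i keeps a single colour `x`, given by a colouring of the i-th graph. The
-- common flow `f` through the other two connectors is left to the search.
hex-case₁ : ∀ i x → ∃[ hc ] (∀ j → HexAt hc (thirds hc) j) × thirds hc (spoke i L) ≡ x × thirds hc (spoke i R) ≡ x ×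
  ∃ λ (f : K) → halfSum (spokes (thirds hc) (nx i)) ≡ proj₁ f × halfSum (spokes (thirds hc) (nx (nx i))) ≡ proj₁ f
hex-case₁ i x = hexSearch-∃ {X = λ _ → ⊥} (λ _ → no (λ ())) (toWitness {a? = all? λ i → allK? λ x → hexSearch? {X = λ _ → ⊥} (λ _ → no (λ ())) λ hc →
  all? (hexAt? hc (thirds hc)) ×-dec (thirds hc (spoke i L) ≟K x ×-dec (thirds hc (spoke i R) ≟K x ×-dec
  anyK? λ f → flow? (nx i) (thirds hc) f ×-dec flow? (nx (nx i)) (thirds hc) f))} tt i x)

-- Here `x` is the colour of the remaining half of e_i and `z` that of the deleted half. `z` can be
-- prescribed because both ends of the spoke carrying it are removed. The flows are the sums of the
-- rows ω y and ω² y when `y` has sum `x`.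
hex-case₂ : ∀ i s x z → ∃[ hc ] let hs = set (spoke i s) z (thirds hc) in
  (∀ k → k ≡ spoke i s ⊎ HexAt hc hs k) × hs (spoke i (flipS s)) ≡ x × hs (spoke i s) ≡ z ×
  halfSum (spokes hs (nx i)) ≡ proj₁ (ω x) × halfSum (spokes hs (nx (nx i))) ≡ proj₁ (ω (ω x))
hex-case₂ i s x z = hexSearch-∃ (_≟ spoke i s) (table i s x z)
  where
  Goal : ∀ i s x z → Set
  Goal i s x z = HexSearch (_≟ spoke i s) λ hc → let hs = set (spoke i s) z (thirds hc) in
    (∀ k → k ≡ spoke i s ⊎ HexAt hc hs k) × hs (spoke i (flipS s)) ≡ x × hs (spoke i s) ≡ z ×
    halfSum (spokes hs (nx i)) ≡ proj₁ (ω x) × halfSum (spokes hs (nx (nx i))) ≡ proj₁ (ω (ω x))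
  goal? : ∀ i s x z → Dec (Goal i s x z)
  goal? i s x z = hexSearch? (_≟ spoke i s) λ hc → let hs = set (spoke i s) z (thirds hc) in
    all? (λ k → (k ≟ spoke i s) ⊎-dec hexAt? hc hs k) ×-dec ((hs (spoke i (flipS s)) ≟K x) ×-dec ((hs (spoke i s) ≟K z) ×-dec
    (flow? (nx i) hs (ω x) ×-dec flow? (nx (nx i)) hs (ω (ω x)))))
  table : ∀ i s x z → Goal i s x z
  table i L = toWitness {a? = all? λ i → allK? λ x → allK? λ z → goal? i L x z} tt i
  table i R = toWitness {a? = all? λ i → allK? λ x → allK? λ z → goal? i R x z} tt i

-- The flows are the three different colours, so that a constant row can be used in each pole. The
-- spokes at the two removed vertices need not fit the cycle.
hex-case₄ : ∀ j → ∃[ hc ] ∃[ hs ] (∀ k → (k ≡ j ⊎ k ≡ next j) ⊎ HexAt hc hs k) × (∀ i → halfSum (spokes hs i) ≡ proj₁ (3→K i))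
hex-case₄ j = proj₁ found , ends (proj₁ found) j , proj₂ found
  where
  X? : ∀ j k → Dec (k ≡ j ⊎ k ≡ next j)
  X? j k = (k ≟ j) ⊎-dec (k ≟ next j)
  -- A free spoke has to complement the opposite spoke to the prescribed flow, and `third` adds two
  -- different colours. Neighbours on the cycle are not opposite, so at most one spoke of each pair
  -- is free.
  fill : (Fin 6 → K) → Fin 6 → K
  fill hs k = third (3→K (proj₁ (unspoke k))) (hs (opp k))
  ends : (Fin 6 → K) → Fin 6 → Fin 6 → K
  ends hc j = set j (fill (thirds hc) j) (set (next j) (fill (thirds hc) (next j)) (thirds hc))
  Goal : Fin 6 → (Fin 6 → K) → Set
  Goal j hc = (∀ k → (k ≡ j ⊎ k ≡ next j) ⊎ HexAt hc (ends hc j) k) × (∀ i → halfSum (spokes (ends hc j) i) ≡ proj₁ (3→K i))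
  found : ∃ (Goal j)
  found = hexSearch-∃ (X? j) (toWitness {a? = all? λ j → hexSearch? (X? j) {Goal j} λ hc →
    all? (λ k → X? j k ⊎-dec hexAt? hc (ends hc j) k) ×-dec all? (λ i → flow? i (ends hc j) (3→K i))} tt j)

-- Rows of colours at the new vertices

ω-distinct : ∀ x → Distinct₃ x (ω x) (ω (ω x))
ω-distinct = toWitness {a? = allK? λ x → distinct₃? x (ω x) (ω (ω x))} tt

-- Multiplication by `ω` is additive; here this is checked on all colours.
ω-row : ∀ y x → rowSum y ≡ proj₁ x → rowSum (λ k → ω (y k)) ≡ proj₁ (ω x)
ω-row y x = toWitness {a? = allK? λ y₀ → allK? λ y₁ → allK? λ y₂ → allK? λ x →
  (rowSum (row y₀ y₁ y₂) ≟₂ proj₁ x) →-dec (rowSum (row (ω y₀) (ω y₁) (ω y₂)) ≟₂ proj₁ (ω x))} tt (y 0F) (y 1F) (y 2F) x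

module _ (X : Fin 3 → Set) where

  -- Rows belong to poles and columns to new vertices. Given the row `y` of one pole, `p` and `q`
  -- are rows for the other two; the columns in `X` are those of removed vertices.
  Rows : K → (Fin 3 → K) → Set
  Rows f y = ∃[ p ] ∃[ q ] (∀ k → X k ⊎ Distinct₃ (y k) (p k) (q k)) × rowSum p ≡ proj₁ f × rowSum q ≡ proj₁ f

  private
    column : (Fin 3 → K) → Fin 3 → K → K → Set
    column y k p q = X k ⊎ Distinct₃ (y k) p q

  RowSearch : K → (Fin 3 → K) → Set
  RowSearch f y = ∃[ p₀ ] ∃[ q₀ ] column y 0F p₀ q₀ × (∃[ p₁ ] ∃[ q₁ ] column y 1F p₁ q₁ ×
    (∃[ p₂ ] ∃[ q₂ ] column y 2F p₂ q₂ × rowSum (row p₀ p₁ p₂) ≡ proj₁ f × rowSum (row q₀ q₁ q₂) ≡ proj₁ f))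

  rowSearch? : (∀ k → Dec (X k)) → ∀ f y → Dec (RowSearch f y)
  rowSearch? X? f y = anyK? λ p₀ → anyK? λ q₀ → column? 0F p₀ q₀ ×-dec anyK? λ p₁ → anyK? λ q₁ → column? 1F p₁ q₁ ×-dec
    anyK? λ p₂ → anyK? λ q₂ → column? 2F p₂ q₂ ×-dec
    ((rowSum (row p₀ p₁ p₂) ≟₂ proj₁ f) ×-dec (rowSum (row q₀ q₁ q₂) ≟₂ proj₁ f))
    where
    column? : ∀ k p q → Dec (column y k p q)
    column? k p q = X? k ⊎-dec distinct₃? (y k) p q

  rowSearch-∃ : ∀ {f} y → RowSearch f (row (y 0F) (y 1F) (y 2F)) → Rows f y
  rowSearch-∃ y (p₀ , q₀ , k₀ , p₁ , q₁ , k₁ , p₂ , q₂ , k₂ , sums) =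
    row p₀ p₁ p₂ , row q₀ q₁ q₂ , (λ { 0F → k₀ ; 1F → k₁ ; 2F → k₂ }) , sums

-- The search succeeds for the following reason: if `p` and `q` are the two cyclic shifts of `y`,
-- both sums vanish, and exchanging their entries in the column where `y` equals `f` adds `f` to
-- both.
rows-case₁ : ∀ f y → Distinct₃ (y 0F) (y 1F) (y 2F) → Rows (λ _ → ⊥) f y
rows-case₁ f y d = rowSearch-∃ (λ _ → ⊥) {f} y (toWitness {a? = allK? λ f → allK? λ y₀ → allK? λ y₁ → allK? λ y₂ →
  distinct₃? y₀ y₁ y₂ →-dec rowSearch? (λ _ → ⊥) (λ _ → no (λ ())) f (row y₀ y₁ y₂)} tt f (y 0F) (y 1F) (y 2F) d)

-- In the exempt column the sums determine the entries of `p` and `q`; the other two columns only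
-- have to be chosen so that these entries are nonzero.
rows-case₃ : ∀ k f y → Rows (_≡ k) f y
rows-case₃ k f y = rowSearch-∃ (_≡ k) {f} y (toWitness {a? = all? λ k → allK? λ f → allK? λ y₀ → allK? λ y₁ → allK? λ y₂ →
  rowSearch? (_≡ k) (_≟ k) f (row y₀ y₁ y₂)} tt k f (y 0F) (y 1F) (y 2F))

-- Poles of critical snarks

length-three : {A : Set} (xs : List A) → length xs ≡ 3 → ∃[ a ] ∃[ b ] ∃[ c ] xs ≡ a ∷ b ∷ c ∷ []
length-three (a ∷ b ∷ c ∷ []) eq = a , b , c , refl

module _ (G : Multipole) where

  -- The two ends of a loop would be distinct ends at one vertex with the same colour.
  colourable⇒loopless : EdgeColourable C G → ∀ d {v} → end G d L ≡ just v → end G d R ≢ just v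
  colourable⇒loopless (φ , ok) d {v} dL dR = allPairs⇒properAt G v (ok v) (d , L) (d , R) dL dR (λ ()) refl

  module _ (e : Fin (nE G)) (w : Fin (nV G)) (snark : Snark G) (e∌w : ¬ Incident G e w) where

    private
      darts-at : ∀ v → Darts 3 (end G) v
      darts-at v = length⇒darts G v (proj₁ (proj₂ snark) v)

      listed : ∃[ p ] ∃[ q ] ∃[ r ] endsAt (cutEdge G e) w ≡ p ∷ q ∷ r ∷ []
      listed = length-three _ (darts⇒length (cutEdge G e) w (cut-darts⁺ G e (darts-at w)))

      w-listed : Darts 3 (end (cutEdge G e)) w
      w-listed = listed-darts (cutEdge G e) w (proj₂ (proj₂ (proj₂ listed)))

      from-cut : ∀ p → At (end (cutEdge G e)) p w → p ≡ inj₁E (fromCut G e p)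
      from-cut p pw with at , back ← fromCut-at G e p pw =
        trans (sym back) (toCut-other G e (λ eq → e∌w (proj₂ (fromCut G e p) , subst (λ d → end G d (proj₂ (fromCut G e p)) ≡ just w) eq at)) (proj₂ (fromCut G e p)))

    snarkPole : Pole
    snarkPole = record
      { G = G ; e = e ; w = w
      ; conns≡[] = proj₁ (proj₁ snark)
      ; attached = proj₂ (proj₁ snark)
      ; loopless = colourable⇒loopless (proj₁ (proj₂ (proj₂ (proj₂ snark))))
      ; e∌w = λ s es → e∌w (s , es)
      ; darts = darts-at
      ; w-darts = cut-darts⁻ G e w-listed
      ; C-list = trans (proj₂ (proj₂ (proj₂ listed)))
          (cong₂ _∷_ (from-cut _ (Darts.dart-at w-listed zero))
            (cong₂ _∷_ (from-cut _ (Darts.dart-at w-listed (suc zero)))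
              (cong (_∷ []) (from-cut _ (Darts.dart-at w-listed (suc (suc zero))))))) }

-- The consequences of admissibility, restated as facts about labellings of the ends of `G` itself.
record Piece : Set where
  field
    P : Pole
  open Pole P public
  field
    critical  : ∀ u v → u ≢ v → Adjacent G u v → ∃[ ψ ] (∀ x → x ≢ u → x ≢ v → EdgeProperAt {C = K} G ψ x)
    connected : Connected G
    proper    : ∀ β ψ → ProperPole β ψ → halfSum β ≢ 0₂
    perfect   : ∀ β y → halfSum β ≢ 0₂ → halfSum β ≡ rowSum y →
                ∃[ ψ ] (∀ k → ψ (proj₁ (c k)) ≡ y k) × ProperPole β ψ
    good      : ∀ s → HalfColouring P s

admissiblePiece : ∀ G e w → Admissible G e w → Piece
admissiblePiece G e w ((snark , crit) , e∌w , prop , perf , good) = record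
  { P = snarkPole G e w snark e∌w
  ; critical = λ u v u≢v adj → removing⇒labelling G (crit u v u≢v adj)
  ; connected = proj₁ (proj₂ (proj₂ snark))
  ; proper = Pole.pole-proper (snarkPole G e w snark e∌w) prop
  ; perfect = Pole.pole-perfect (snarkPole G e w snark e∌w) perf
  ; good = good⇒half-colouring (snarkPole G e w snark e∌w) good }

-- Components and incidences

K-nonzero : ∀ (x : K) → proj₁ x ≢ 0₂
K-nonzero (_ , t) refl = t

-- Places `y` at pole `i`, `p` at `nx i` and `q` at `nx (nx i)`, so that the exceptional pole can be
-- any of the three without repeating the argument.
rotated : {A : Set} → Fin 3 → (y p q : A) → Fin 3 → A
rotated 0F y p q = row y p q
rotated 1F y p q = row q y p
rotated 2F y p q = row p q y

rotate-elim : (Z : Fin 3 → Set) → ∀ i → Z i → Z (nx i) → Z (nx (nx i)) → ∀ j → Z j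
rotate-elim Z 0F a b c 0F = a
rotate-elim Z 0F a b c 1F = b
rotate-elim Z 0F a b c 2F = c
rotate-elim Z 1F a b c 0F = c
rotate-elim Z 1F a b c 1F = a
rotate-elim Z 1F a b c 2F = b
rotate-elim Z 2F a b c 0F = b
rotate-elim Z 2F a b c 1F = c
rotate-elim Z 2F a b c 2F = a

rotated-elim : {A : Set} (Z : Fin 3 → A → Set) → ∀ i {y p q} → Z i y → Z (nx i) p → Z (nx (nx i)) q →
  ∀ j → Z j (rotated i y p q j)
rotated-elim Z 0F a b c = rotate-elim _ 0F a b c
rotated-elim Z 1F a b c = rotate-elim _ 1F a b c
rotated-elim Z 2F a b c = rotate-elim _ 2F a b c

distinct-rotated : {A : Set} {B : Set} (i : Fin 3) {y p q : B → A} {k : B} → Distinct₃ (y k) (p k) (q k) →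
  Distinct₃ (rotated i y p q 0F k) (rotated i y p q 1F k) (rotated i y p q 2F k)
distinct-rotated 0F d = d
distinct-rotated 1F (yp , yq , pq) = ≢-sym yq , ≢-sym pq , yp
distinct-rotated 2F (yp , yq , pq) = pq , ≢-sym yp , ≢-sym yq

distinct₃-lookup : {A : Set} (f : Fin 3 → A) → Distinct₃ (f 0F) (f 1F) (f 2F) → ∀ {i j} → i ≢ j → f i ≢ f j
distinct₃-lookup f (a , b , c) {0F} {0F} n = contradiction refl n
distinct₃-lookup f (a , b , c) {0F} {1F} n = a
distinct₃-lookup f (a , b , c) {0F} {2F} n = b
distinct₃-lookup f (a , b , c) {1F} {0F} n = ≢-sym a
distinct₃-lookup f (a , b , c) {1F} {1F} n = contradiction refl n
distinct₃-lookup f (a , b , c) {1F} {2F} n = c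
distinct₃-lookup f (a , b , c) {2F} {0F} n = ≢-sym b
distinct₃-lookup f (a , b , c) {2F} {1F} n = ≢-sym c
distinct₃-lookup f (a , b , c) {2F} {2F} n = contradiction refl n

next-prev : ∀ j → next (prev j) ≡ j
next-prev 0F = refl
next-prev 1F = refl
next-prev 2F = refl
next-prev 3F = refl
next-prev 4F = refl
next-prev 5F = refl

prev-next : ∀ j → prev (next j) ≡ j
prev-next 0F = refl
prev-next 1F = refl
prev-next 2F = refl
prev-next 3F = refl
prev-next 4F = refl
prev-next 5F = refl

-- Components are computed by merging, for each edge in turn, the classes of
-- its ends; rep maps a vertex to a representative of its class.
module _ (M : Multipole) where

  private
    _⟶*_ : Fin (nV M) → Fin (nV M) → Set
    _⟶*_ = Star (Adjacent M)

  ⟶*-sym : ∀ {x y} → x ⟶* y → y ⟶* x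
  ⟶*-sym = reverse λ { (d , inj₁ p) → d , inj₂ p ; (d , inj₂ p) → d , inj₁ p }

  Components : List (Fin (nE M)) → Set
  Components ds = ∃ λ (rep : Fin (nV M) → Fin (nV M)) → (∀ x → x ⟶* rep x) ×
    (∀ {d u v} → d ∈ ds → end M d L ≡ just u → end M d R ≡ just v → rep u ≡ rep v)

  merge : ∀ {d ds u v} → end M d L ≡ just u → end M d R ≡ just v → Components ds → Components (d ∷ ds)
  merge {d} {ds} {u} {v} du dv (rep , reach , same) = rep′ , reach′ , same′
    where
    rep′ : Fin (nV M) → Fin (nV M)
    rep′ x = if does (rep x ≟ rep u) then rep v else rep x
    reach′ : ∀ x → x ⟶* rep′ x
    reach′ x with rep x ≟ rep u
    ... | yes eq = subst (x ⟶*_) eq (reach x) ◅◅ ⟶*-sym (reach u) ◅◅ ((d , inj₁ (du , dv)) ◅ reach v)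
    ... | no _   = reach x
    joined : rep′ u ≡ rep′ v
    joined rewrite dec-true (rep u ≟ rep u) refl with rep v ≟ rep u
    ... | yes _ = refl
    ... | no _  = refl
    same′ : ∀ {f a b} → f ∈ d ∷ ds → end M f L ≡ just a → end M f R ≡ just b → rep′ a ≡ rep′ b
    same′ (here refl) fa fb with refl ← trans (sym fa) du | refl ← trans (sym fb) dv = joined
    same′ (there f∈)  fa fb = cong (λ r → if does (r ≟ rep u) then rep v else r) (same f∈ fa fb)

  components : ∀ ds → Components ds
  components []       = (λ x → x) , (λ x → ε) , λ ()
  components (d ∷ ds) with end M d L in dL | end M d R in dR
  ... | just u  | just v  = merge dL dR (components ds)
  ... | nothing | _       = let rep , reach , same = components ds in rep , reach ,
    λ { (here refl) fa _ → contradiction (trans (sym dL) fa) λ () ; (there f∈) → same f∈ }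
  ... | just _  | nothing = let rep , reach , same = components ds in rep , reach ,
    λ { (here refl) _ fb → contradiction (trans (sym dR) fb) λ () ; (there f∈) → same f∈ }

module Composition (Q : Fin 3 → Piece) where

  module Q i = Piece (Q i)

  open Assembly (λ i → Piece.P (Q i)) public

  data TeView (i : Fin 3) (d : Fin (nE (Q.G i))) (t : Side) : Maybe VN → Set where
    inner : ∀ {x} → end (Q.G i) d t ≡ just x → x ≢ Q.w i → TeView i d t (just (tv i x))
    outer : ∀ k → Q.c i k ≡ (d , t) → TeView i d t (just (nv k))

  te-view : ∀ i d t → TeView i d t (en₁ (te i d) t)
  te-view i d t with x , dx ← Q.attached i d t = by-vertex (x ≟ Q.w i) dx
    where
    by-vertex : ∀ {x} → Dec (x ≡ Q.w i) → end (Q.G i) d t ≡ just x → TeView i d t (en₁ (te i d) t)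
    by-vertex (no x≢w) dx = subst (TeView i d t) (sym (en₁-inner dx x≢w)) (inner dx x≢w)
    by-vertex (yes refl) dx with k , eq ← Darts.dart-onto (Q.w-darts i) (d , t) dx =
      subst (TeView i d t) (trans (sym (en₁-c i k)) (cong (λ p → en₁ (te i (proj₁ p)) (proj₂ p)) eq)) (outer k eq)

  en-spoke : ∀ i s {x} → end (Q.G i) (Q.e i) s ≡ just x → en (sp (spoke i s)) R ≡ just (tv i x)
  en-spoke i s {x} ex = trans (cong (λ u → place (proj₁ u) (end (Q.G (proj₁ u)) (Q.e (proj₁ u)) (proj₂ u))) (unspoke-spoke i s))
    (trans (cong (place i) ex) (cong (if_then nothing else just (tv i x)) (dec-false (x ≟ Q.w i) λ { refl → Q.e∌w i s ex })))

  record Around (x : VN) : Set where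
    field
      dart : Fin 3 → N × Side
      dart-live : ∀ k → live (proj₁ (dart k))
      dart-inj  : ∀ {j k} → dart j ≡ dart k → j ≡ k
      dart-at   : ∀ k → At en (dart k) x
      dart-onto : ∀ p → live (proj₁ p) → At en p x → ∃[ k ] dart k ≡ p

  around-hv : ∀ j → Around (hv j)
  around-hv j = record
    { dart = dart
    ; dart-live = λ { 0F → tt ; 1F → tt ; 2F → tt }
    ; dart-inj = λ {k} {l} eq → trans (sym (slot-dart k)) (trans (cong slot eq) (slot-dart l))
    ; dart-at = λ { 0F → refl ; 1F → cong (λ l → just (hv l)) (next-prev j) ; 2F → refl }
    ; dart-onto = onto }
    where
    dart : Fin 3 → N × Side
    dart 0F = cy j , L
    dart 1F = cy (prev j) , R
    dart 2F = sp j , L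
    slot : N × Side → Fin 3
    slot (cy _ , L) = 0F
    slot (cy _ , R) = 1F
    slot _          = 2F
    slot-dart : ∀ k → slot (dart k) ≡ k
    slot-dart 0F = refl
    slot-dart 1F = refl
    slot-dart 2F = refl
    onto : ∀ p → live (proj₁ p) → At en p (hv j) → ∃[ k ] dart k ≡ p
    onto (cy l , L) _ refl = 0F , refl
    onto (cy l , R) _ refl = 1F , cong (λ l → cy l , R) (prev-next l)
    onto (sp l , L) _ refl = 2F , refl
    onto (sp l , R) _ eq = contradiction eq (no-hv l)
      where
      no-hv : ∀ l → en (sp l) R ≢ just (hv j)
      no-hv l eq with x , ex ← Q.attached (proj₁ (unspoke l)) (Q.e (proj₁ (unspoke l))) (proj₂ (unspoke l))
        with () ← trans (sym (en-spoke (proj₁ (unspoke l)) (proj₂ (unspoke l)) ex))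
                    (trans (cong (λ m → en (sp m) R) (spoke-unspoke l)) eq)
    onto (te i d , t) _ eq with en₁ (te i d) t | te-view i d t
    onto (te i d , t) _ () | _ | inner _ _
    onto (te i d , t) _ () | _ | outer _ _

  around-nv : ∀ k → Around (nv k)
  around-nv k = record
    { dart = λ i → key i k
    ; dart-live = λ i → Q.c≢e i k
    ; dart-inj = λ eq → te-index (cong proj₁ eq)
    ; dart-at = λ i → en₁-c i k
    ; dart-onto = onto }
    where
    onto : ∀ p → live (proj₁ p) → At en p (nv k) → ∃[ i ] key i k ≡ p
    onto (sp l , R) _ eq with x , ex ← Q.attached (proj₁ (unspoke l)) (Q.e (proj₁ (unspoke l))) (proj₂ (unspoke l))
      with () ← trans (sym (en-spoke (proj₁ (unspoke l)) (proj₂ (unspoke l)) ex))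
                  (trans (cong (λ m → en (sp m) R) (spoke-unspoke l)) eq)
    onto (cy l , L) _ ()
    onto (cy l , R) _ ()
    onto (te i d , t) _ eq with en₁ (te i d) t | te-view i d t
    onto (te i d , t) _ refl | _ | outer .k ck = i , cong (λ p → te i (proj₁ p) , proj₂ p) ck

  -- An end of e_i survives as the `R` end of the spoke with which its half was joined; all other
  -- ends keep their edge.
  toN : ∀ i → EndOf (Q.G i) → N × Side
  toN i (d , s) = if does (d ≟ Q.e i) then (sp (spoke i s) , R) else (te i d , s)

  toN-e : ∀ i s → toN i (Q.e i , s) ≡ (sp (spoke i s) , R)
  toN-e i s rewrite dec-true (Q.e i ≟ Q.e i) refl = refl

  toN-other : ∀ i {d} s → d ≢ Q.e i → toN i (d , s) ≡ (te i d , s)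
  toN-other i {d} s d≢e rewrite dec-false (d ≟ Q.e i) d≢e = refl

  toN-live : ∀ i p → live (proj₁ (toN i p))
  toN-live i (d , s) with d ≟ Q.e i
  ... | yes _  = tt
  ... | no d≢e = d≢e

  toN-at : ∀ i {x} p → x ≢ Q.w i → At (end (Q.G i)) p x → At en (toN i p) (tv i x)
  toN-at i (d , s) x≢w dx with d ≟ Q.e i
  ... | yes refl = en-spoke i s dx
  ... | no _     = en₁-inner dx x≢w

  toN-injective : ∀ i p q → toN i p ≡ toN i q → p ≡ q
  toN-injective i (d , s) (f , t) eq with d ≟ Q.e i | f ≟ Q.e i
  ... | yes refl | yes refl = cong (λ u → Q.e i , proj₂ u)
        (trans (sym (unspoke-spoke i s)) (trans (cong unspoke (sp-injective (cong proj₁ eq))) (unspoke-spoke i t)))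
    where
    sp-injective : ∀ {j k} → sp j ≡ sp k → j ≡ k
    sp-injective refl = refl
  toN-injective i (d , s) (f , t) refl | no _ | no _ = refl

  around-tv : ∀ i x → x ≢ Q.w i → Around (tv i x)
  around-tv i x x≢w = record
    { dart = λ k → toN i (D.dart k)
    ; dart-live = λ k → toN-live i (D.dart k)
    ; dart-inj = λ eq → D.dart-inj (toN-injective i _ _ eq)
    ; dart-at = λ k → toN-at i (D.dart k) x≢w (D.dart-at k)
    ; dart-onto = onto }
    where
    module D = Darts (Q.darts i x)
    from : ∀ {p q} → At (end (Q.G i)) p x → toN i p ≡ q → ∃[ k ] toN i (D.dart k) ≡ q
    from px refl with k , eq ← D.dart-onto _ px = k , cong (toN i) eq
    onto : ∀ p → live (proj₁ p) → At en p (tv i x) → ∃[ k ] toN i (D.dart k) ≡ p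
    onto (cy l , L) _ ()
    onto (cy l , R) _ ()
    onto (sp l , R) _ eq with y , ey ← Q.attached (proj₁ (unspoke l)) (Q.e (proj₁ (unspoke l))) (proj₂ (unspoke l))
      = spoke-case (unspoke l) (spoke-unspoke l) ey (trans (sym (en-spoke (proj₁ (unspoke l)) (proj₂ (unspoke l)) ey))
          (trans (cong (λ m → en (sp m) R) (spoke-unspoke l)) eq))
      where
      spoke-case : ∀ u {y} → spoke (proj₁ u) (proj₂ u) ≡ l → end (Q.G (proj₁ u)) (Q.e (proj₁ u)) (proj₂ u) ≡ just y →
        just (tv (proj₁ u) y) ≡ just (tv i x) → ∃[ k ] toN i (D.dart k) ≡ (sp l , R)
      spoke-case (_ , s) refl ey refl = from ey (toN-e i s)
    onto (te j d , t) d≢e eq with en₁ (te j d) t | te-view j d t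
    onto (te .i d , t) d≢e refl | _ | inner dx _ = from dx (toN-other i t d≢e)

  around : ∀ x → vlive x → Around x
  around (hv j)   _   = around-hv j
  around (tv i x) x≢w = around-tv i x x≢w
  around (nv k)   _   = around-nv k

-- Colourings and connectedness of the composite graph

constant-row : ∀ x → rowSum (λ _ → x) ≡ proj₁ x
constant-row ka = refl
constant-row kb = refl
constant-row kc = refl

cutVal-map : ∀ {A A′ : Set} G e (f : A → A′) β ψ p → f (cutVal G e β ψ p) ≡ cutVal G e (λ s → f (β s)) (λ d → f (ψ d)) p
cutVal-map G e f β ψ (d , s) with d ≟ e
... | yes _ = refl
... | no _  = refl

cutVal-cong : ∀ {A : Set} G e {β β′ : Side → A} {ψ} → (∀ s → β s ≡ β′ s) → ∀ p → cutVal G e β ψ p ≡ cutVal G e β′ ψ p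
cutVal-cong G e eq (d , s) with d ≟ e
... | yes _ = eq s
... | no _  = refl

cutVal-uncut : ∀ {A : Set} G e (ψ : Fin (nE G) → A) p → cutVal G e (λ _ → ψ e) ψ p ≡ ψ (proj₁ p)
cutVal-uncut G e ψ (d , s) with d ≟ e
... | yes refl = refl
... | no _     = refl

module Composite (Q : Fin 3 → Piece) where

  open Composition Q

  -- Transfer between the composite graph and its names

  module Graph (F : Multipole) (ν : Named F live vlive en []) where

    nm : Fin (nE F) → N
    nm = name (edges ν)

    vm : Fin (nV F) → VN
    vm = name (verts ν)

    edge : ∀ {n} → live n → Fin (nE F)
    edge l = proj₁ (name-onto (edges ν) l)

    nm-edge : ∀ {n} (l : live n) → nm (edge l) ≡ n
    nm-edge l = proj₂ (name-onto (edges ν) l)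

    vert : ∀ {x} → vlive x → Fin (nV F)
    vert l = proj₁ (name-onto (verts ν) l)

    vm-vert : ∀ {x} (l : vlive x) → vm (vert l) ≡ x
    vm-vert l = proj₂ (name-onto (verts ν) l)

    at⇒named : ∀ {p y} → At (end F) p y → en (nm (proj₁ p)) (proj₂ p) ≡ just (vm y)
    at⇒named {i , t} {y} py = trans (sym (ends ν i t)) (cong (Maybe.map vm) py)

    named⇒at : ∀ i t {x} → en (nm i) t ≡ just x → ∃[ y ] end F i t ≡ just y × vm y ≡ x
    named⇒at i t eq with end F i t | ends ν i t
    ... | just y  | e = y , refl , just-injective (trans e eq)
    ... | nothing | e with () ← trans e eq

    named⇒at-edge : ∀ {n} (l : live n) t {x y} → en n t ≡ just x → vm y ≡ x → At (end F) (edge l , t) y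
    named⇒at-edge l t eq refl with y′ , y′-at , y′-vm ← named⇒at (edge l) t (trans (cong (λ n → en n t) (nm-edge l)) eq) =
      trans y′-at (cong just (name-inj (verts ν) y′-vm))

    nm-end-injective : ∀ {p q : EndOf F} → nmE ν p ≡ nmE ν q → p ≡ q
    nm-end-injective eq = cong₂ _,_ (name-inj (edges ν) (cong proj₁ eq)) (cong proj₂ eq)

    labelled-proper : ∀ {C : Set} (label : N → C) {x y} → vm y ≡ x → (A : Around x) → let open Around A in
      (∀ {j k} → j ≢ k → label (proj₁ (dart j)) ≢ label (proj₁ (dart k))) → EdgeProperAt F (λ i → label (nm i)) y
    labelled-proper label refl A distinct p q py qy p≢q
      with j , jp ← Around.dart-onto A (nmE ν p) (name-live (edges ν) (proj₁ p)) (at⇒named py)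
         | k , kq ← Around.dart-onto A (nmE ν q) (name-live (edges ν) (proj₁ q)) (at⇒named qy) =
      λ eq → distinct {j} {k} (λ { refl → p≢q (nm-end-injective (trans (sym jp) kq)) })
        (trans (cong (λ r → label (proj₁ r)) jp) (trans eq (sym (cong (λ r → label (proj₁ r)) kq))))

    F-darts : ∀ y → Darts 3 (end F) y
    F-darts y = record
      { dart = λ k → edge (dart-live k) , proj₂ (dart k)
      ; dart-inj = λ {j} {k} eq → dart-inj (cong₂ _,_
          (trans (sym (nm-edge (dart-live j))) (trans (cong (λ p → nm (proj₁ p)) eq) (nm-edge (dart-live k)))) (cong proj₂ eq))
      ; dart-at = λ k → named⇒at-edge (dart-live k) (proj₂ (dart k)) (dart-at k) refl
      ; dart-onto = λ p py → let k , eq = dart-onto (nmE ν p) (name-live (edges ν) (proj₁ p)) (at⇒named py) in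
          k , nm-end-injective (trans (cong (_, proj₂ (dart k)) (nm-edge (dart-live k))) eq) }
      where open Around (around (vm y) (name-live (verts ν) y))

    cubic : Cubic F
    cubic y = darts⇒length F y (F-darts y)

    attached : ∀ i t → ∃[ y ] end F i t ≡ just y
    attached i t = let x , eq = named-end (nm i) (name-live (edges ν) i) t ; y , y-at , _ = named⇒at i t eq in y , y-at
      where
      named-end : ∀ n → live n → ∀ t → ∃[ x ] en n t ≡ just x
      named-end (cy j) _ L = _ , refl
      named-end (cy j) _ R = _ , refl
      named-end (sp j) _ L = _ , refl
      named-end (sp j) _ R with x , ex ← Q.attached (proj₁ (unspoke j)) (Q.e (proj₁ (unspoke j))) (proj₂ (unspoke j)) =
        _ , trans (cong (λ m → en (sp m) R) (sym (spoke-unspoke j))) (en-spoke (proj₁ (unspoke j)) (proj₂ (unspoke j)) ex)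
      named-end (te i d) _ t with en₁ (te i d) t | te-view i d t
      ... | _ | inner _ _ = _ , refl
      ... | _ | outer _ _ = _ , refl

    isGraph : IsGraph F
    isGraph = named-conns≡[] ν refl , attached

    -- The parts have to agree in two places only: the halves of e_i have the colours of their
    -- spokes, and the edges at w_i have the colours `Y i` seen by the new vertices. `X` collects
    -- the removed vertices; the colour type is general because a colouring with four colours is
    -- glued as well.
    glue : ∀ {C : Set} (X : VN → Set) (hc hs : Fin 6 → C) (Y : Fin 3 → Fin 3 → C) →
      (∀ j → X (hv j) ⊎ HexAt hc hs j) →
      (∀ k → X (nv k) ⊎ Distinct₃ (Y 0F k) (Y 1F k) (Y 2F k)) →
      (∀ i → ∃ λ (ψ : Fin (nE (Q.G i)) → C) → (∀ k → ψ (proj₁ (Q.c i k)) ≡ Y i k) ×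
        (∀ x → x ≢ Q.w i → X (tv i x) ⊎ ProperAt (end (Q.G i)) (cutVal (Q.G i) (Q.e i) (λ s → hs (spoke i s)) ψ) x)) →
      ∃ λ (φ : Fin (nE F) → C) → ∀ y → X (vm y) ⊎ EdgeProperAt F φ y
    glue {C} X hc hs Y hex-ok nv-ok sol = (λ i → label (nm i)) , λ y → at y (vm y) refl (name-live (verts ν) y)
      where
      label : N → C
      label (cy j)   = hc j
      label (sp j)   = hs j
      -- A default: halves of cut edges are not live in the composite.
      label (be i s) = hs 0F
      label (te i d) = proj₁ (sol i) d
      label-toN : ∀ i p → label (proj₁ (toN i p)) ≡ cutVal (Q.G i) (Q.e i) (λ s → hs (spoke i s)) (proj₁ (sol i)) p
      label-toN i (d , s) with d ≟ Q.e i
      ... | yes _ = refl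
      ... | no _  = refl
      at : ∀ y x → vm y ≡ x → vlive x → X x ⊎ EdgeProperAt F (λ i → label (nm i)) y
      at y (hv j) eq _ = Sum.map₂ (λ { (a , b , c) →
        labelled-proper label eq (around-hv j) λ {k} {l} → distinct₃-lookup (λ k → label (proj₁ (Around.dart (around-hv j) k))) (a , b , c) {k} {l} }) (hex-ok j)
      at y (nv k) eq _ = Sum.map₂ (λ d → labelled-proper label eq (around-nv k)
        λ {i} {j} i≢j e → distinct₃-lookup (λ i → Y i k) d i≢j (trans (sym (proj₁ (proj₂ (sol i)) k)) (trans e (proj₁ (proj₂ (sol j)) k)))) (nv-ok k)
      at y (tv i x) eq x≢w = Sum.map₂ (λ pr → labelled-proper label eq (around-tv i x x≢w)
        λ {j} {k} j≢k e → pr (D.dart j) (D.dart k) (D.dart-at j) (D.dart-at k) (λ dd → j≢k (D.dart-inj dd))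
          (trans (sym (label-toN i (D.dart j))) (trans e (label-toN i (D.dart k))))) (proj₂ (proj₂ (sol i)) x x≢w)
        where module D = Darts (Q.darts i x)

    -- Nothing is assumed at the new vertices, which rules out bicriticality.
    uncolourable : (φ : Fin (nE F) → K) → (∀ y → (∀ k → vm y ≢ nv k) → EdgeProperAt F φ y) → ⊥
    uncolourable φ ok = hex-zero-flow hc hs hex-ok λ i → Q.proper i (λ s → hs (spoke i s)) (ψ i) (λ x x≢w → pole-ok i x≢w)
      where
      hc hs : Fin 6 → K
      hc j = φ (edge {cy j} tt)
      hs j = φ (edge {sp j} tt)
      ψ : ∀ i → Fin (nE (Q.G i)) → K
      ψ i d with d ≟ Q.e i
      -- An arbitrary colour, as `cutVal` takes the values on e_i from the spokes.
      ... | yes _  = a′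
      ... | no d≢e = φ (edge {te i d} d≢e)
      hex-ok : ∀ j → HexAt hc hs j
      hex-ok j = apart {0F} {1F} (λ ()) , apart {0F} {2F} (λ ()) , apart {1F} {2F} (λ ())
        where
        open Around (around-hv j)
        y : Fin (nV F)
        y = vert {hv j} tt
        on : ∀ k → φ (edge (dart-live k)) ≡ row (hc j) (hc (prev j)) (hs j) k
        on 0F = refl
        on 1F = refl
        on 2F = refl
        apart : ∀ {k l} → k ≢ l → row (hc j) (hc (prev j)) (hs j) k ≢ row (hc j) (hc (prev j)) (hs j) l
        apart {k} {l} k≢l eq = ok y (λ m e → contradiction (trans (sym (vm-vert {hv j} tt)) e) λ ())
          (edge (dart-live k) , proj₂ (dart k)) (edge (dart-live l) , proj₂ (dart l))
          (named⇒at-edge (dart-live k) (proj₂ (dart k)) (dart-at k) (vm-vert {hv j} tt))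
          (named⇒at-edge (dart-live l) (proj₂ (dart l)) (dart-at l) (vm-vert {hv j} tt))
          (λ e → k≢l (dart-inj (cong₂ _,_ (trans (sym (nm-edge (dart-live k))) (trans (cong (λ p → nm (proj₁ p)) e) (nm-edge (dart-live l)))) (cong proj₂ e))))
          (trans (on k) (trans eq (sym (on l))))
      pole-ok : ∀ i {x} → x ≢ Q.w i → ProperAt (end (Q.G i)) (cutVal (Q.G i) (Q.e i) (λ s → hs (spoke i s)) (ψ i)) x
      pole-ok i {x} x≢w = properAt-pull (λ p → edge (toN-live i p) , proj₂ (toN i p))
        (λ p px → named⇒at-edge (toN-live i p) (proj₂ (toN i p)) (toN-at i p x≢w px) (vm-vert {tv i x} x≢w) , value p)
        (λ p q _ _ e → toN-injective i p q (cong₂ _,_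
          (trans (sym (nm-edge (toN-live i p))) (trans (cong (λ p → nm (proj₁ p)) e) (nm-edge (toN-live i q)))) (cong proj₂ e)))
        (ok (vert {tv i x} x≢w) (λ m e → contradiction (trans (sym (vm-vert {tv i x} x≢w)) e) λ ()))
        where
        value : ∀ p → φ (edge (toN-live i p)) ≡ cutVal (Q.G i) (Q.e i) (λ s → hs (spoke i s)) (ψ i) p
        value (d , s) with d ≟ Q.e i
        ... | yes _ = refl
        ... | no d≢e with d ≟ Q.e i
        ...   | yes eq = contradiction eq d≢e
        ...   | no _   = cong φ (name-inj (edges ν) (trans (nm-edge _) (sym (nm-edge _))))

    -- Removing two adjacent vertices

    Near : VN → VN → VN → Set
    Near a b x = x ≡ a ⊎ x ≡ b

    LabelledOff : (VN → Set) → Set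
    LabelledOff X = ∃ λ (φ : Fin (nE F) → K) → ∀ y → X (vm y) ⊎ EdgeProperAt F φ y

    labelled-off-swap : ∀ {a b} → LabelledOff (Near a b) → LabelledOff (Near b a)
    labelled-off-swap (φ , ok) = φ , λ y → Sum.map₁ swap (ok y)

    PoleOff : (VN → Set) → ∀ i → (Side → K) → (Fin 3 → K) → Set
    PoleOff X i β y = ∃ λ (ψ : Fin (nE (Q.G i)) → K) → (∀ k → ψ (proj₁ (Q.c i k)) ≡ y k) ×
      (∀ x → x ≢ Q.w i → X (tv i x) ⊎ ProperAt (end (Q.G i)) (cutVal (Q.G i) (Q.e i) β ψ) x)

    perfect-off : ∀ {X : VN → Set} i {β y} (x : K) → halfSum β ≡ proj₁ x → rowSum y ≡ proj₁ x → PoleOff X i β y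
    perfect-off i x β-sum y-sum with ψ , ψ-y , proper ← Q.perfect i _ _ (λ eq → K-nonzero x (trans (sym β-sum) eq)) (trans β-sum (sym y-sum)) =
      ψ , ψ-y , λ z z≢w → inj₂ (proper z z≢w)

    -- Only pole `i` needs a colouring of its own. In the other two, the flows through both
    -- connectors are the same colour, hence equal and nonzero, and perfection applies.
    glue-at : ∀ X i hc hs (y p q : Fin 3 → K) (f g : K) →
      (∀ j → X (hv j) ⊎ HexAt hc hs j) →
      (∀ k → X (nv k) ⊎ Distinct₃ (y k) (p k) (q k)) →
      PoleOff X i (spokes hs i) y →
      halfSum (spokes hs (nx i)) ≡ proj₁ f → rowSum p ≡ proj₁ f →
      halfSum (spokes hs (nx (nx i))) ≡ proj₁ g → rowSum q ≡ proj₁ g → LabelledOff X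
    glue-at X i hc hs y p q f g hex-ok columns special p-half p-row q-half q-row =
      glue X hc hs (rotated i y p q) hex-ok (λ k → Sum.map₂ (distinct-rotated i) (columns k))
        (rotated-elim (λ j → PoleOff X j (spokes hs j)) i special
          (perfect-off {X} (nx i) f p-half p-row) (perfect-off {X} (nx (nx i)) g q-half q-row))

    pole-uncut : ∀ {X : VN → Set} i (ψ : Fin (nE (Q.G i)) → K) {β} → (∀ s → β s ≡ ψ (Q.e i)) →
      (∀ x → x ≢ Q.w i → X (tv i x) ⊎ EdgeProperAt (Q.G i) ψ x) → PoleOff X i β (λ k → ψ (proj₁ (Q.c i k)))
    pole-uncut i ψ β-eq ok = ψ , (λ _ → refl) , λ x x≢w → Sum.map₂
      (properAt-cong λ p _ → trans (sym (cutVal-uncut (Q.G i) (Q.e i) ψ p)) (cutVal-cong (Q.G i) (Q.e i) {ψ = ψ} (λ s → sym (β-eq s)) p)) (ok x x≢w)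

    spokes-eq : ∀ {i : Fin 3} {hs : Fin 6 → K} {x} → hs (spoke i L) ≡ x → hs (spoke i R) ≡ x → ∀ s → hs (spoke i s) ≡ x
    spokes-eq l r L = l
    spokes-eq l r R = r

    remove-inner : ∀ i {u v} → u ≢ v → u ≢ Q.w i → v ≢ Q.w i → Adjacent (Q.G i) u v → LabelledOff (Near (tv i u) (tv i v))
    remove-inner i {u} {v} u≢v u≢w v≢w adj =
      let ψ , ok = Q.critical i u v u≢v adj
          hc , hex-ok , hL , hR , f , p-half , q-half = hex-case₁ i (ψ (Q.e i))
          p , q , columns , p-row , q-row = rows-case₁ f (λ k → ψ (proj₁ (Q.c i k)))
            (apart ψ ok {0F} {1F} (λ ()) , apart ψ ok {0F} {2F} (λ ()) , apart ψ ok {1F} {2F} (λ ()))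
      in glue-at (Near (tv i u) (tv i v)) i hc (thirds hc) _ p q f f (λ j → inj₂ (hex-ok j)) (λ k → Sum.map₁ (λ ()) (columns k))
          (pole-uncut {Near (tv i u) (tv i v)} i ψ (spokes-eq {i} {thirds hc} hL hR) (λ x _ → off ψ ok x)) p-half p-row q-half q-row
      where
      Off : (Fin (nE (Q.G i)) → K) → Set
      Off ψ = ∀ x → x ≢ u → x ≢ v → EdgeProperAt (Q.G i) ψ x
      apart : ∀ ψ → Off ψ → ∀ {j k} → j ≢ k → ψ (proj₁ (Q.c i j)) ≢ ψ (proj₁ (Q.c i k))
      apart ψ ok {j} {k} j≢k = ok (Q.w i) (≢-sym u≢w) (≢-sym v≢w) (dart j) (dart k) (dart-at j) (dart-at k) (λ eq → j≢k (dart-inj eq))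
        where open Darts (Q.w-darts i)
      off : ∀ ψ → Off ψ → ∀ x → Near (tv i u) (tv i v) (tv i x) ⊎ EdgeProperAt (Q.G i) ψ x
      off ψ ok x with x ≟ u | x ≟ v
      ... | yes refl | _ = inj₁ (inj₁ refl)
      ... | no _ | yes refl = inj₁ (inj₂ refl)
      ... | no x≢u | no x≢v = inj₂ (ok x x≢u x≢v)

    -- Criticality for the pair `u`, w_i says nothing about the colours at w_i, so the row `y` is
    -- arbitrary. In return the new vertex `k` is removed, and column `k` is exempt.
    remove-outer : ∀ i k {u} → u ≢ Q.w i → Adjacent (Q.G i) u (Q.w i) → LabelledOff (Near (tv i u) (nv k))
    remove-outer i k {u} u≢w adj =
      let ψ , ok = Q.critical i u (Q.w i) u≢w adj
          hc , hex-ok , hL , hR , f , p-half , q-half = hex-case₁ i (ψ (Q.e i))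
          p , q , columns , p-row , q-row = rows-case₃ k f (λ k → ψ (proj₁ (Q.c i k)))
      in glue-at (Near (tv i u) (nv k)) i hc (thirds hc) _ p q f f (λ j → inj₂ (hex-ok j)) (λ l → Sum.map₁ (λ { refl → inj₂ refl }) (columns l))
          (pole-uncut {Near (tv i u) (nv k)} i ψ (spokes-eq {i} {thirds hc} hL hR) (off ψ ok)) p-half p-row q-half q-row
      where
      off : ∀ ψ → (∀ x → x ≢ u → x ≢ Q.w i → EdgeProperAt (Q.G i) ψ x) →
        ∀ x → x ≢ Q.w i → Near (tv i u) (nv k) (tv i x) ⊎ EdgeProperAt (Q.G i) ψ x
      off ψ ok x x≢w with x ≟ u
      ... | yes refl = inj₁ (inj₁ refl)
      ... | no x≢u = inj₂ (ok x x≢u x≢w)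

    -- The rows of the three poles are y, ω y and ω² y.
    remove-spoke : ∀ i s {u} → end (Q.G i) (Q.e i) s ≡ just u → LabelledOff (Near (hv (spoke i s)) (tv i u))
    remove-spoke i s {u} eu =
      let β , ψ , ok , y-row = Q.good i s
          x = β (flipS s)
          hc , hex-ok , h-far , h-near , p-half , q-half = hex-case₂ i s x (β s)
          hs = set (spoke i s) (β s) (thirds hc)
          y = λ k → ψ (proj₁ (Q.c i k))
          p-row = ω-row y x y-row
      in glue-at (Near (hv (spoke i s)) (tv i u)) i hc hs y (λ k → ω (y k)) (λ k → ω (ω (y k))) (ω x) (ω (ω x))
          (λ j → Sum.map₁ (λ { refl → inj₁ refl }) (hex-ok j)) (λ k → inj₂ (ω-distinct (y k)))
          (ψ , (λ _ → refl) , λ z z≢w → off β ψ (halves s β hs h-far h-near) ok z z≢w)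
          p-half p-row q-half (ω-row (λ k → ω (y k)) (ω x) p-row)
      where
      halves : ∀ s (β : Side → K) hs → hs (spoke i (flipS s)) ≡ β (flipS s) → hs (spoke i s) ≡ β s → ∀ t → β t ≡ hs (spoke i t)
      halves L β hs far near L = sym near
      halves L β hs far near R = sym far
      halves R β hs far near L = sym far
      halves R β hs far near R = sym near
      off : ∀ β ψ {β′ : Side → K} → (∀ t → β t ≡ β′ t) →
        (∀ x → x ≢ Q.w i → end (Q.G i) (Q.e i) s ≢ just x → ProperAt (end (Q.G i)) (cutVal (Q.G i) (Q.e i) β ψ) x) →
        ∀ x → x ≢ Q.w i → Near (hv (spoke i s)) (tv i u) (tv i x) ⊎ ProperAt (end (Q.G i)) (cutVal (Q.G i) (Q.e i) β′ ψ) x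
      off β ψ eq ok x x≢w with x ≟ u
      ... | yes refl = inj₁ (inj₂ refl)
      ... | no x≢u = inj₂ (properAt-cong (λ p _ → cutVal-cong (Q.G i) (Q.e i) {ψ = ψ} eq p)
        (ok x x≢w λ ex → x≢u (just-injective (trans (sym ex) eu))))

    -- Three equal colours sum to that colour, so the constant rows a, b, c match the flows from
    -- `hex-case₄`, and they differ in every column.
    remove-cycle : ∀ j → LabelledOff (Near (hv j) (hv (next j)))
    remove-cycle j = let hc , hs , hex-ok , halves = hex-case₄ j in
      glue (Near (hv j) (hv (next j))) hc hs (λ i _ → 3→K i)
        (λ k → Sum.map₁ (Sum.map (cong hv) (cong hv)) (hex-ok k))
        (λ k → inj₂ ((λ ()) , (λ ()) , (λ ())))
        (λ i → perfect-off {Near (hv j) (hv (next j))} i (3→K i) (halves i) (constant-row (3→K i)))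

    adjacent : ∀ i d s {u v} → end (Q.G i) d s ≡ just u → end (Q.G i) d (flipS s) ≡ just v → Adjacent (Q.G i) u v
    adjacent i d L du dv = d , inj₁ (du , dv)
    adjacent i d R du dv = d , inj₂ (dv , du)

    c-at : ∀ i k {d t} → Q.c i k ≡ (d , t) → end (Q.G i) d t ≡ just (Q.w i)
    c-at i k eq = subst (λ p → At (end (Q.G i)) p (Q.w i)) eq (Darts.dart-at (Q.w-darts i) k)

    remove-edge : ∀ n {a b} → live n → en n L ≡ just a → en n R ≡ just b → LabelledOff (Near a b)
    remove-edge (cy j) _ refl refl = remove-cycle j
    remove-edge (sp j) {b = b} _ refl eq =
      let i , s = unspoke j
          u , eu = Q.attached i (Q.e i) s
      in subst (λ x → LabelledOff (Near (hv j) x))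
           (just-injective (trans (sym (en-spoke i s eu)) (trans (cong (λ m → en (sp m) R) (spoke-unspoke j)) eq)))
           (subst (λ l → LabelledOff (Near (hv l) (tv i u))) (spoke-unspoke j) (remove-spoke i s eu))
    remove-edge (te i d) _ eqL eqR with en₁ (te i d) L | te-view i d L | en₁ (te i d) R | te-view i d R
    remove-edge (te i d) _ refl refl | _ | inner du u≢w | _ | inner dv v≢w =
      remove-inner i (λ { refl → Q.loopless i d du dv }) u≢w v≢w (adjacent i d L du dv)
    remove-edge (te i d) _ refl refl | _ | inner du u≢w | _ | outer k ck =
      remove-outer i k u≢w (adjacent i d L du (c-at i k ck))
    remove-edge (te i d) _ refl refl | _ | outer k ck | _ | inner dv v≢w =
      labelled-off-swap (remove-outer i k v≢w (adjacent i d R dv (c-at i k ck)))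
    remove-edge (te i d) _ refl refl | _ | outer k ck | _ | outer l cl =
      contradiction (c-at i l cl) (Q.loopless i d (c-at i k ck))

    critical : Critical F
    critical u v u≢v (i , adj) = let φ , ok = off adj in
        labelling⇒removing F u≢v φ λ x x≢u x≢v → Sum.fromInj₂
          (λ { (inj₁ eq) → contradiction (name-inj (verts ν) eq) x≢u ; (inj₂ eq) → contradiction (name-inj (verts ν) eq) x≢v }) (ok x)
      where
      off : (end F i L ≡ just u × end F i R ≡ just v) ⊎ (end F i L ≡ just v × end F i R ≡ just u) → LabelledOff (Near (vm u) (vm v))
      off (inj₁ (iu , iv)) = remove-edge (nm i) (name-live (edges ν) i) (at⇒named iu) (at⇒named iv)
      off (inj₂ (iv , iu)) = labelled-off-swap (remove-edge (nm i) (name-live (edges ν) i) (at⇒named iv) (at⇒named iu))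

    not-bicritical : ¬ Bicritical F
    not-bicritical bicritical = let φ , ok = removing⇒labelling F (bicritical (vert {nv 0F} tt) (vert {nv 1F} tt) distinct) in
        uncolourable φ λ y y≢nv → ok y (λ { refl → y≢nv 0F (vm-vert {nv 0F} tt) }) (λ { refl → y≢nv 1F (vm-vert {nv 1F} tt) })
      where
      distinct : vert {nv 0F} tt ≢ vert {nv 1F} tt
      distinct eq with () ← trans (sym (vm-vert {nv 0F} tt)) (trans (cong vm eq) (vm-vert {nv 1F} tt))

    -- Chromatic index

    K→4 : K → Fin 4
    K→4 x = inject₁ (K→3 x)

    K→4-injective : ∀ {x y} → K→4 x ≡ K→4 y → x ≡ y
    K→4-injective eq = K→3-injective (inject₁-injective eq)

    -- Every other edge of the 6-cycle gets the fourth colour.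
    four-colourable : F EdgeColourableWith 4
    four-colourable = let φ , ok = glue (λ _ → ⊥) hc (λ j → K→4 (hs j)) (λ i _ → K→4 (3→K i))
                                     hex-ok (λ _ → inj₂ ((λ ()) , (λ ()) , (λ ()))) sol in
        φ , λ y → properAt⇒allPairs F y (Sum.fromInj₂ ⊥-elim (ok y))
      where
      hc : Fin 6 → Fin 4
      hc = hex 3F 1F 3F 0F 3F 0F
      hs : Fin 6 → K
      -- Opposite spokes sum to a, b and c, which are the flows for three constant rows. The two
      -- spokes at the ends of a cycle edge without the fourth colour agree, so that edge has to
      -- avoid only one colour.
      hs = hex b′ a′ a′ c′ c′ b′
      hex-ok : ∀ j → ⊥ ⊎ HexAt hc (λ j → K→4 (hs j)) j
      hex-ok 0F = inj₂ ((λ ()) , (λ ()) , (λ ()))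
      hex-ok 1F = inj₂ ((λ ()) , (λ ()) , (λ ()))
      hex-ok 2F = inj₂ ((λ ()) , (λ ()) , (λ ()))
      hex-ok 3F = inj₂ ((λ ()) , (λ ()) , (λ ()))
      hex-ok 4F = inj₂ ((λ ()) , (λ ()) , (λ ()))
      hex-ok 5F = inj₂ ((λ ()) , (λ ()) , (λ ()))
      half-ok : ∀ i → halfSum (spokes hs i) ≡ proj₁ (3→K i)
      half-ok 0F = refl
      half-ok 1F = refl
      half-ok 2F = refl
      sol : ∀ i → ∃ λ (ψ : Fin (nE (Q.G i)) → Fin 4) → (∀ k → ψ (proj₁ (Q.c i k)) ≡ K→4 (3→K i)) ×
        (∀ x → x ≢ Q.w i → ⊥ ⊎ ProperAt (end (Q.G i)) (cutVal (Q.G i) (Q.e i) (λ s → K→4 (hs (spoke i s))) ψ) x)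
      sol i = let ψ , ψ-y , ok = perfect-off {λ _ → ⊥} i {spokes hs i} {λ _ → 3→K i} (3→K i) (half-ok i) (constant-row (3→K i)) in
        (λ d → K→4 (ψ d)) , (λ k → cong K→4 (ψ-y k)) , λ x x≢w → Sum.map₂
          (λ pr → properAt-cong (λ p _ → cutVal-map (Q.G i) (Q.e i) K→4 (spokes hs i) ψ p) (properAt-recolour K→4 K→4-injective pr)) (ok x x≢w)

    chromatic-index : ChromaticIndex F 4
    chromatic-index = four-colourable , λ { j (s≤s j≤3) (φ , ok) →
      uncolourable (λ i → 3→K (inject≤ (φ i) j≤3)) λ y _ →
        properAt-recolour (λ x → 3→K (inject≤ x j≤3)) (λ eq → inject≤-injective j≤3 j≤3 _ _ (3→K-injective eq))
          (allPairs⇒properAt F y (ok y)) }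

    -- Connectedness

    private
      comps : Components F (allFin (nE F))
      comps = components F (allFin (nE F))

      rep : Fin (nV F) → Fin (nV F)
      rep = proj₁ comps

    root : Fin (nV F)
    root = rep (vert {hv 0F} tt)

    -- Quantified over all vertices with the name `x`, hence vacuous for dead names.
    Reached : VN → Set
    Reached x = ∀ y → vm y ≡ x → rep y ≡ root

    reached-vert : ∀ {x} (l : vlive x) → rep (vert l) ≡ root → Reached x
    reached-vert l eq y refl = trans (cong rep (name-inj (verts ν) (sym (vm-vert l)))) eq

    joined : ∀ {n a b} → live n → en n L ≡ just a → en n R ≡ just b → ∀ {y z} → vm y ≡ a → vm z ≡ b → rep y ≡ rep z
    joined l nL nR ya zb = proj₂ (proj₂ comps) (∈-allFin (edge l)) (named⇒at-edge l L nL ya) (named⇒at-edge l R nR zb)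

    across : ∀ n {a b} → live n → vlive a → ∀ s → en n s ≡ just a → en n (flipS s) ≡ just b → Reached a → Reached b
    across n l va L na nb ra y yb = trans (sym (joined l na nb (vm-vert va) yb)) (ra (vert va) (vm-vert va))
    across n l va R na nb ra y yb = trans (joined l nb na yb (vm-vert va)) (ra (vert va) (vm-vert va))

    hexagon-reached : ∀ j → Reached (hv j)
    hexagon-reached = λ { 0F → r₀ ; 1F → r₁ ; 2F → r₂ ; 3F → r₃ ; 4F → r₄ ; 5F → step 4F r₄ }
      where
      step : ∀ j → Reached (hv j) → Reached (hv (next j))
      step j = across (cy j) tt tt L refl refl
      r₀ = reached-vert {hv 0F} tt refl
      r₁ = step 0F r₀
      r₂ = step 1F r₁
      r₃ = step 2F r₂
      r₄ = step 3F r₃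
    half-reached : ∀ i s {x} → end (Q.G i) (Q.e i) s ≡ just x → Reached (tv i x)
    half-reached i s ex = across (sp (spoke i s)) tt tt L refl (en-spoke i s ex) (hexagon-reached (spoke i s))

    reached? : ∀ {x} → vlive x → Dec (Reached x)
    reached? l with rep (vert l) ≟ root
    ... | yes eq = yes (reached-vert l eq)
    ... | no ne  = no λ r → ne (r (vert l) (vm-vert l))

    module _ (i : Fin 3) where

      private
        G = Q.G i
        e = Q.e i
        w = Q.w i

      Missed : Maybe (Fin (nV G)) → Bool
      Missed nothing  = false
      Missed (just x) with x ≟ w
      ... | yes _  = false
      ... | no x≢w = not (does (reached? {tv i x} x≢w))

      missed : Fin 3 → Bool
      missed k = not (does (reached? {nv k} tt))

      -- `reached?` takes a proof of `x ≢ w` as an argument, so two decisions of the same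
      -- proposition, made from different proofs, have to be compared.
      Missed-live : ∀ {x} (x≢w : x ≢ w) → Missed (just x) ≡ not (does (reached? {tv i x} x≢w))
      Missed-live {x} x≢w with x ≟ w
      ... | yes eq = contradiction eq x≢w
      ... | no x≢w′ with reached? {tv i x} x≢w
      ...   | yes r = cong not (dec-true (reached? {tv i x} x≢w′) r)
      ...   | no ¬r = cong not (dec-false (reached? {tv i x} x≢w′) ¬r)

      dec-⇔ : ∀ {A B : Set} (a : Dec A) (b : Dec B) → (A → B) → (B → A) → does a ≡ does b
      dec-⇔ (yes a) b f g = sym (dec-true b (f a))
      dec-⇔ (no ¬a) b f g = sym (dec-false b (λ b → ¬a (g b)))

      Missed-at : ∀ {m x} → m ≡ just x → (x≢w : x ≢ w) → Missed m ≡ not (does (reached? {tv i x} x≢w))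
      Missed-at refl = Missed-live

      Missed-w : Missed (just w) ≡ false
      Missed-w with w ≟ w
      ... | yes _ = refl
      ... | no ne = contradiction refl ne

      Missed-sound : ∀ v → Missed (just v) ≡ true → v ≢ w
      Missed-sound v eq refl with () ← trans (sym eq) Missed-w

      Missed-e : ∀ s → Missed (end G e s) ≡ false
      Missed-e s = by-vertex (proj₂ (Q.attached i e s))
        where
        by-vertex : ∀ {x} → end G e s ≡ just x → Missed (end G e s) ≡ false
        by-vertex {x} ex = trans (Missed-at ex x≢w) (cong not (dec-true (reached? {tv i x} x≢w) (half-reached i s ex)))
          where
          x≢w : x ≢ w
          x≢w refl = Q.e∌w i s ex

      Missed-closed : ∀ d → d ≢ e → end G d L ≢ just w → end G d R ≢ just w → Missed (end G d L) ≡ Missed (end G d R)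
      Missed-closed d d≢e dL dR = by-vertices (proj₂ (Q.attached i d L)) (proj₂ (Q.attached i d R))
        where
        by-vertices : ∀ {x y} → end G d L ≡ just x → end G d R ≡ just y → Missed (end G d L) ≡ Missed (end G d R)
        by-vertices {x} {y} dx dy = trans (Missed-at dx x≢w) (trans (cong not
          (dec-⇔ (reached? {tv i x} x≢w) (reached? {tv i y} y≢w)
            (across (te i d) d≢e x≢w L (en₁-inner dx x≢w) (en₁-inner dy y≢w))
            (across (te i d) d≢e y≢w R (en₁-inner dy y≢w) (en₁-inner dx x≢w)))) (sym (Missed-at dy y≢w)))
          where
          x≢w : x ≢ w
          x≢w refl = dL dx
          y≢w : y ≢ w
          y≢w refl = dR dy

      Missed-far : ∀ k → Missed (c-far (Piece.P (Q i)) k) ≡ missed k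
      Missed-far k = by-vertex (proj₂ (Q.attached i d (flipS s)))
        where
        d = proj₁ (Q.c i k)
        s = proj₂ (Q.c i k)
        far : ∀ s → end G d s ≡ just w → end G d (flipS s) ≢ just w
        far L a b = Q.loopless i d a b
        far R a b = Q.loopless i d b a
        by-vertex : ∀ {x} → end G d (flipS s) ≡ just x → Missed (end G d (flipS s)) ≡ missed k
        by-vertex {x} dx = trans (Missed-at dx x≢w) (cong not (dec-⇔ (reached? {tv i x} x≢w) (reached? {nv k} tt)
            (across (te i d) (Q.c≢e i k) x≢w (flipS s) (en₁-inner dx x≢w) (trans (cong (en₁ (te i d)) (flipS-involutive s)) (en₁-c i k)))
            (across (te i d) (Q.c≢e i k) tt s (en₁-c i k) (en₁-inner dx x≢w))))
          where
          x≢w : x ≢ w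
          x≢w refl = far s (Darts.dart-at (Q.w-darts i) k) dx

      -- The ends of e_i are reached through the spokes, so the boundary of the missed part consists
      -- of edges at w_i. Such an edge joins its far end to a new vertex in the composite, so both
      -- are missed or neither is.
      missed-sum : ∀ {β y} → halfSum β ≡ proj₁ a′ → rowSum y ≡ proj₁ a′ → sum (λ k → missed k · proj₁ (y k)) ≡ 0₂
      missed-sum {β} {y} β-sum y-sum = by-colouring (Q.perfect i β y (λ eq → K-nonzero a′ (trans (sym β-sum) eq)) (trans β-sum (sym y-sum)))
        where
        by-colouring : (∃[ ψ ] (∀ k → ψ (proj₁ (Q.c i k)) ≡ y k) × Q.ProperPole i β ψ) → sum (λ k → missed k · proj₁ (y k)) ≡ 0₂
        by-colouring (ψ , ψ-y , proper) = trans (sum-cong-≗ λ k → sym (cong₂ (λ b x → b · proj₁ x) (Missed-far k) (ψ-y k)))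
          (trans (sym (cong (_⊕ sum (λ k → Missed (c-far P k) · proj₁ (ψ (proj₁ (Q.c i k))))) halves))
            (pole-parity P (λ s → proj₁ (β s)) (λ d → proj₁ (ψ d)) Missed refl Missed-w zero-sum Missed-closed))
          where
          P = Piece.P (Q i)
          halves : (Missed (end G e L) · proj₁ (β L)) ⊕ (Missed (end G e R) · proj₁ (β R)) ≡ 0₂
          halves = cong₂ (λ b b′ → (b · proj₁ (β L)) ⊕ (b′ · proj₁ (β R))) (Missed-e L) (Missed-e R)
          zero-sum : ∀ v → Missed (just v) ≡ true → sum (λ k → poleVal P (λ s → proj₁ (β s)) (λ d → proj₁ (ψ d)) (Darts.dart (Q.darts i v) k)) ≡ 0₂
          zero-sum v Mv = trans (sum-cong-≗ λ k → sym (cutVal-map G e proj₁ β ψ (dart k)))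
            (distinct-sum (val 0F) (val 1F) (val 2F) (apart (λ ())) (apart (λ ())) (apart (λ ())))
            where
            open Darts (Q.darts i v)
            val : Fin 3 → K
            val k = cutVal G e β ψ (dart k)
            apart : ∀ {j k} → j ≢ k → val j ≢ val k
            apart {j} {k} j≢k = proper v (Missed-sound v Mv) (dart j) (dart k) (dart-at j) (dart-at k) (λ eq → j≢k (dart-inj eq))

    -- Both rows have sum a, and in either of them the only nonempty set of columns with sum zero is
    -- the pair of entries b. The flag tells whether column 0 is missed. If it is, that pair is
    -- columns 1 and 2, and the missed set contains column 0; if not, the pair is columns 0 and 1,
    -- and the missed set omits column 0.
    separating-row : Bool → Fin 3 → K
    separating-row true  = row a′ b′ b′
    separating-row false = row b′ b′ a′

    separating-sum : ∀ (m : Fin 3 → Bool) k → m k ≡ true → sum (λ k → m k · proj₁ (separating-row (m 0F) k)) ≢ 0₂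
    separating-sum m k mk = cases (m 0F) (m 1F) (m 2F) (witness k mk)
      where
      witness : ∀ k → m k ≡ true → m 0F ≡ true ⊎ m 1F ≡ true ⊎ m 2F ≡ true
      witness 0F e = inj₁ e
      witness 1F e = inj₂ (inj₁ e)
      witness 2F e = inj₂ (inj₂ e)
      cases : ∀ m₀ m₁ m₂ → m₀ ≡ true ⊎ m₁ ≡ true ⊎ m₂ ≡ true →
        (m₀ · proj₁ (separating-row m₀ 0F)) ⊕ ((m₁ · proj₁ (separating-row m₀ 1F)) ⊕ ((m₂ · proj₁ (separating-row m₀ 2F)) ⊕ 0₂)) ≢ 0₂
      cases true  true  true  _ ()
      cases true  true  false _ ()
      cases true  false true  _ ()
      cases true  false false _ ()
      cases false true  true  _ ()
      cases false true  false _ ()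
      cases false false true  _ ()
      cases false false false (inj₁ ())
      cases false false false (inj₂ (inj₁ ()))
      cases false false false (inj₂ (inj₂ ()))

    separating-row-sum : ∀ b → rowSum (separating-row b) ≡ proj₁ a′
    separating-row-sum true  = refl
    separating-row-sum false = refl

    -- Otherwise perfection of T₁ provides a colouring that violates parity
    -- on the part of T₁ that is not reached.
    new-reached : ∀ k → Reached (nv k)
    new-reached k with reached? {nv k} tt in eq
    ... | yes r = r
    ... | no _  = ⊥-elim (separating-sum (missed 0F) k (cong (λ d → not (does d)) eq)
      -- The halves b and c give the flow a, the sum of either separating row.
      (missed-sum 0F {λ { L → b′ ; R → c′ }} {separating-row (missed 0F 0F)} refl (separating-row-sum (missed 0F 0F))))

    -- Follow a path of the i-th graph from `x` to w_i. If it uses e_i, an end of e_i is reached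
    -- through a spoke; otherwise its last edge leads, in the composite, to a new vertex.
    pole-reached : ∀ i x → x ≢ Q.w i → Reached (tv i x)
    pole-reached i x x≢w = along (Q.connected i x (Q.w i)) x≢w
      where
      G = Q.G i
      along : ∀ {x} → Star (Adjacent G) x (Q.w i) → x ≢ Q.w i → Reached (tv i x)
      step : ∀ {x z} d s → end G d s ≡ just x → end G d (flipS s) ≡ just z → Star (Adjacent G) z (Q.w i) → x ≢ Q.w i → Reached (tv i x)
      along ε x≢w = contradiction refl x≢w
      along ((d , inj₁ (dx , dz)) ◅ path) x≢w = step d L dx dz path x≢w
      along ((d , inj₂ (dz , dx)) ◅ path) x≢w = step d R dx dz path x≢w
      step {x} {z} d s dx dz path x≢w with d ≟ Q.e i | z ≟ Q.w i
      ... | yes refl | _ = half-reached i s dx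
      ... | no d≢e | no z≢w = across (te i d) d≢e z≢w (flipS s) (en₁-inner dz z≢w)
        (en₁-inner (trans (cong (end G d) (flipS-involutive s)) dx) x≢w) (along path z≢w)
      ... | no d≢e | yes refl with k , ck ← Darts.dart-onto (Q.w-darts i) (d , flipS s) dz =
        across (te i d) d≢e tt (flipS s) (subst (λ p → en₁ (te i (proj₁ p)) (proj₂ p) ≡ just (nv k)) ck (en₁-c i k))
          (en₁-inner (trans (cong (end G d) (flipS-involutive s)) dx) x≢w) (new-reached k)

    reached : ∀ x → vlive x → Reached x
    reached (hv j)   _   = hexagon-reached j
    reached (tv i x) x≢w = pole-reached i x x≢w
    reached (nv k)   _   = new-reached k

    connected : Connected F
    connected u v = to-root u ◅◅ ⟶*-sym F (to-root v)
      where
      to-root : ∀ y → Star (Adjacent F) y root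
      to-root y = subst (Star (Adjacent F) y) (reached (vm y) (name-live (verts ν) y) y refl) (proj₁ (proj₂ comps) y)

    strictlyCriticalSnark : StrictlyCriticalSnark F
    strictlyCriticalSnark = (isGraph , cubic , connected , chromatic-index) , critical , not-bicritical

assembled : (Q : Fin 3 → Piece) → ∀ T₁ T₂ T₃ →
  T₁ ≡ Piece.pole (Q 0F) → T₂ ≡ Piece.pole (Q 1F) → T₃ ≡ Piece.pole (Q 2F) →
  StrictlyCriticalSnark (H6⋆ (TTTsc T₁ T₂ T₃))
assembled Q T₁ T₂ T₃ eq₁ eq₂ eq₃ =
  Composite.Graph.strictlyCriticalSnark Q (H6⋆ (TTTsc T₁ T₂ T₃)) (Composition.named-F Q {T₁} {T₂} {T₃} eq₁ eq₂ eq₃)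

theorem4 : (G₁ G₂ G₃ : Multipole)
    (e₁ : Fin (nE G₁)) (w₁ : Fin (nV G₁)) → Admissible G₁ e₁ w₁ →
    (e₂ : Fin (nE G₂)) (w₂ : Fin (nV G₂)) → Admissible G₂ e₂ w₂ →
    (e₃ : Fin (nE G₃)) (w₃ : Fin (nV G₃)) → Admissible G₃ e₃ w₃ →
    StrictlyCriticalSnark (H6⋆ (TTTsc (T23 G₁ e₁ w₁) (T23 G₂ e₂ w₂) (T23 G₃ e₃ w₃)))
theorem4 G₁ G₂ G₃ e₁ w₁ adm₁ e₂ w₂ adm₂ e₃ w₃ adm₃ =
  assembled pieces (T23 G₁ e₁ w₁) (T23 G₂ e₂ w₂) (T23 G₃ e₃ w₃) refl refl refl
  where
  pieces : Fin 3 → Piece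
  pieces 0F = admissiblePiece G₁ e₁ w₁ adm₁
  pieces 1F = admissiblePiece G₂ e₂ w₂ adm₂
  pieces 2F = admissiblePiece G₃ e₃ w₃ adm₃
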